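{- Every maximal clique of the graph $\Gamma$ has size three, where $\Gamma$ is the graph whose vertices are the elliptic ovoids of the symplectic subquadrangles of the Hermitian surface $\mathcal{H}(3,4)$ of $\mathrm{PG}(3,4)$, two vertices being adjacent whenever they meet in exactly one point and their symplectic subquadrangles meet in exactly six points.
   Context: A maximal clique is a set of pairwise adjacent vertices that is not properly contained in a larger set of pairwise adjacent vertices. Let $\perp$ be a non-degenerate unitary polarity of $\mathrm{PG}(3,4)$ and let $\mathcal{H}(3,4)$ be the Hermitian surface it defines, i.e. the incidence structure of the points and lines of $\mathrm{PG}(3,4)$ that are totally isotropic with respect to $\perp$ (it has $45$ points and $27$ lines, and is a generalized quadrangle of order $(4,2)$). Symplectic subquadrangles: let $\Sigma$ be a Baer subgeometry of $\mathrm{PG}(3,4)$, i.e. a subgeometry isomorphic to $\mathrm{PG}(3,2)$, and let $\mathcal{W}=\mathcal{W}(3,2)$ be the incidence structure of all points of $\Sigma$ (there are $15$) and of the $15$ lines of $\Sigma$ (called generators of $\mathcal{W}$) that are totally isotropic with respect to a non-degenerate symplectic polarity of $\Sigma$. This polarity extends uniquely to a symplectic polarity $\tilde{\perp}$ of $\mathrm{PG}(3,4)$. $\mathcal{W}$ is called a symplectic subquadrangle of $\mathcal{H}(3,4)$ if $\tilde{\perp}\perp=\perp\tilde{\perp}=\sigma$, where $\sigma$ is a semilinear involution whose set of fixed points is $\Sigma$ (so all points of $\Sigma$ lie on $\mathcal{H}(3,4)$ and $\perp$, $\tilde{\perp}$ induce the same polarity on $\Sigma$). For two symplectic subquadrangles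 $\mathcal{W},\mathcal{W}'$, the intersection $\mathcal{W}\cap\mathcal{W}'$ denotes the set of their common points; "meeting in $n$ points" means $|\mathcal{W}\cap\mathcal{W}'|=n$. Elliptic ovoids: an elliptic ovoid of $\mathcal{W}$ is an elliptic quadric $\mathcal{Q}^-(3,2)$ of $\Sigma$ (a set of $5$ points) such that the lines of $\Sigma$ tangent to it (meeting it in exactly one point) are precisely the $15$ generators of $\mathcal{W}$. An elliptic quadric of $\Sigma$ determines a unique symplectic quadrangle $\mathcal{W}$ of $\Sigma$ in this way, called the symplectic subquadrangle of the elliptic ovoid. -}

module Defs where

open import Algebra.Bundles using (CommutativeRing)
open import Algebra.Bundles.Raw using (RawRing)
import Algebra.Definitions as AlgebraDefinitions
open import Algebra.Morphism.Structures using (IsRingIsomorphism)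
open import Data.Bool.Base using (Bool; true; false)
open import Data.Bool.Properties using (xor-∧-commutativeRing)
open import Data.Fin.Base using (Fin)
open import Data.Fin.Subset using (Subset; _∩_; ∣_∣) renaming (_∈_ to _∈ₛ_)
open import Data.List.Base using (List)
open import Data.List.Membership.Propositional using () renaming (_∈_ to _∈ₗ_)
open import Data.List.Relation.Binary.Subset.Propositional using () renaming (_⊆_ to _⊆ₗ_)
open import Data.List.Relation.Unary.Unique.Propositional using (Unique)
open import Data.Nat.Base as ℕ using (ℕ; zero; suc)
open import Data.Product.Base using (Σ; ∃; ∃-syntax; _×_)
open import Data.Vec.Base using (Vec; []; _∷_; _++_; concat; foldr′; lookup; map; replicate; zipWith)
open import Function.Base using (id)
open import Function.Bundles using (_⇔_)
open import Level using (0ℓ)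
open import Relation.Binary.Core using (Rel)
open import Relation.Binary.PropositionalEquality using (_≡_; _≢_)
open import Relation.Nullary.Negation using (¬_)
open import Relation.Unary using (Pred; _≐_; ｛_｝)

module LinearAlgebra (R : RawRing 0ℓ 0ℓ) where

  open RawRing R

  infixl 6 _⊕_
  infixr 7 _·_

  Vector : ℕ → Set
  Vector n = Vec Carrier n

  𝟎 : ∀ {n} → Vector n
  𝟎 {n} = replicate n 0#

  _⊕_ : ∀ {n} → Vector n → Vector n → Vector n
  _⊕_ = zipWith _+_

  _·_ : ∀ {n} → Carrier → Vector n → Vector n
  c · v = map (c *_) v

  combination : ∀ {k n} → Vector k → Vec (Vector n) k → Vector n
  combination c vs = foldr′ _⊕_ 𝟎 (zipWith _·_ c vs)

  LinearlyIndependent : ∀ {k n} → Vec (Vector n) k → Set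
  LinearlyIndependent vs = ∀ c → combination c vs ≡ 𝟎 → c ≡ 𝟎

  Form : ℕ → Set
  Form n = Vector n → Vector n → Carrier

  record IsSesquilinear {n} (θ : Carrier → Carrier) (g : Form n) : Set where
    field
      additiveˡ    : ∀ u v w → g (u ⊕ v) w ≡ g u w + g v w
      additiveʳ    : ∀ u v w → g u (v ⊕ w) ≡ g u v + g u w
      homogeneousˡ : ∀ c u v → g (c · u) v ≡ c * g u v
      homogeneousʳ : ∀ c u v → g u (c · v) ≡ θ c * g u v

  IsBilinear : ∀ {n} → Form n → Set
  IsBilinear = IsSesquilinear id

  NonDegenerate : ∀ {n} → Form n → Set
  NonDegenerate g = ∀ u → (∀ v → g u v ≡ 0#) → u ≡ 𝟎

  record IsSymplectic {n} (g : Form n) : Set where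
    field
      bilinear      : IsBilinear g
      alternating   : ∀ u → g u u ≡ 0#
      nonDegenerate : NonDegenerate g

  polarForm : ∀ {n} → (Vector n → Carrier) → Form n
  polarForm Q u v = Q (u ⊕ v) + - Q u + - Q v

  record IsQuadratic {n} (Q : Vector n → Carrier) : Set where
    field
      homogeneous : ∀ c v → Q (c · v) ≡ (c * c) * Q v
      bilinear    : IsBilinear (polarForm Q)

  -- A non-singular quadratic form in four variables is elliptic (of
  -- type Q⁻(3,q)) when its Witt index is 1: there are singular points,
  -- but no totally singular lines.
  record IsElliptic (Q : Vector 4 → Carrier) : Set where
    field
      quadratic       : IsQuadratic Q
      nonSingular     : ∀ u → Q u ≡ 0# → (∀ v → polarForm Q u v ≡ 0#) → u ≡ 𝟎
      singularPoint   : ∃[ u ] (u ≢ 𝟎 × Q u ≡ 0#)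
      noSingularLines : ∀ u v → LinearlyIndependent (u ∷ v ∷ []) →
                        ¬ (∀ c → Q (combination c (u ∷ v ∷ [])) ≡ 0#)

GF2 : RawRing 0ℓ 0ℓ
GF2 = CommutativeRing.rawRing xor-∧-commutativeRing

-- ω̄ is ω² = ω + 1.
data 𝔽₄ : Set where
  O I ω ω̄ : 𝔽₄

infixl 6 _+₄_
infixl 7 _*₄_

_+₄_ : 𝔽₄ → 𝔽₄ → 𝔽₄
O +₄ y = y
I +₄ O = I
I +₄ I = O
I +₄ ω = ω̄
I +₄ ω̄ = ω
ω +₄ O = ω
ω +₄ I = ω̄
ω +₄ ω = O
ω +₄ ω̄ = I
ω̄ +₄ O = ω̄
ω̄ +₄ I = ω
ω̄ +₄ ω = I
ω̄ +₄ ω̄ = O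

_*₄_ : 𝔽₄ → 𝔽₄ → 𝔽₄
O *₄ y = O
I *₄ y = y
ω *₄ O = O
ω *₄ I = ω
ω *₄ ω = ω̄
ω *₄ ω̄ = I
ω̄ *₄ O = O
ω̄ *₄ I = ω̄
ω̄ *₄ ω = I
ω̄ *₄ ω̄ = ω

-- Negation is the identity, the characteristic being 2.
GF4 : RawRing 0ℓ 0ℓ
GF4 = record
  { Carrier = 𝔽₄ ; _≈_ = _≡_ ; _+_ = _+₄_ ; _*_ = _*₄_ ; -_ = id ; 0# = O ; 1# = I }

frobenius : 𝔽₄ → 𝔽₄
frobenius x = x *₄ x

ι : Bool → 𝔽₄
ι false = O
ι true  = I

module L₂ = LinearAlgebra GF2
module L₄ = LinearAlgebra GF4

open L₄ using (_⊕_; _·_; 𝟎)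

allVectors : ∀ n → Vec (L₄.Vector n) (4 ℕ.^ n)
allVectors zero    = [] ∷ []
allVectors (suc n) = concat (map (λ a → map (a ∷_) (allVectors n)) (O ∷ I ∷ ω ∷ ω̄ ∷ []))

numPoints : ℕ → ℕ
numPoints zero    = 0
numPoints (suc n) = 4 ℕ.^ n ℕ.+ numPoints n

-- The vectors whose first non-zero coordinate is 1, one for each
-- one-dimensional subspace.
normalised : ∀ n → Vec (L₄.Vector n) (numPoints n)
normalised zero    = []
normalised (suc n) = map (I ∷_) (allVectors n) ++ map (O ∷_) (normalised n)

-- numPoints 4 evaluates to 85.
Point : Set
Point = Fin (numPoints 4)

PointSet : Set
PointSet = Subset (numPoints 4)

coords : Point → L₄.Vector 4
coords = lookup (normalised 4)

infix 4 _represents_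

_represents_ : L₄.Vector 4 → Point → Set
v represents p = ∃[ c ] (c ≢ O × v ≡ c · coords p)

-- S ^⊥ for the polarity ⊥ defined by g, on arbitrary sets of points.
perp : L₄.Form 4 → Pred Point 0ℓ → Pred Point 0ℓ
perp g S p = ∀ q → S q → g (coords q) (coords p) ≡ O

-- Non-degenerate unitary polarities are those given by non-degenerate
-- Hermitian forms.
record IsUnitary (h : L₄.Form 4) : Set where
  field
    sesquilinear  : L₄.IsSesquilinear frobenius h
    hermitian     : ∀ u v → h v u ≡ frobenius (h u v)
    nonDegenerate : L₄.NonDegenerate h

record IsSemilinear (θ : 𝔽₄ → 𝔽₄) (T : L₄.Vector 4 → L₄.Vector 4) : Set where
  field
    automorphism : IsRingIsomorphism GF4 GF4 θ
    additive     : ∀ u v → T (u ⊕ v) ≡ T u ⊕ T v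
    homogeneous  : ∀ c v → T (c · v) ≡ θ c · T v
    injective    : ∀ v → T v ≡ 𝟎 → v ≡ 𝟎

record IsSemilinearInvolution (σ : Point → Point) : Set where
  open AlgebraDefinitions {A = Point} _≡_ using (Involutive)
  field
    θ          : 𝔽₄ → 𝔽₄
    T          : L₄.Vector 4 → L₄.Vector 4
    semilinear : IsSemilinear θ T
    induces    : ∀ p → T (coords p) represents σ p
    -- σ ≢ id is not imposed: where this is used, σ fixes exactly a Baer
    -- subgeometry.
    involutive : Involutive σ

-- A Baer subgeometry consists of the points having coordinates in GF(2)
-- with respect to some basis of GF(4)⁴.
record BaerSubgeometry : Set where
  field
    basis       : Vec (L₄.Vector 4) 4
    independent : L₄.LinearlyIndependent basis

  embed : L₂.Vector 4 → L₄.Vector 4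
  embed x = L₄.combination (map ι x) basis

  -- The points of the subgeometry whose coordinate vector satisfies P
  -- are exactly those of S.
  Locus : Pred (L₂.Vector 4) 0ℓ → PointSet → Set
  Locus P S = ∀ p → p ∈ₛ S ⇔ (∃[ x ] (x ≢ L₂.𝟎 × P x × embed x represents p))

  field
    points      : PointSet
    points-spec : ∀ p → p ∈ₛ points ⇔ (∃[ x ] (x ≢ L₂.𝟎 × embed x represents p))

  record Line : Set where
    field
      x y              : L₂.Vector 4
      line-independent : L₂.LinearlyIndependent (x ∷ y ∷ [])

    at : L₂.Vector 2 → L₂.Vector 4
    at c = L₂.combination c (x ∷ y ∷ [])

    field
      line-points : PointSet
      line-spec   : Locus (λ z → ∃[ c ] z ≡ at c) line-points

  TotallyIsotropic : L₂.Form 4 → Line → Set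
  TotallyIsotropic f ℓ = ∀ c d → f (at c) (at d) ≡ false
    where open Line ℓ

  Tangent : PointSet → Line → Set
  Tangent S ℓ = ∣ Line.line-points ℓ ∩ S ∣ ≡ 1

  IsEllipticQuadric : PointSet → Set
  IsEllipticQuadric S = ∃[ Q ] (L₂.IsElliptic Q × Locus (λ x → Q x ≡ false) S)

-- h is the Hermitian form of the surface.
record SymplecticSubquadrangle (h : L₄.Form 4) : Set where
  field
    baer : BaerSubgeometry

  open BaerSubgeometry baer public

  field
    form       : L₂.Form 4
    symplectic : L₂.IsSymplectic form

    form~       : L₄.Form 4
    symplectic~ : L₄.IsSymplectic form~
    extends     : ∀ x y → form~ (embed x) (embed y) ≡ ι (form x y)

    σ            : Point → Point
    σ-involution : IsSemilinearInvolution σ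
    σ-fixes      : ∀ p → p ∈ₛ points ⇔ σ p ≡ p

    -- Both composites of the two polarities are σ.  A composite of two
    -- polarities is a collineation, so comparing on points suffices.
    perp∘perp~   : ∀ p → perp h (perp form~ ｛ p ｝) ≐ ｛ σ p ｝
    perp~∘perp   : ∀ p → perp form~ (perp h ｛ p ｝) ≐ ｛ σ p ｝

record IsEllipticOvoidOf {h : L₄.Form 4} (W : SymplecticSubquadrangle h) (S : PointSet) : Set where
  open SymplecticSubquadrangle W
  field
    quadric             : IsEllipticQuadric S
    tangents-generators : ∀ (ℓ : Line) → Tangent S ℓ ⇔ TotallyIsotropic form ℓ

IsVertex : L₄.Form 4 → Pred PointSet 0ℓ
IsVertex h S = Σ (SymplecticSubquadrangle h) λ W → IsEllipticOvoidOf W S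

-- The subquadrangle of an elliptic ovoid is determined by the ovoid (its
-- five points are a frame of the subgeometry), hence "the subquadrangles
-- meet in six points" may be stated with existential quantifiers.
Adjacent : L₄.Form 4 → Rel PointSet 0ℓ
Adjacent h S S′ =
  ∣ S ∩ S′ ∣ ≡ 1 ×
  ∃[ W ] ∃[ W′ ] (IsEllipticOvoidOf {h} W S × IsEllipticOvoidOf {h} W′ S′ ×
                  ∣ points W ∩ points W′ ∣ ≡ 6)
  where open SymplecticSubquadrangle using (points)

-- A graph with finitely many vertices: sets of vertices are lists without
-- repetitions, up to order.
module _ {A : Set} (Vertex : Pred A 0ℓ) (_~_ : Rel A 0ℓ) where

  record IsClique (C : List A) : Set where
    field
      unique   : Unique C
      vertices : ∀ {u} → u ∈ₗ C → Vertex u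
      adjacent : ∀ {u v} → u ∈ₗ C → v ∈ₗ C → u ≢ v → u ~ v

  record IsMaximalClique (C : List A) : Set where
    field
      clique  : IsClique C
      maximal : ∀ D → IsClique D → C ⊆ₗ D → D ⊆ₗ C

{-# OPTIONS --safe #-}
module Submission where

-- Let v₁, …, v₅ represent the points of an elliptic ovoid, over the field of
-- two elements of its subgeometry, with sum zero.  Since ⊥ and the symplectic
-- polarity agree on the subgeometry, and since a line on two points of the
-- ovoid is not a tangent, h vᵢ vⱼ = 1 for i ≠ j and h vᵢ vᵢ = 0; the
-- subquadrangle consists of the points ⟨vᵢ⟩ and ⟨vᵢ + vⱼ⟩.  Conversely, all
-- such "frames" v give elliptic ovoids, the symplectic form being h u (τ w),
-- where τ applies the Frobenius map to the coordinates with respect to v.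
--
-- In the coordinates of a frame the Hermitian form has a fixed Gram matrix Γ,
-- so one ovoid may be taken to be the standard one, and the ovoids adjacent to
-- it can be enumerated: there are forty.  Each of them is adjacent to another
-- one, and no three of them are pairwise adjacent.  So every edge of the graph
-- lies in a triangle, and there are no cliques of size four.

open import Defs
open import Algebra.Morphism.Structures using (IsRingIsomorphism)
open import Data.Bool.Base as Bool using (Bool; true; false; _∧_; _xor_; if_then_else_)
import Data.Bool.Properties as Bool
open import Data.Empty using (⊥; ⊥-elim)
open import Data.Fin.Base as Fin using (Fin; zero; suc)
open import Data.Fin.Permutation using (Permutation′; permutation; _⟨$⟩ʳ_)
open import Data.Fin.Patterns using (0F; 1F; 2F; 3F)
import Data.Fin.Properties as Fin
open import Data.Fin.Subset using (Subset; _∩_; ∣_∣; ⁅_⁆) renaming (_∈_ to _∈ₛ_)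
open import Data.Fin.Subset.Properties
  using (⊆-antisym; x∈⁅y⁆⇒x≡y; x∈⁅x⁆; ∣⁅x⁆∣≡1; nonempty?; Empty-unique; ∣⊥∣≡0; p⊂q⇒∣p∣<∣q∣;
         x∈p∩q⁺; x∈p∩q⁻; ∩-comm)
open import Data.List.Base as List using (List; []; _∷_; length)
open import Data.List.Membership.Propositional using (find) renaming (_∈_ to _∈ₗ_)
open import Data.List.Membership.Propositional.Properties
  using (∈-filter⁺; ∈-concatMap⁺) renaming (∈-map⁺ to ∈ₗ-map⁺)
open import Data.List.Relation.Unary.All as Allₗ using ([]; _∷_)
open import Data.List.Relation.Unary.AllPairs using ([]; _∷_)
open import Data.List.Relation.Unary.Any as Anyₗ using (here; there)
import Data.List.Relation.Unary.Any.Properties as Anyₗ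
open import Data.List.Relation.Unary.Unique.Propositional using (Unique)
open import Data.Nat.Base as ℕ using (ℕ; zero; suc; _<_)
import Data.Nat.Properties as ℕ
open import Data.Product.Base as Product
  using (∃; ∃-syntax; _×_; _,_; _,′_; proj₁; proj₂; uncurry; map₁; map₂; assocʳ′)
open import Data.Sum.Base using (_⊎_; inj₁; inj₂)
open import Data.Unit.Base using (⊤; tt)
open import Data.Vec.Base
  using (Vec; []; _∷_; _++_; foldr′; head; lookup; map; replicate; tabulate; toList; zipWith)
open import Data.Vec.Membership.Propositional using (_∈_)
open import Data.Vec.Membership.Propositional.Properties using (∈-map⁺; ∈-++⁺ˡ; ∈-++⁺ʳ; ∈-toList⁺)
open import Data.Vec.Properties
  using (∷-injective; map-∘; map-cong; map-id; lookup-map; lookup∘tabulate; tabulate∘lookup;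
         lookup⇒[]=; []=⇒lookup; zipWith-comm; zipWith-identityʳ)
  renaming (≡-dec to Vec-≡-dec)
import Data.Vec.Relation.Unary.All as All using (all?)
import Data.Vec.Relation.Unary.All.Properties as All using (lookup⁺)
open import Data.Vec.Relation.Unary.AllPairs using (allPairs?)
import Data.Vec.Relation.Unary.Any as Any using (index; here)
import Data.Vec.Relation.Unary.Any.Properties as Any using (lookup-index)
open import Data.Vec.Relation.Unary.Unique.Propositional.Properties using (lookup-injective)
open import Function.Base using (case_of_; _∘_; id)
open import Function.Bundles using (_⇔_; mk⇔; Equivalence)
open import Function.Definitions using (Injective)
open import Relation.Binary.Definitions using (DecidableEquality)
open import Relation.Binary.PropositionalEquality
open import Relation.Nullary
  using (Dec; yes; no; does; ¬_; ¬?; _×-dec_; _⊎-dec_; _→-dec_; map′; contradiction; decidable-stable)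
open import Relation.Nullary.Decidable using (True; toWitness; dec-true)
open import Relation.Unary using (Decidable; ｛_｝; _≐_)

open import Algebra.Properties.CommutativeMonoid.Sum ℕ.+-0-commutativeMonoid using (sum; sum-permute; sum-cong-≗)

open L₄ using (_⊕_; _·_; 𝟎; combination)
open Equivalence using (to; from)

decide : ∀ {A : Set} (a? : Dec A) → {True a?} → A
decide a? {t} = toWitness t

does⇒ : ∀ {A : Set} (a? : Dec A) → does a? ≡ true → A
does⇒ (yes a) _ = a

Searchable : Set → Set₁
Searchable A = ∀ {P : A → Set} → Decidable P → Dec (∃ P)

all? : ∀ {A} → Searchable A → ∀ {P : A → Set} → Decidable P → Dec (∀ x → P x)
all? s P? = map′
  (λ ¬∃ x → decidable-stable (P? x) λ ¬p → ¬∃ (x , ¬p))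
  (λ ∀P (x , ¬p) → ¬p (∀P x))
  (¬? (s (¬? ∘ P?)))

¬∀⇒∃¬ : ∀ {A} → Searchable A → ∀ {P : A → Set} → Decidable P → ¬ (∀ x → P x) → ∃[ x ] ¬ P x
¬∀⇒∃¬ s P? ¬∀ = decidable-stable (s (¬? ∘ P?))
  λ ¬∃ → ¬∀ λ x → decidable-stable (P? x) λ ¬p → ¬∃ (x , ¬p)

search-Fin : ∀ {n} → Searchable (Fin n)
search-Fin = Fin.any?

search-Bool : Searchable Bool
search-Bool P? = map′
  (λ { (inj₁ p) → false , p ; (inj₂ p) → true , p })
  (λ { (false , p) → inj₁ p ; (true , p) → inj₂ p })
  (P? false ⊎-dec P? true)

search-𝔽₄ : Searchable 𝔽₄
search-𝔽₄ P? = map′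
  (λ { (inj₁ p) → O , p ; (inj₂ (inj₁ p)) → I , p
     ; (inj₂ (inj₂ (inj₁ p))) → ω , p ; (inj₂ (inj₂ (inj₂ p))) → ω̄ , p })
  (λ { (O , p) → inj₁ p ; (I , p) → inj₂ (inj₁ p)
     ; (ω , p) → inj₂ (inj₂ (inj₁ p)) ; (ω̄ , p) → inj₂ (inj₂ (inj₂ p)) })
  (P? O ⊎-dec P? I ⊎-dec P? ω ⊎-dec P? ω̄)

search-Vec : ∀ {A} → Searchable A → ∀ {n} → Searchable (Vec A n)
search-Vec s {zero}  P? = map′ ([] ,_) (λ { ([] , p) → p }) (P? [])
search-Vec s {suc n} P? = map′
  (λ (x , xs , p) → x ∷ xs , p)
  (λ { (x ∷ xs , p) → x , xs , p })
  (s λ x → search-Vec s λ xs → P? (x ∷ xs))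

search-Bits : ∀ {n} → Searchable (Vec Bool n)
search-Bits = search-Vec search-Bool

search-Vector : ∀ {n} → Searchable (L₄.Vector n)
search-Vector = search-Vec search-𝔽₄

infix 4 _≟₄_ _≟ᵥ_

_≟₄_ : DecidableEquality 𝔽₄
O ≟₄ O = yes refl
O ≟₄ I = no λ ()
O ≟₄ ω = no λ ()
O ≟₄ ω̄ = no λ ()
I ≟₄ O = no λ ()
I ≟₄ I = yes refl
I ≟₄ ω = no λ ()
I ≟₄ ω̄ = no λ ()
ω ≟₄ O = no λ ()
ω ≟₄ I = no λ ()
ω ≟₄ ω = yes refl
ω ≟₄ ω̄ = no λ ()
ω̄ ≟₄ O = no λ ()
ω̄ ≟₄ I = no λ ()
ω̄ ≟₄ ω = no λ ()
ω̄ ≟₄ ω̄ = yes refl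

_≟ᵥ_ : ∀ {n} → DecidableEquality (L₄.Vector n)
_≟ᵥ_ = Vec-≡-dec _≟₄_

-- Field laws

private
  ∀₄ : {P : 𝔽₄ → Set} → Decidable P → Dec (∀ x → P x)
  ∀₄ = all? search-𝔽₄

+-comm : ∀ x y → x +₄ y ≡ y +₄ x
+-comm = decide (∀₄ λ x → ∀₄ λ y → _ ≟₄ _)

+-identityʳ : ∀ x → x +₄ O ≡ x
+-identityʳ = decide (∀₄ λ x → _ ≟₄ _)

x+x≡O : ∀ x → x +₄ x ≡ O
x+x≡O = decide (∀₄ λ x → _ ≟₄ _)

x+y≡O⇒x≡y : ∀ x y → x +₄ y ≡ O → x ≡ y
x+y≡O⇒x≡y = decide (∀₄ λ x → ∀₄ λ y → (_ ≟₄ _) →-dec (_ ≟₄ _))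

*-assoc : ∀ x y z → (x *₄ y) *₄ z ≡ x *₄ (y *₄ z)
*-assoc = decide (∀₄ λ x → ∀₄ λ y → ∀₄ λ z → _ ≟₄ _)

*-comm : ∀ x y → x *₄ y ≡ y *₄ x
*-comm = decide (∀₄ λ x → ∀₄ λ y → _ ≟₄ _)

*-zeroʳ : ∀ x → x *₄ O ≡ O
*-zeroʳ = decide (∀₄ λ x → _ ≟₄ _)

*-distribˡ-+ : ∀ x y z → x *₄ (y +₄ z) ≡ x *₄ y +₄ x *₄ z
*-distribˡ-+ = decide (∀₄ λ x → ∀₄ λ y → ∀₄ λ z → _ ≟₄ _)

*-distribʳ-+ : ∀ x y z → (y +₄ z) *₄ x ≡ y *₄ x +₄ z *₄ x
*-distribʳ-+ = decide (∀₄ λ x → ∀₄ λ y → ∀₄ λ z → _ ≟₄ _)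

x*y≢O : ∀ x y → x ≢ O → y ≢ O → x *₄ y ≢ O
x*y≢O = decide (∀₄ λ x → ∀₄ λ y → ¬? (_ ≟₄ _) →-dec ¬? (_ ≟₄ _) →-dec ¬? (_ ≟₄ _))

frobenius-+ : ∀ x y → frobenius (x +₄ y) ≡ frobenius x +₄ frobenius y
frobenius-+ = decide (∀₄ λ x → ∀₄ λ y → _ ≟₄ _)

frobenius-* : ∀ x y → frobenius (x *₄ y) ≡ frobenius x *₄ frobenius y
frobenius-* = decide (∀₄ λ x → ∀₄ λ y → _ ≟₄ _)

frobenius-involutive : ∀ x → frobenius (frobenius x) ≡ x
frobenius-involutive = decide (∀₄ λ x → _ ≟₄ _)

inverse : ∀ x → x ≢ O → ∃[ y ] (y ≢ O × y *₄ x ≡ I)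
inverse = decide (∀₄ λ x → ¬? (_ ≟₄ _) →-dec search-𝔽₄ λ y → ¬? (_ ≟₄ _) ×-dec (_ ≟₄ _))

-- Vectors and linear combinations

⊕-interchange : ∀ {n} (s t u v : L₄.Vector n) → (s ⊕ t) ⊕ (u ⊕ v) ≡ (s ⊕ u) ⊕ (t ⊕ v)
⊕-interchange []      []      []      []      = refl
⊕-interchange (a ∷ s) (b ∷ t) (c ∷ u) (d ∷ v) = cong₂ _∷_ (lemma a b c d) (⊕-interchange s t u v)
  where
  lemma : ∀ a b c d → (a +₄ b) +₄ (c +₄ d) ≡ (a +₄ c) +₄ (b +₄ d)
  lemma = decide (∀₄ λ a → ∀₄ λ b → ∀₄ λ c → ∀₄ λ d → _ ≟₄ _)

⊕-self : ∀ {n} (u : L₄.Vector n) → u ⊕ u ≡ 𝟎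
⊕-self []      = refl
⊕-self (a ∷ u) = cong₂ _∷_ (x+x≡O a) (⊕-self u)

⊕-identityʳ : ∀ {n} (u : L₄.Vector n) → u ⊕ 𝟎 ≡ u
⊕-identityʳ = zipWith-identityʳ +-identityʳ

u⊕v≡𝟎⇒u≡v : ∀ {n} (u v : L₄.Vector n) → u ⊕ v ≡ 𝟎 → u ≡ v
u⊕v≡𝟎⇒u≡v []      []      _  = refl
u⊕v≡𝟎⇒u≡v (a ∷ u) (b ∷ v) eq =
  cong₂ _∷_ (x+y≡O⇒x≡y a b (proj₁ (∷-injective eq))) (u⊕v≡𝟎⇒u≡v u v (proj₂ (∷-injective eq)))

·-distribˡ : ∀ {n} c (u v : L₄.Vector n) → c · (u ⊕ v) ≡ c · u ⊕ c · v
·-distribˡ c []      []      = refl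
·-distribˡ c (a ∷ u) (b ∷ v) = cong₂ _∷_ (*-distribˡ-+ c a b) (·-distribˡ c u v)

·-distribʳ : ∀ {n} c d (u : L₄.Vector n) → (c +₄ d) · u ≡ c · u ⊕ d · u
·-distribʳ c d []      = refl
·-distribʳ c d (a ∷ u) = cong₂ _∷_ (*-distribʳ-+ a c d) (·-distribʳ c d u)

·-assoc : ∀ {n} c d (u : L₄.Vector n) → (c *₄ d) · u ≡ c · (d · u)
·-assoc c d []      = refl
·-assoc c d (a ∷ u) = cong₂ _∷_ (*-assoc c d a) (·-assoc c d u)

·-identity : ∀ {n} (u : L₄.Vector n) → I · u ≡ u
·-identity = map-id

·-zeroˡ : ∀ {n} (u : L₄.Vector n) → O · u ≡ 𝟎
·-zeroˡ []      = refl
·-zeroˡ (a ∷ u) = cong (O ∷_) (·-zeroˡ u)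

·-zeroʳ : ∀ {n} c → c · 𝟎 {n} ≡ 𝟎
·-zeroʳ {zero}  c = refl
·-zeroʳ {suc n} c = cong₂ _∷_ (*-zeroʳ c) (·-zeroʳ c)

·-cancel : ∀ {n} c (u : L₄.Vector n) → c ≢ O → c · u ≡ 𝟎 → u ≡ 𝟎
·-cancel c u c≢O eq with d , _ , dc ← inverse c c≢O = begin
  u             ≡⟨ ·-identity u ⟨
  I · u         ≡⟨ cong (_· u) dc ⟨
  (d *₄ c) · u  ≡⟨ ·-assoc d c u ⟩
  d · (c · u)   ≡⟨ cong (d ·_) eq ⟩
  d · 𝟎         ≡⟨ ·-zeroʳ d ⟩
  𝟎             ∎
  where open ≡-Reasoning

IsAdditive : ∀ {m n} → (L₄.Vector m → L₄.Vector n) → Set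
IsAdditive T = ∀ u v → T (u ⊕ v) ≡ T u ⊕ T v

combination-⊕ : ∀ {k n} (vs : Vec (L₄.Vector n) k) → IsAdditive (λ c → combination c vs)
combination-⊕ []       []      []      = sym (⊕-self 𝟎)
combination-⊕ (v ∷ vs) (a ∷ c) (b ∷ d) = begin
  (a +₄ b) · v ⊕ combination (c ⊕ d) vs
    ≡⟨ cong₂ _⊕_ (·-distribʳ a b v) (combination-⊕ vs c d) ⟩
  (a · v ⊕ b · v) ⊕ (combination c vs ⊕ combination d vs)
    ≡⟨ ⊕-interchange (a · v) (b · v) _ _ ⟩
  (a · v ⊕ combination c vs) ⊕ (b · v ⊕ combination d vs) ∎
  where open ≡-Reasoning

combination-· : ∀ {k n} (vs : Vec (L₄.Vector n) k) a c → combination (a · c) vs ≡ a · combination c vs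
combination-· []       a []      = sym (·-zeroʳ a)
combination-· (v ∷ vs) a (b ∷ c) =
  trans (cong₂ _⊕_ (·-assoc a b v) (combination-· vs a c)) (sym (·-distribˡ a (b · v) _))

map-combination : ∀ {k m n} (T : L₄.Vector m → L₄.Vector n) → IsAdditive T →
  (∀ c v → T (c · v) ≡ c · T v) →
  ∀ c (vs : Vec (L₄.Vector m) k) → T (combination c vs) ≡ combination c (map T vs)
map-combination T T-⊕ T-· [] [] = begin
  T 𝟎        ≡⟨ cong T (·-zeroˡ 𝟎) ⟨
  T (O · 𝟎)  ≡⟨ T-· O 𝟎 ⟩
  O · T 𝟎    ≡⟨ ·-zeroˡ (T 𝟎) ⟩
  𝟎          ∎
  where open ≡-Reasoning
map-combination T T-⊕ T-· (a ∷ c) (v ∷ vs) =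
  trans (T-⊕ _ _) (cong₂ _⊕_ (T-· a v) (map-combination T T-⊕ T-· c vs))

-- Points

leading : ∀ {n} → L₄.Vector n → 𝔽₄
leading []      = O
leading (O ∷ v) = leading v
leading (I ∷ v) = I
leading (ω ∷ v) = ω
leading (ω̄ ∷ v) = ω̄

normalise : ∀ {n} → L₄.Vector n → L₄.Vector n
normalise []      = []
normalise (O ∷ v) = O ∷ normalise v
normalise (I ∷ v) = I ∷ v
normalise (ω ∷ v) = I ∷ ω̄ · v
normalise (ω̄ ∷ v) = I ∷ ω · v

leading-normalise : ∀ {n} (v : L₄.Vector n) → v ≡ leading v · normalise v
leading-normalise []      = refl
leading-normalise (O ∷ v) = cong₂ _∷_ (sym (*-zeroʳ (leading v))) (leading-normalise v)
leading-normalise (I ∷ v) = cong (I ∷_) (sym (·-identity v))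
leading-normalise (ω ∷ v) = cong (ω ∷_) (trans (sym (·-identity v)) (·-assoc ω ω̄ v))
leading-normalise (ω̄ ∷ v) = cong (ω̄ ∷_) (trans (sym (·-identity v)) (·-assoc ω̄ ω v))

leading≢O : ∀ {n} (v : L₄.Vector n) → v ≢ 𝟎 → leading v ≢ O
leading≢O v v≢𝟎 eq = v≢𝟎 (trans (leading-normalise v) (trans (cong (_· normalise v) eq) (·-zeroˡ _)))

normalise-· : ∀ {n} c (v : L₄.Vector n) → c ≢ O → normalise (c · v) ≡ normalise v
normalise-· c []      c≢O = refl
normalise-· c (O ∷ v) c≢O rewrite *-zeroʳ c = cong (O ∷_) (normalise-· c v c≢O)
normalise-· O (_ ∷ v) c≢O = contradiction refl c≢O
normalise-· I (I ∷ v) c≢O = cong (I ∷_) (·-identity v)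
normalise-· I (ω ∷ v) c≢O = cong (λ u → I ∷ ω̄ · u) (·-identity v)
normalise-· I (ω̄ ∷ v) c≢O = cong (λ u → I ∷ ω · u) (·-identity v)
normalise-· ω (I ∷ v) c≢O = cong (I ∷_) (trans (sym (·-assoc ω̄ ω v)) (·-identity v))
normalise-· ω (ω ∷ v) c≢O = cong (I ∷_) (sym (·-assoc ω ω v))
normalise-· ω (ω̄ ∷ v) c≢O = refl
normalise-· ω̄ (I ∷ v) c≢O = cong (I ∷_) (trans (sym (·-assoc ω ω̄ v)) (·-identity v))
normalise-· ω̄ (ω ∷ v) c≢O = refl
normalise-· ω̄ (ω̄ ∷ v) c≢O = cong (I ∷_) (sym (·-assoc ω̄ ω̄ v))

normalise-coords : ∀ p → normalise (coords p) ≡ coords p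
normalise-coords = All.lookup⁺ (decide (All.all? (λ v → normalise v ≟ᵥ v) (normalised 4)))

coords≢𝟎 : ∀ p → coords p ≢ 𝟎
coords≢𝟎 = All.lookup⁺ (decide (All.all? (λ v → ¬? (v ≟ᵥ 𝟎)) (normalised 4)))

coords-injective : ∀ p q → coords p ≡ coords q → p ≡ q
coords-injective = lookup-injective (decide (allPairs? (λ u v → ¬? (u ≟ᵥ v)) (normalised 4)))

∈-allVectors : ∀ {n} (v : L₄.Vector n) → v ∈ allVectors n
∈-allVectors []      = Any.here refl
∈-allVectors {suc n} (a ∷ v) = block a
  where
  v∈ : ∀ {b} → b ∷ v ∈ map (b ∷_) (allVectors n)
  v∈ = ∈-map⁺ _ (∈-allVectors v)
  skip : ∀ {m w b} {ws : Vec (L₄.Vector (suc n)) m} → w ∈ ws → w ∈ map (b ∷_) (allVectors n) ++ ws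
  skip = ∈-++⁺ʳ _
  block : ∀ a → a ∷ v ∈ allVectors (suc n)
  block O = ∈-++⁺ˡ v∈
  block I = skip (∈-++⁺ˡ v∈)
  block ω = skip (skip (∈-++⁺ˡ v∈))
  block ω̄ = skip (skip (skip (∈-++⁺ˡ v∈)))

∈-normalised : ∀ {n} (v : L₄.Vector n) → v ≢ 𝟎 → normalise v ∈ normalised n
∈-normalised []      v≢𝟎 = contradiction refl v≢𝟎
∈-normalised {suc n} (O ∷ v) v≢𝟎 =
  ∈-++⁺ʳ (map (I ∷_) (allVectors n)) (∈-map⁺ _ (∈-normalised v (v≢𝟎 ∘ cong (O ∷_))))
∈-normalised {suc n} (I ∷ v) _ = ∈-++⁺ˡ {xs = map (I ∷_) (allVectors n)} (∈-map⁺ _ (∈-allVectors v))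
∈-normalised {suc n} (ω ∷ v) _ = ∈-++⁺ˡ {xs = map (I ∷_) (allVectors n)} (∈-map⁺ _ (∈-allVectors (ω̄ · v)))
∈-normalised {suc n} (ω̄ ∷ v) _ = ∈-++⁺ˡ {xs = map (I ∷_) (allVectors n)} (∈-map⁺ _ (∈-allVectors (ω · v)))

-- Comparing two coordinate vectors makes Agda evaluate the whole list of
-- points, so the relation is kept opaque.
infix 4 _∼_

opaque
  _∼_ : L₄.Vector 4 → Point → Set
  _∼_ = _represents_

  ∼⇒represents : ∀ {v p} → v ∼ p → v represents p
  ∼⇒represents v∼p = v∼p

  represents⇒∼ : ∀ {v p} → v represents p → v ∼ p
  represents⇒∼ v∼p = v∼p

  coords-∼ : ∀ p → coords p ∼ p
  coords-∼ p = I , (λ ()) , sym (·-identity _)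

  ∼-· : ∀ {v p} c → c ≢ O → v ∼ p → (c · v) ∼ p
  ∼-· c c≢O (d , d≢O , refl) = c *₄ d , x*y≢O c d c≢O d≢O , sym (·-assoc c d _)

  ∼⇒≢𝟎 : ∀ {v p} → v ∼ p → v ≢ 𝟎
  ∼⇒≢𝟎 {p = p} (c , c≢O , refl) eq = coords≢𝟎 p (·-cancel c _ c≢O eq)

  ∼⇒normalise : ∀ {v p} → v ∼ p → normalise v ≡ coords p
  ∼⇒normalise {p = p} (c , c≢O , refl) = trans (normalise-· c (coords p) c≢O) (normalise-coords p)

  normalise⇒∼ : ∀ {v p} → normalise v ≡ coords p → v ∼ p
  normalise⇒∼ {v} {p} eq = leading v , leading≢O v v≢𝟎 , trans (leading-normalise v) (cong (leading v ·_) eq)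
    where
    normalise-𝟎 : ∀ n → normalise (𝟎 {n}) ≡ 𝟎
    normalise-𝟎 zero    = refl
    normalise-𝟎 (suc n) = cong (O ∷_) (normalise-𝟎 n)
    v≢𝟎 : v ≢ 𝟎
    v≢𝟎 refl = coords≢𝟎 p (trans (sym eq) (normalise-𝟎 4))

_∼?_ : ∀ v p → Dec (v ∼ p)
v ∼? p = map′ normalise⇒∼ ∼⇒normalise (normalise v ≟ᵥ coords p)

opaque
  pointOf : ∀ v → v ≢ 𝟎 → ∃[ p ] v ∼ p
  pointOf v v≢𝟎 = Any.index (∈-normalised v v≢𝟎) , normalise⇒∼ (Any.lookup-index (∈-normalised v v≢𝟎))

∼-unique : ∀ {v p q} → v ∼ p → v ∼ q → p ≡ q
∼-unique {p = p} {q} v∼p v∼q = coords-injective p q (trans (sym (∼⇒normalise v∼p)) (∼⇒normalise v∼q))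

∼-scalar : ∀ {u v p} → u ∼ p → v ∼ p → ∃[ c ] (c ≢ O × u ≡ c · v)
∼-scalar {u} {v} {p} u∼p v∼p with inverse (leading v) (leading≢O v (∼⇒≢𝟎 v∼p))
... | e , e≢O , el≡I = leading u *₄ e , x*y≢O (leading u) e (leading≢O u (∼⇒≢𝟎 u∼p)) e≢O , (begin
  u                                             ≡⟨ leading-normalise u ⟩
  leading u · normalise u
    ≡⟨ cong (leading u ·_) (trans (∼⇒normalise u∼p) (sym (∼⇒normalise v∼p))) ⟩
  leading u · normalise v                       ≡⟨ cong (leading u ·_) (·-identity _) ⟨
  leading u · (I · normalise v)                 ≡⟨ cong (λ x → leading u · (x · normalise v)) el≡I ⟨
  leading u · ((e *₄ leading v) · normalise v)  ≡⟨ cong (leading u ·_) (·-assoc e (leading v) _) ⟩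
  leading u · (e · (leading v · normalise v))   ≡⟨ ·-assoc (leading u) e _ ⟨
  (leading u *₄ e) · (leading v · normalise v)  ≡⟨ cong (_ ·_) (leading-normalise v) ⟨
  (leading u *₄ e) · v                          ∎)
  where open ≡-Reasoning

-- Counting vectors

private
  encode : ∀ {n} → L₄.Vector n → Fin (4 ℕ.^ n)
  encode v = Any.index (∈-allVectors v)

  encode-injective : ∀ {n} → Injective _≡_ _≡_ (encode {n})
  encode-injective {x = u} {v} eq =
    trans (Any.lookup-index (∈-allVectors u))
      (trans (cong (lookup (allVectors _)) eq) (sym (Any.lookup-index (∈-allVectors v))))

  digit : Fin 4 → 𝔽₄
  digit = lookup (O ∷ I ∷ ω ∷ ω̄ ∷ [])

  digit-injective : ∀ i j → digit i ≡ digit j → i ≡ j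
  digit-injective = lookup-injective (decide (allPairs? (λ a b → ¬? (a ≟₄ b)) (O ∷ I ∷ ω ∷ ω̄ ∷ [])))

  decode : ∀ n → Fin (4 ℕ.^ n) → L₄.Vector n
  decode zero    _ = []
  decode (suc n) i = digit (proj₁ (Fin.remQuot {4} (4 ℕ.^ n) i)) ∷ decode n (proj₂ (Fin.remQuot {4} (4 ℕ.^ n) i))

  decode-injective : ∀ n → Injective _≡_ _≡_ (decode n)
  decode-injective zero    {zero} {zero} _ = refl
  decode-injective (suc n) {i} {j} eq with eq₁ , eq₂ ← ∷-injective eq = begin
    i                                                 ≡⟨ Fin.combine-remQuot {4} (4 ℕ.^ n) i ⟨
    uncurry Fin.combine (Fin.remQuot {4} (4 ℕ.^ n) i)
      ≡⟨ cong₂ Fin.combine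
           (digit-injective (proj₁ (Fin.remQuot {4} (4 ℕ.^ n) i)) (proj₁ (Fin.remQuot {4} (4 ℕ.^ n) j)) eq₁)
           (decode-injective n eq₂) ⟩
    uncurry Fin.combine (Fin.remQuot {4} (4 ℕ.^ n) j)
      ≡⟨ Fin.combine-remQuot {4} (4 ℕ.^ n) j ⟩
    j                                                 ∎
    where open ≡-Reasoning

vector-pigeonhole : ∀ {m n} → 4 ℕ.^ n < 4 ℕ.^ m → (f : L₄.Vector m → L₄.Vector n) → ¬ Injective _≡_ _≡_ f
vector-pigeonhole {m} n<m f inj =
  Fin.<⇒notInjective {f = encode ∘ f ∘ decode m} n<m (decode-injective m ∘ inj ∘ encode-injective)

injective⇒surjective : ∀ {n} (f : L₄.Vector n → L₄.Vector n) → Injective _≡_ _≡_ f → ∀ v → ∃[ u ] f u ≡ v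
injective⇒surjective {n} f inj v = decidable-stable (search-Vector λ u → f u ≟ᵥ v) λ v∉ →
  let
    g : Fin (suc (4 ℕ.^ n)) → Fin (4 ℕ.^ n)
    g = λ { zero → encode v ; (suc i) → encode (f (decode n i)) }
    g-injective : Injective _≡_ _≡_ g
    g-injective = λ
      { {zero}  {zero}  _  → refl
      ; {zero}  {suc j} eq → contradiction (decode n j , sym (encode-injective eq)) v∉
      ; {suc i} {zero}  eq → contradiction (decode n i , encode-injective eq) v∉
      ; {suc i} {suc j} eq → cong suc (decode-injective n (inj (encode-injective eq))) }
  in Fin.<⇒notInjective {f = g} ℕ.≤-refl g-injective

leftInverse⇒rightInverse : ∀ {n} (f g : L₄.Vector n → L₄.Vector n) → (∀ u → g (f u) ≡ u) → ∀ v → f (g v) ≡ v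
leftInverse⇒rightInverse f g gf v with u , refl ← injective⇒surjective f
  (λ {u} {u′} eq → trans (sym (gf u)) (trans (cong g eq) (gf u′))) v = cong f (gf u)

-- Cardinalities

∣-∣-sum : ∀ {n} (S : Subset n) → ∣ S ∣ ≡ sum (λ i → if lookup S i then 1 else 0)
∣-∣-sum []          = refl
∣-∣-sum (true ∷ S)  = cong suc (∣-∣-sum S)
∣-∣-sum (false ∷ S) = ∣-∣-sum S

preimage : ∀ {n} → (Fin n → Fin n) → Subset n → Subset n
preimage f S = tabulate (lookup S ∘ f)

∈-preimage : ∀ {n} (f : Fin n → Fin n) S p → p ∈ₛ preimage f S ⇔ f p ∈ₛ S
∈-preimage f S p = mk⇔
  (λ p∈ → lookup⇒[]= (f p) S (trans (sym (lookup∘tabulate _ p)) ([]=⇒lookup p∈)))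
  (λ fp∈ → lookup⇒[]= p _ (trans (lookup∘tabulate _ p) ([]=⇒lookup fp∈)))

preimage-∩ : ∀ {n} (f : Fin n → Fin n) S T → preimage f (S ∩ T) ≡ preimage f S ∩ preimage f T
preimage-∩ f S T = ⊆-antisym
  (λ p∈ → let fp∈S , fp∈T = x∈p∩q⁻ S T (to (∈-preimage f _ _) p∈) in
    x∈p∩q⁺ (from (∈-preimage f S _) fp∈S , from (∈-preimage f T _) fp∈T))
  (λ p∈ → let p∈S , p∈T = x∈p∩q⁻ (preimage f S) _ p∈ in
    from (∈-preimage f _ _) (x∈p∩q⁺ (to (∈-preimage f S _) p∈S , to (∈-preimage f T _) p∈T)))

∣preimage∣ : ∀ {n} (π : Permutation′ n) S → ∣ preimage (π ⟨$⟩ʳ_) S ∣ ≡ ∣ S ∣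
∣preimage∣ π S = begin
  ∣ preimage f S ∣                                  ≡⟨ ∣-∣-sum (preimage f S) ⟩
  sum (λ i → if lookup (preimage f S) i then 1 else 0)
    ≡⟨ sum-cong-≗ (λ i → cong (if_then 1 else 0) (lookup∘tabulate (lookup S ∘ f) i)) ⟩
  sum (λ i → if lookup S (f i) then 1 else 0)       ≡⟨ sum-permute _ π ⟨
  sum (λ i → if lookup S i then 1 else 0)           ≡⟨ ∣-∣-sum S ⟨
  ∣ S ∣                                             ∎
  where
  open ≡-Reasoning
  f = π ⟨$⟩ʳ_

∣S∣≡1⇒unique : ∀ {n} {S : Subset n} → ∣ S ∣ ≡ 1 → ∀ {p q} → p ∈ₛ S → q ∈ₛ S → p ≡ q
∣S∣≡1⇒unique {S = S} ∣S∣≡1 {p} {q} p∈S q∈S = decidable-stable (p Fin.≟ q) λ p≢q →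
  ℕ.<-irrefl (trans (∣⁅x⁆∣≡1 p) (sym ∣S∣≡1)) (p⊂q⇒∣p∣<∣q∣
    ( (λ r∈ → subst (_∈ₛ S) (sym (x∈⁅y⁆⇒x≡y p r∈)) p∈S)
    , q , q∈S , λ q∈ → p≢q (sym (x∈⁅y⁆⇒x≡y p q∈))))

unique⇒∣S∣≡1 : ∀ {n} {S : Subset n} p → p ∈ₛ S → (∀ {q} → q ∈ₛ S → q ≡ p) → ∣ S ∣ ≡ 1
unique⇒∣S∣≡1 {S = S} p p∈S unique = trans (cong ∣_∣ S≡⁅p⁆) (∣⁅x⁆∣≡1 p)
  where
  S≡⁅p⁆ : S ≡ ⁅ p ⁆
  S≡⁅p⁆ = ⊆-antisym
    (λ q∈ → subst (_∈ₛ ⁅ p ⁆) (sym (unique q∈)) (x∈⁅x⁆ p))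
    (λ q∈ → subst (_∈ₛ S) (sym (x∈⁅y⁆⇒x≡y p q∈)) p∈S)

-- Sets of points given by representing vectors

opaque
  locus : List (L₄.Vector 4) → PointSet
  locus vs = pointsIn (List.map normalise vs)
    where
    pointsIn : List (L₄.Vector 4) → PointSet
    pointsIn ns = map (λ u → does (Anyₗ.any? (_≟ᵥ u) ns)) (normalised 4)

  ∈-locus : ∀ vs p → p ∈ₛ locus vs ⇔ Anyₗ.Any (_∼ p) vs
  ∈-locus vs p = mk⇔
    (λ p∈ → Anyₗ.map normalise⇒∼ (Anyₗ.map⁻ (does⇒ any? (trans (sym eq) ([]=⇒lookup p∈)))))
    (λ any → lookup⇒[]= p _ (trans eq (dec-true any? (Anyₗ.map⁺ (Anyₗ.map ∼⇒normalise any)))))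
    where
    any? : Dec (Anyₗ.Any (_≡ coords p) (List.map normalise vs))
    any? = Anyₗ.any? (_≟ᵥ coords p) (List.map normalise vs)
    eq : lookup (locus vs) p ≡ does any?
    eq = lookup-map p (λ u → does (Anyₗ.any? (_≟ᵥ u) (List.map normalise vs))) (normalised 4)

-- Semilinear bijections and the permutations of points that they induce

module Collineation (θ : 𝔽₄ → 𝔽₄) (θ≢O : ∀ c → c ≢ O → θ c ≢ O)
                    (T : L₄.Vector 4 → L₄.Vector 4)
                    (T-· : ∀ c v → T (c · v) ≡ θ c · T v)
                    (T≢𝟎 : ∀ v → T v ≡ 𝟎 → v ≡ 𝟎) where

  private
    imageOf : ∀ p → ∃[ q ] T (coords p) ∼ q
    imageOf p = pointOf (T (coords p)) (coords≢𝟎 p ∘ T≢𝟎 _)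

  image : Point → Point
  image p = proj₁ (imageOf p)

  ∼-image : ∀ {v p} → v ∼ p → T v ∼ image p
  ∼-image {p = p} v∼p with c , c≢O , refl ← ∼⇒represents v∼p =
    subst (_∼ image p) (sym (T-· c (coords p))) (∼-· {p = image p} (θ c) (θ≢O c c≢O) (proj₂ (imageOf p)))

-- Sesquilinear forms

dot : ∀ {n} → L₄.Vector n → L₄.Vector n → 𝔽₄
dot a b = foldr′ _+₄_ O (zipWith _*₄_ a b)

hermitianForm : ∀ {n} → Vec (L₄.Vector n) n → L₄.Form n
hermitianForm G a b = dot a (map (dot (map frobenius b)) G)

gram : ∀ {k n} → L₄.Form n → Vec (L₄.Vector n) k → Vec (L₄.Vector k) k
gram h vs = map (λ v → map (h v) vs) vs

module Sesquilinear {n} {θ : 𝔽₄ → 𝔽₄} {h : L₄.Form n} (sesqui : L₄.IsSesquilinear θ h) where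

  open L₄.IsSesquilinear sesqui

  𝟎ˡ : ∀ w → h 𝟎 w ≡ O
  𝟎ˡ w = trans (cong (λ u → h u w) (sym (·-zeroˡ 𝟎))) (homogeneousˡ O 𝟎 w)

  𝟎ʳ : ∀ u → h u 𝟎 ≡ O
  𝟎ʳ u = begin
    h u 𝟎               ≡⟨ cong (h u) (⊕-self 𝟎) ⟨
    h u (𝟎 ⊕ 𝟎)         ≡⟨ additiveʳ u 𝟎 𝟎 ⟩
    h u 𝟎 +₄ h u 𝟎      ≡⟨ x+x≡O (h u 𝟎) ⟩
    O                   ∎
    where open ≡-Reasoning

  combinationˡ : ∀ {k} (a : L₄.Vector k) vs w → h (combination a vs) w ≡ dot a (map (λ v → h v w) vs)
  combinationˡ []      []       w = 𝟎ˡ w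
  combinationˡ (c ∷ a) (v ∷ vs) w =
    trans (additiveˡ _ _ w) (cong₂ _+₄_ (homogeneousˡ c v w) (combinationˡ a vs w))

  combinationʳ : ∀ {k} u (b : L₄.Vector k) vs → h u (combination b vs) ≡ dot (map θ b) (map (h u) vs)
  combinationʳ u []      []       = 𝟎ʳ u
  combinationʳ u (c ∷ b) (v ∷ vs) =
    trans (additiveʳ u _ _) (cong₂ _+₄_ (homogeneousʳ c u v) (combinationʳ u b vs))

gram-combination : ∀ {k n} {h : L₄.Form n} → L₄.IsSesquilinear frobenius h → ∀ vs (a b : L₄.Vector k) →
  h (combination a vs) (combination b vs) ≡ hermitianForm (gram h vs) a b
gram-combination {h = h} sesqui vs a b = begin
  h (combination a vs) (combination b vs)
    ≡⟨ combinationˡ a vs _ ⟩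
  dot a (map (λ v → h v (combination b vs)) vs)
    ≡⟨ cong (dot a) (map-cong (λ v → combinationʳ v b vs) vs) ⟩
  dot a (map (λ v → dot (map frobenius b) (map (h v) vs)) vs)
    ≡⟨ cong (dot a) (map-∘ _ _ vs) ⟩
  hermitianForm (gram h vs) a b ∎
  where
  open ≡-Reasoning
  open Sesquilinear sesqui

gram-map : ∀ {k m n} {h : L₄.Form n} {h′ : L₄.Form m} {T : L₄.Vector m → L₄.Vector n} →
  (∀ a b → h (T a) (T b) ≡ h′ a b) → ∀ (vs : Vec (L₄.Vector m) k) → gram h (map T vs) ≡ gram h′ vs
gram-map {h = h} {h′} {T} T-h vs = begin
  map (λ v → map (h v) (map T vs)) (map T vs)  ≡⟨ map-∘ _ T vs ⟨
  map (λ a → map (h (T a)) (map T vs)) vs      ≡⟨ map-cong (λ a → map-∘ _ T vs) vs ⟨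
  map (λ a → map (λ b → h (T a) (T b)) vs) vs  ≡⟨ map-cong (λ a → map-cong (T-h a) vs) vs ⟩
  map (λ a → map (h′ a) vs) vs                 ∎
  where open ≡-Reasoning

-- Frames

-- The five points of an elliptic ovoid have representatives v₁, …, v₅ with
-- v₁ + … + v₅ = 0 and h vᵢ vⱼ = 1 for i ≠ j; a frame consists of four of
-- them, and Γ is its Gram matrix.
Γ : Vec (L₄.Vector 4) 4
Γ = (O ∷ I ∷ I ∷ I ∷ [])
  ∷ (I ∷ O ∷ I ∷ I ∷ [])
  ∷ (I ∷ I ∷ O ∷ I ∷ [])
  ∷ (I ∷ I ∷ I ∷ O ∷ []) ∷ []

IsFrame : L₄.Form 4 → Vec (L₄.Vector 4) 4 → Set
IsFrame h v = gram h v ≡ Γ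

h₀ : L₄.Form 4
h₀ = hermitianForm Γ

Q₀ : Vec Bool 4 → Bool
Q₀ (a ∷ b ∷ c ∷ d ∷ []) = (a ∧ (b xor c xor d)) xor (b ∧ (c xor d)) xor (c ∧ d)

ovoidBits quadrangleBits : List (Vec Bool 4)
ovoidBits =
    (true  ∷ false ∷ false ∷ false ∷ [])
  ∷ (false ∷ true  ∷ false ∷ false ∷ [])
  ∷ (false ∷ false ∷ true  ∷ false ∷ [])
  ∷ (false ∷ false ∷ false ∷ true  ∷ [])
  ∷ (true  ∷ true  ∷ true  ∷ true  ∷ []) ∷ []
quadrangleBits = ovoidBits List.++
    (true  ∷ true  ∷ false ∷ false ∷ [])
  ∷ (true  ∷ false ∷ true  ∷ false ∷ [])
  ∷ (true  ∷ false ∷ false ∷ true  ∷ [])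
  ∷ (false ∷ true  ∷ true  ∷ false ∷ [])
  ∷ (false ∷ true  ∷ false ∷ true  ∷ [])
  ∷ (false ∷ false ∷ true  ∷ true  ∷ [])
  ∷ (true  ∷ true  ∷ true  ∷ false ∷ [])
  ∷ (true  ∷ true  ∷ false ∷ true  ∷ [])
  ∷ (true  ∷ false ∷ true  ∷ true  ∷ [])
  ∷ (false ∷ true  ∷ true  ∷ true  ∷ []) ∷ []

embedBits : ∀ {n} → Vec (L₄.Vector n) 4 → Vec Bool 4 → L₄.Vector n
embedBits v x = combination (map ι x) v

opaque
  bitLocus : Vec (L₄.Vector 4) 4 → List (Vec Bool 4) → PointSet
  bitLocus v L = locus (List.map (embedBits v) L)

ovoid quadrangle : Vec (L₄.Vector 4) 4 → PointSet
ovoid      v = bitLocus v ovoidBits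
quadrangle v = bitLocus v quadrangleBits

_≟ᵇ_ : ∀ {n} → DecidableEquality (Vec Bool n)
_≟ᵇ_ = Vec-≡-dec Bool._≟_

private
  _∈?_ : ∀ x (L : List (Vec Bool 4)) → Dec (x ∈ₗ L)
  x ∈? L = Anyₗ.any? (x ≟ᵇ_) L

∈-quadrangleBits : ∀ x → x ≢ L₂.𝟎 → x ∈ₗ quadrangleBits
∈-quadrangleBits = decide (all? search-Bits λ x → ¬? (x ≟ᵇ L₂.𝟎) →-dec (x ∈? quadrangleBits))

∈-quadrangleBits⁻ : ∀ x → x ∈ₗ quadrangleBits → x ≢ L₂.𝟎
∈-quadrangleBits⁻ = decide (all? search-Bits λ x → (x ∈? quadrangleBits) →-dec ¬? (x ≟ᵇ L₂.𝟎))

∈-ovoidBits : ∀ x → x ≢ L₂.𝟎 → Q₀ x ≡ false → x ∈ₗ ovoidBits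
∈-ovoidBits = decide (all? search-Bits λ x →
  ¬? (x ≟ᵇ L₂.𝟎) →-dec (Q₀ x Bool.≟ false) →-dec (x ∈? ovoidBits))

∈-ovoidBits⁻ : ∀ x → x ∈ₗ ovoidBits → x ≢ L₂.𝟎 × Q₀ x ≡ false
∈-ovoidBits⁻ = decide (all? search-Bits λ x →
  (x ∈? ovoidBits) →-dec (¬? (x ≟ᵇ L₂.𝟎) ×-dec (Q₀ x Bool.≟ false)))

opaque
  unfolding bitLocus

  ∈-bitLocus : ∀ v L p → p ∈ₛ bitLocus v L ⇔ (∃[ x ] (x ∈ₗ L × embedBits v x ∼ p))
  ∈-bitLocus v L p = mk⇔
    (λ p∈ → find (Anyₗ.map⁻ {f = embedBits v} (to (∈-locus (List.map (embedBits v) L) p) p∈)))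
    (λ (x , x∈ , x∼p) → from (∈-locus (List.map (embedBits v) L) p)
      (Anyₗ.map⁺ {f = embedBits v} (Anyₗ.map (λ x≡y → subst (λ y → embedBits v y ∼ p) x≡y x∼p) x∈)))

∈-quadrangle : ∀ v p → p ∈ₛ quadrangle v ⇔ (∃[ x ] (x ≢ L₂.𝟎 × embedBits v x ∼ p))
∈-quadrangle v p = mk⇔
  (λ p∈ → map₂ (map₁ (∈-quadrangleBits⁻ _)) (to (∈-bitLocus v quadrangleBits p) p∈))
  (λ ∃x → from (∈-bitLocus v quadrangleBits p) (map₂ (map₁ (∈-quadrangleBits _)) ∃x))

∈-ovoid : ∀ v p → p ∈ₛ ovoid v ⇔ (∃[ x ] (x ≢ L₂.𝟎 × Q₀ x ≡ false × embedBits v x ∼ p))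
∈-ovoid v p = mk⇔
  (λ p∈ → map₂ (λ (x∈ , x∼p) → assocʳ′ (∈-ovoidBits⁻ _ x∈ , x∼p)) (to (∈-bitLocus v ovoidBits p) p∈))
  (λ ∃x → from (∈-bitLocus v ovoidBits p) (map₂ (λ (x≢𝟎 , Qx , x∼p) → ∈-ovoidBits _ x≢𝟎 Qx , x∼p) ∃x))

Γ-involutive : ∀ a → map (λ row → dot row (map (λ r → frobenius (dot (map frobenius a) r)) Γ)) Γ ≡ a
Γ-involutive = decide (all? search-Vector λ a →
  map (λ row → dot row (map (λ r → frobenius (dot (map frobenius a) r)) Γ)) Γ ≟ᵥ a)

module Coordinates {h : L₄.Form 4} (unitary : IsUnitary h)
                   {v : Vec (L₄.Vector 4) 4} (frame : IsFrame h v) where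

  open IsUnitary unitary
  open L₄.IsSesquilinear sesquilinear
  open Sesquilinear sesquilinear
  open ≡-Reasoning

  fromCoords : L₄.Vector 4 → L₄.Vector 4
  fromCoords a = combination a v

  opaque
    -- Γ is its own inverse.
    toCoords : L₄.Vector 4 → L₄.Vector 4
    toCoords u = map (λ row → dot row (map (h u) v)) Γ

    toCoords∘fromCoords : ∀ a → toCoords (fromCoords a) ≡ a
    toCoords∘fromCoords a = begin
      map (λ row → dot row (map (h (fromCoords a)) v)) Γ
        ≡⟨ cong (λ x → map (λ row → dot row x) Γ) (map-cong h-row v) ⟩
      map (λ row → dot row (map (λ w → frobenius (dot (map frobenius a) (map (h w) v))) v)) Γ
        ≡⟨ cong (λ x → map (λ row → dot row x) Γ) (map-∘ _ _ v) ⟩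
      map (λ row → dot row (map (λ r → frobenius (dot (map frobenius a) r)) (gram h v))) Γ
        ≡⟨ cong (λ G → map (λ row → dot row (map (λ r → frobenius (dot (map frobenius a) r)) G)) Γ) frame ⟩
      map (λ row → dot row (map (λ r → frobenius (dot (map frobenius a) r)) Γ)) Γ
        ≡⟨ Γ-involutive a ⟩
      a ∎
      where
      h-row : ∀ w → h (fromCoords a) w ≡ frobenius (dot (map frobenius a) (map (h w) v))
      h-row w = trans (hermitian w (fromCoords a)) (cong frobenius (combinationʳ w a v))

  fromCoords∘toCoords : ∀ u → fromCoords (toCoords u) ≡ u
  fromCoords∘toCoords = leftInverse⇒rightInverse fromCoords toCoords toCoords∘fromCoords

  toCoords-⊕ : IsAdditive toCoords
  toCoords-⊕ u w = begin
    toCoords (u ⊕ w)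
      ≡⟨ cong toCoords (cong₂ _⊕_ (fromCoords∘toCoords u) (fromCoords∘toCoords w)) ⟨
    toCoords (fromCoords (toCoords u) ⊕ fromCoords (toCoords w))
      ≡⟨ cong toCoords (combination-⊕ v (toCoords u) (toCoords w)) ⟨
    toCoords (fromCoords (toCoords u ⊕ toCoords w))
      ≡⟨ toCoords∘fromCoords _ ⟩
    toCoords u ⊕ toCoords w ∎

  toCoords-· : ∀ c u → toCoords (c · u) ≡ c · toCoords u
  toCoords-· c u = begin
    toCoords (c · u)                        ≡⟨ cong (toCoords ∘ (c ·_)) (fromCoords∘toCoords u) ⟨
    toCoords (c · fromCoords (toCoords u))  ≡⟨ cong toCoords (combination-· v c (toCoords u)) ⟨
    toCoords (fromCoords (c · toCoords u))  ≡⟨ toCoords∘fromCoords _ ⟩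
    c · toCoords u                          ∎

  fromCoords-𝟎 : fromCoords 𝟎 ≡ 𝟎
  fromCoords-𝟎 = trans (cong fromCoords (sym (·-zeroˡ 𝟎))) (trans (combination-· v O 𝟎) (·-zeroˡ _))

  toCoords-𝟎 : toCoords 𝟎 ≡ 𝟎
  toCoords-𝟎 = trans (cong toCoords (sym (·-zeroˡ (𝟎 {4})))) (trans (toCoords-· O 𝟎) (·-zeroˡ (toCoords 𝟎)))

  fromCoords≢𝟎 : ∀ a → fromCoords a ≡ 𝟎 → a ≡ 𝟎
  fromCoords≢𝟎 a eq = trans (sym (toCoords∘fromCoords a)) (trans (cong toCoords eq) toCoords-𝟎)

  toCoords≢𝟎 : ∀ u → toCoords u ≡ 𝟎 → u ≡ 𝟎
  toCoords≢𝟎 u eq = trans (sym (fromCoords∘toCoords u)) (trans (cong fromCoords eq) fromCoords-𝟎)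

  h-fromCoords : ∀ a b → h (fromCoords a) (fromCoords b) ≡ h₀ a b
  h-fromCoords a b = trans (gram-combination sesquilinear v a b) (cong (λ G → hermitianForm G a b) frame)

  h₀-toCoords : ∀ u w → h₀ (toCoords u) (toCoords w) ≡ h u w
  h₀-toCoords u w = trans (sym (h-fromCoords (toCoords u) (toCoords w)))
    (cong₂ h (fromCoords∘toCoords u) (fromCoords∘toCoords w))

  fromCoords-frame : ∀ {M} → IsFrame h₀ M → IsFrame h (map fromCoords M)
  fromCoords-frame {M} = trans (gram-map h-fromCoords M)

  toCoords-frame : ∀ {w} → IsFrame h w → IsFrame h₀ (map toCoords w)
  toCoords-frame {w} = trans (gram-map h₀-toCoords w)

  private
    module From = Collineation id (λ _ → id) fromCoords (λ c a → combination-· v c a) fromCoords≢𝟎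
    module To   = Collineation id (λ _ → id) toCoords toCoords-· toCoords≢𝟎

    to∘from : ∀ p → To.image (From.image p) ≡ p
    to∘from p = ∼-unique {q = p} (To.∼-image (From.∼-image (coords-∼ p)))
      (subst (_∼ p) (sym (toCoords∘fromCoords (coords p))) (coords-∼ p))

    from∘to : ∀ p → From.image (To.image p) ≡ p
    from∘to p = ∼-unique {q = p} (From.∼-image (To.∼-image (coords-∼ p)))
      (subst (_∼ p) (sym (fromCoords∘toCoords (coords p))) (coords-∼ p))

    fromPermutation : Permutation′ (numPoints 4)
    fromPermutation = permutation From.image To.image from∘to to∘from

  relative : PointSet → PointSet
  relative = preimage From.image

  relative-∣∩∣ : ∀ S T → ∣ relative S ∩ relative T ∣ ≡ ∣ S ∩ T ∣
  relative-∣∩∣ S T = trans (cong ∣_∣ (sym (preimage-∩ From.image S T))) (∣preimage∣ fromPermutation (S ∩ T))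

  relative-injective : ∀ {S T} → relative S ≡ relative T → S ≡ T
  relative-injective {S} {T} eq = ⊆-antisym (⊆ S T eq) (⊆ T S (sym eq))
    where
    ⊆ : ∀ S T → relative S ≡ relative T → ∀ {p} → p ∈ₛ S → p ∈ₛ T
    ⊆ S T eq {p} p∈S = subst (_∈ₛ T) (from∘to p) (to (∈-preimage From.image T _)
      (subst (To.image p ∈ₛ_) eq (from (∈-preimage From.image S _) (subst (_∈ₛ S) (sym (from∘to p)) p∈S))))

  relative-bitLocus : ∀ w L → relative (bitLocus w L) ≡ bitLocus (map toCoords w) L
  relative-bitLocus w L = ⊆-antisym
    (λ {p} p∈ →
      let x , x∈ , x∼ = to (∈-bitLocus w L (From.image p)) (to (∈-preimage From.image _ p) p∈) in
      from (∈-bitLocus (map toCoords w) L p)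
        (x , x∈ , subst₂ _∼_ (toCoords-embed x) (to∘from p) (To.∼-image x∼)))
    (λ {p} p∈ →
      let x , x∈ , x∼ = to (∈-bitLocus (map toCoords w) L p) p∈ in
      from (∈-preimage From.image _ p) (from (∈-bitLocus w L (From.image p))
        (x , x∈ , subst (_∼ From.image p)
          (trans (cong fromCoords (sym (toCoords-embed x))) (fromCoords∘toCoords _))
          (From.∼-image x∼))))
    where
    toCoords-embed : ∀ x → toCoords (embedBits w x) ≡ embedBits (map toCoords w) x
    toCoords-embed x = map-combination toCoords toCoords-⊕ toCoords-· (map ι x) w

  relative-ovoid : ∀ w → relative (ovoid w) ≡ ovoid (map toCoords w)
  relative-ovoid w = relative-bitLocus w ovoidBits

  relative-quadrangle : ∀ w → relative (quadrangle w) ≡ quadrangle (map toCoords w)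
  relative-quadrangle w = relative-bitLocus w quadrangleBits

standardFrame : Vec (L₄.Vector 4) 4
standardFrame = (I ∷ O ∷ O ∷ O ∷ [])
              ∷ (O ∷ I ∷ O ∷ O ∷ [])
              ∷ (O ∷ O ∷ I ∷ O ∷ [])
              ∷ (O ∷ O ∷ O ∷ I ∷ []) ∷ []

AdjacentFrames : (v w : Vec (L₄.Vector 4) 4) → Set
AdjacentFrames v w = ∣ ovoid v ∩ ovoid w ∣ ≡ 1 × ∣ quadrangle v ∩ quadrangle w ∣ ≡ 6

e₁ : Vec Bool 4
e₁ = true ∷ false ∷ false ∷ false ∷ []

cyclicFrames : List (Vec (Vec Bool 4) 4)
cyclicFrames = List.iterate rotate
  ((true  ∷ false ∷ false ∷ false ∷ [])
  ∷ (false ∷ true  ∷ false ∷ false ∷ [])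
  ∷ (false ∷ false ∷ true  ∷ false ∷ [])
  ∷ (false ∷ false ∷ false ∷ true  ∷ []) ∷ []) 5
  where
  rotate : Vec (Vec Bool 4) 4 → Vec (Vec Bool 4) 4
  rotate (a ∷ b ∷ c ∷ d ∷ []) = b ∷ c ∷ d ∷ a L₂.⊕ b L₂.⊕ c L₂.⊕ d ∷ []

recombine : Vec (Vec Bool 4) 4 → Vec (L₄.Vector 4) 4 → Vec (L₄.Vector 4) 4
recombine R = map (λ a → combination a (map (map ι) R))

-- The ovoids adjacent to the standard one: two seeds through its first
-- point, the images of these under permutations of its other points, and
-- finally the images under cyclic permutations of all five points.
opaque
  neighboursThrough : List (Vec (L₄.Vector 4) 4)
  neighboursThrough = List.concatMap (λ S → List.map (λ v → map (λ a → combination a v) S) turned) seeds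
    where
    seeds : List (Vec (L₄.Vector 4) 4)
    seeds =
        ((I ∷ O ∷ O ∷ O ∷ []) ∷ (I ∷ I ∷ O ∷ O ∷ []) ∷ (O ∷ I ∷ ω ∷ ω ∷ []) ∷ (ω ∷ ω̄ ∷ O ∷ ω ∷ []) ∷ [])
      ∷ ((I ∷ O ∷ O ∷ O ∷ []) ∷ (I ∷ I ∷ O ∷ O ∷ []) ∷ (O ∷ I ∷ ω̄ ∷ ω̄ ∷ []) ∷ (ω̄ ∷ ω ∷ O ∷ ω̄ ∷ []) ∷ []) ∷ []
    turn : Vec (L₄.Vector 4) 4 → Vec (L₄.Vector 4) 4
    turn (a ∷ b ∷ c ∷ d ∷ []) = a ∷ c ∷ d ∷ a ⊕ b ⊕ c ⊕ d ∷ []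
    turned : List (Vec (L₄.Vector 4) 4)
    turned = List.iterate turn standardFrame 4

  neighbours : List (Vec (L₄.Vector 4) 4)
  neighbours = List.concatMap (λ R → List.map (recombine R) neighboursThrough) cyclicFrames

extensions : L₄.Vector 4 → List (L₄.Vector 4) → List (L₄.Vector 4)
extensions u = List.filter (λ v → h₀ u v ≟₄ I)

isotropicVectors : List (L₄.Vector 4)
isotropicVectors = List.filter (λ v → h₀ v v ≟₄ O) (toList (allVectors 4))

opaque
  framesThrough : L₄.Vector 4 → List (Vec (L₄.Vector 4) 4)
  framesThrough u = second (extensions u isotropicVectors)
    where
    fourth : L₄.Vector 4 → L₄.Vector 4 → List (L₄.Vector 4) → List (Vec (L₄.Vector 4) 4)
    fourth v w = List.map (λ x → u ∷ v ∷ w ∷ x ∷ [])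
    third : L₄.Vector 4 → List (L₄.Vector 4) → List (Vec (L₄.Vector 4) 4)
    third v ws = List.concatMap (λ w → fourth v w (extensions w ws)) ws
    second : List (L₄.Vector 4) → List (Vec (L₄.Vector 4) 4)
    second vs = List.concatMap (λ v → third v (extensions v vs)) vs

opaque
  unfolding framesThrough

  ∈-framesThrough : ∀ M → IsFrame h₀ M → M ∈ₗ framesThrough (head M)
  ∈-framesThrough (u ∷ v ∷ w ∷ x ∷ []) frame =
    within vs (within ws (∈ₗ-map⁺ _ (extension w x (hᵢⱼ 2F 3F) (extension v x (hᵢⱼ 1F 3F) xs))))
    where
    hᵢⱼ : ∀ i j → lookup (lookup (gram h₀ (u ∷ v ∷ w ∷ x ∷ [])) i) j ≡ lookup (lookup Γ i) j
    hᵢⱼ i j = cong (λ G → lookup (lookup G i) j) frame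
    extension : ∀ a b {bs} → h₀ a b ≡ I → b ∈ₗ bs → b ∈ₗ extensions a bs
    extension a b eq b∈ = ∈-filter⁺ (λ c → h₀ a c ≟₄ I) b∈ eq
    isotropic : ∀ a → h₀ a a ≡ O → a ∈ₗ isotropicVectors
    isotropic a eq = ∈-filter⁺ (λ c → h₀ c c ≟₄ O) (∈-toList⁺ (∈-allVectors a)) eq
    within : ∀ {A B : Set} {f : A → List B} {a b as} → a ∈ₗ as → b ∈ₗ f a → b ∈ₗ List.concatMap f as
    within {f = f} a∈ b∈ = ∈-concatMap⁺ f (Anyₗ.map (λ { refl → b∈ }) a∈)
    vs : v ∈ₗ extensions u isotropicVectors
    vs = extension u v (hᵢⱼ 0F 1F) (isotropic v (hᵢⱼ 1F 1F))
    ws : w ∈ₗ extensions v (extensions u isotropicVectors)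
    ws = extension v w (hᵢⱼ 1F 2F) (extension u w (hᵢⱼ 0F 2F) (isotropic w (hᵢⱼ 2F 2F)))
    xs : x ∈ₗ extensions u isotropicVectors
    xs = extension u x (hᵢⱼ 0F 3F) (isotropic x (hᵢⱼ 3F 3F))

private
  pair : Vec (L₄.Vector 4) 4 → PointSet × PointSet
  pair v = ovoid v , quadrangle v

  AdjacentPairs : (X Y : PointSet × PointSet) → Set
  AdjacentPairs (A , B) (A′ , B′) = ∣ A ∩ A′ ∣ ≡ 1 × ∣ B ∩ B′ ∣ ≡ 6

  adjacentPairs? : ∀ X Y → Dec (AdjacentPairs X Y)
  adjacentPairs? (A , B) (A′ , B′) = (∣ A ∩ A′ ∣ ℕ.≟ 1) ×-dec (∣ B ∩ B′ ∣ ℕ.≟ 6)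

  _≟ₛ_ : DecidableEquality PointSet
  _≟ₛ_ = Vec-≡-dec Bool._≟_

private
  CompleteAt : (X : PointSet × PointSet) → List PointSet → (Y : PointSet × PointSet) → Set
  CompleteAt X Ns Y =
      (proj₁ Y ≡ proj₁ X → proj₂ Y ≡ proj₂ X)
    × (AdjacentPairs X Y → Anyₗ.Any (proj₁ Y ≡_) Ns)

  Complete : PointSet × PointSet → List PointSet → Set
  Complete X Ns = Allₗ.All (CompleteAt X Ns ∘ pair) (framesThrough (map ι e₁))

  complete? : ∀ X Ns → Dec (Complete X Ns)
  complete? X Ns = Allₗ.all? (completeAt? ∘ pair) (framesThrough (map ι e₁))
    where
    completeAt? : ∀ Y → Dec (CompleteAt X Ns Y)
    completeAt? Y =
            ((proj₁ Y ≟ₛ proj₁ X) →-dec (proj₂ Y ≟ₛ proj₂ X))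
      ×-dec (adjacentPairs? X Y →-dec Anyₗ.any? (proj₁ Y ≟ₛ_) Ns)

  TriangleFree Extensible : List (PointSet × PointSet) → Set
  TriangleFree Ns = Allₗ.All (λ X → Allₗ.All (λ Y → AdjacentPairs X Y →
    Allₗ.All (λ Z → ¬ (AdjacentPairs X Z × AdjacentPairs Y Z)) Ns) Ns) Ns
  Extensible Ns = Allₗ.All (λ X → Anyₗ.Any (AdjacentPairs X) Ns) Ns

-- In the next checks the point sets are bound to variables, for Agda to
-- evaluate each of them only once.
opaque
  unfolding bitLocus locus framesThrough neighboursThrough neighbours

  neighbours-frames : Allₗ.All (IsFrame h₀) neighbours
  neighbours-frames = decide (Allₗ.all? (λ N → Vec-≡-dec _≟ᵥ_ (gram h₀ N) Γ) neighbours)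

  ∣ovoid∣≢1 : ∣ ovoid standardFrame ∩ ovoid standardFrame ∣ ≢ 1
  ∣ovoid∣≢1 ()

  neighbours-adjacent : Allₗ.All (AdjacentFrames standardFrame) neighbours
  neighbours-adjacent = decide (check (pair standardFrame))
    where
    check : ∀ X → Dec (Allₗ.All (AdjacentPairs X ∘ pair) neighbours)
    check X = Allₗ.all? (adjacentPairs? X ∘ pair) neighbours

  private
    complete : Complete (pair standardFrame) (List.map ovoid neighboursThrough)
    complete = decide (complete? (pair standardFrame) (List.map ovoid neighboursThrough))

    triangleFree : TriangleFree (List.map pair neighbours)
    triangleFree = decide (check (List.map pair neighbours))
      where
      check : ∀ Ns → Dec (TriangleFree Ns)
      check Ns = Allₗ.all? (λ X → Allₗ.all? (λ Y → adjacentPairs? X Y →-dec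
        Allₗ.all? (λ Z → ¬? (adjacentPairs? X Z ×-dec adjacentPairs? Y Z)) Ns) Ns) Ns

    extensible : Extensible (List.map pair neighbours)
    extensible = decide (check (List.map pair neighbours))
      where
      check : ∀ Ns → Dec (Extensible Ns)
      check Ns = Allₗ.all? (λ X → Anyₗ.any? (adjacentPairs? X) Ns) Ns

neighbours-triangleFree : ∀ {L M N} → L ∈ₗ neighbours → M ∈ₗ neighbours → N ∈ₗ neighbours →
  AdjacentFrames L M → AdjacentFrames L N → ¬ AdjacentFrames M N
neighbours-triangleFree L∈ M∈ N∈ L∼M L∼N M∼N =
  Allₗ.lookup (Allₗ.lookup (Allₗ.lookup triangleFree (∈ₗ-map⁺ pair L∈)) (∈ₗ-map⁺ pair M∈) L∼M)
    (∈ₗ-map⁺ pair N∈) (L∼N , M∼N)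

neighbours-extensible : ∀ {L} → L ∈ₗ neighbours → ∃[ M ] (M ∈ₗ neighbours × AdjacentFrames L M)
neighbours-extensible {L} L∈ =
  find (Anyₗ.map⁻ {f = pair} {P = AdjacentPairs (pair L)} (Allₗ.lookup extensible (∈ₗ-map⁺ pair L∈)))

neighboursThrough-complete : ∀ {M} → M ∈ₗ framesThrough (map ι e₁) →
    (ovoid M ≡ ovoid standardFrame → quadrangle M ≡ quadrangle standardFrame)
  × (AdjacentFrames standardFrame M → Anyₗ.Any (ovoid M ≡_) (List.map ovoid neighboursThrough))
neighboursThrough-complete M∈ = Allₗ.lookup complete M∈

opaque
  unfolding neighbours

  recombine-∈-neighbours : ∀ {R N} → R ∈ₗ cyclicFrames → N ∈ₗ neighboursThrough → recombine R N ∈ₗ neighbours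
  recombine-∈-neighbours {R} R∈ N∈ = ∈-concatMap⁺ (λ R → List.map (recombine R) neighboursThrough)
    (Anyₗ.map (λ { refl → ∈ₗ-map⁺ (recombine R) N∈ }) R∈)

map-ι-⊕ : ∀ {n} (x y : Vec Bool n) → map ι (x L₂.⊕ y) ≡ map ι x ⊕ map ι y
map-ι-⊕ []      []      = refl
map-ι-⊕ (a ∷ x) (b ∷ y) = cong₂ _∷_ (ι-+ a b) (map-ι-⊕ x y)
  where
  ι-+ : ∀ a b → ι (a xor b) ≡ ι a +₄ ι b
  ι-+ = decide (all? search-Bool λ a → all? search-Bool λ b → ι (a xor b) ≟₄ ι a +₄ ι b)

map-ι-· : ∀ {n} a (x : Vec Bool n) → map ι (a L₂.· x) ≡ ι a · map ι x
map-ι-· a []      = refl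
map-ι-· a (b ∷ x) = cong₂ _∷_ (ι-* a b) (map-ι-· a x)
  where
  ι-* : ∀ a b → ι (a ∧ b) ≡ ι a *₄ ι b
  ι-* = decide (all? search-Bool λ a → all? search-Bool λ b → ι (a ∧ b) ≟₄ ι a *₄ ι b)

map-ι-𝟎 : ∀ n → map ι (L₂.𝟎 {n}) ≡ 𝟎
map-ι-𝟎 zero    = refl
map-ι-𝟎 (suc n) = cong (O ∷_) (map-ι-𝟎 n)

map-ι-injective : ∀ {n} (x y : Vec Bool n) → map ι x ≡ map ι y → x ≡ y
map-ι-injective []      []      _  = refl
map-ι-injective (a ∷ x) (b ∷ y) eq =
  cong₂ _∷_ (ι-injective a b (proj₁ (∷-injective eq))) (map-ι-injective x y (proj₂ (∷-injective eq)))
  where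
  ι-injective : ∀ a b → ι a ≡ ι b → a ≡ b
  ι-injective = decide (all? search-Bool λ a → all? search-Bool λ b → (ι a ≟₄ ι b) →-dec (a Bool.≟ b))

embedBits-combination : ∀ {k n} (w : Vec (L₄.Vector n) 4) y (R : Vec (Vec Bool 4) k) →
  combination (map ι y) (map (embedBits w) R) ≡ embedBits w (L₂.combination y R)
embedBits-combination w []      []      = sym (begin
  combination (map ι L₂.𝟎) w  ≡⟨ cong (λ a → combination a w) (map-ι-𝟎 4) ⟩
  combination 𝟎 w             ≡⟨ combination-𝟎 w ⟩
  𝟎                           ∎)
  where
  open ≡-Reasoning
  combination-𝟎 : ∀ {k n} (w : Vec (L₄.Vector n) k) → combination 𝟎 w ≡ 𝟎
  combination-𝟎 w = trans (cong (λ a → combination a w) (sym (·-zeroˡ 𝟎)))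
    (trans (combination-· w O 𝟎) (·-zeroˡ _))
embedBits-combination w (a ∷ y) (r ∷ R) = begin
  ι a · embedBits w r ⊕ combination (map ι y) (map (embedBits w) R)
    ≡⟨ cong₂ _⊕_ (sym (combination-· w (ι a) (map ι r))) (embedBits-combination w y R) ⟩
  combination (ι a · map ι r) w ⊕ embedBits w (L₂.combination y R)
    ≡⟨ combination-⊕ w (ι a · map ι r) (map ι (L₂.combination y R)) ⟨
  combination (ι a · map ι r ⊕ map ι (L₂.combination y R)) w
    ≡⟨ cong (λ b → combination b w) (cong (_⊕ map ι (L₂.combination y R)) (sym (map-ι-· a r))) ⟩
  combination (map ι (a L₂.· r) ⊕ map ι (L₂.combination y R)) w
    ≡⟨ cong (λ b → combination b w) (map-ι-⊕ (a L₂.· r) (L₂.combination y R)) ⟨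
  embedBits w (L₂.combination (a ∷ y) (r ∷ R)) ∎
  where open ≡-Reasoning

-- Changing the frame of an ovoid

Stabilises : Vec (Vec Bool 4) 4 → List (Vec Bool 4) → Set
Stabilises R L = Allₗ.All (λ y → L₂.combination y R ∈ₗ L) L
               × Allₗ.All (λ x → Anyₗ.Any (λ y → x ≡ L₂.combination y R) L) L

recombine-bitLocus : ∀ w R L → Stabilises R L → bitLocus (map (embedBits w) R) L ≡ bitLocus w L
recombine-bitLocus w R L (into , onto) = ⊆-antisym
  (λ {p} p∈ → from (∈-bitLocus w L p) (⊆₁ (to (∈-bitLocus (map (embedBits w) R) L p) p∈)))
  (λ {p} p∈ → from (∈-bitLocus (map (embedBits w) R) L p) (⊆₂ (to (∈-bitLocus w L p) p∈)))
  where
  ⊆₁ : ∀ {p} → ∃[ y ] (y ∈ₗ L × embedBits (map (embedBits w) R) y ∼ p) → ∃[ x ] (x ∈ₗ L × embedBits w x ∼ p)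
  ⊆₁ {p} (y , y∈ , y∼p) =
    L₂.combination y R , Allₗ.lookup into y∈ , subst (_∼ p) (embedBits-combination w y R) y∼p
  ⊆₂ : ∀ {p} → ∃[ x ] (x ∈ₗ L × embedBits w x ∼ p) → ∃[ y ] (y ∈ₗ L × embedBits (map (embedBits w) R) y ∼ p)
  ⊆₂ {p} (x , x∈ , x∼p) with find (Allₗ.lookup onto x∈)
  ... | y , y∈ , refl = y , y∈ , subst (_∼ p) (sym (embedBits-combination w y R)) x∼p

rescale-bitLocus : ∀ w c L → c ≢ O → bitLocus (map (c ·_) w) L ≡ bitLocus w L
rescale-bitLocus w c L c≢O = ⊆-antisym
  (λ {p} p∈ → from (∈-bitLocus w L p) (map₂ (λ {x} → map₂ (unscale {x})) (to (∈-bitLocus (map (c ·_) w) L p) p∈)))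
  (λ {p} p∈ → from (∈-bitLocus (map (c ·_) w) L p) (map₂ (λ {x} → map₂ (scale {x})) (to (∈-bitLocus w L p) p∈)))
  where
  open ≡-Reasoning
  c-commutes : ∀ {n} a (u : L₄.Vector n) → c · (a · u) ≡ a · (c · u)
  c-commutes a u = trans (sym (·-assoc c a u)) (trans (cong (_· u) (*-comm c a)) (·-assoc a c u))
  embed-scale : ∀ x → embedBits (map (c ·_) w) x ≡ c · embedBits w x
  embed-scale x = sym (map-combination (c ·_) (·-distribˡ c) c-commutes (map ι x) w)
  scale : ∀ {x p} → embedBits w x ∼ p → embedBits (map (c ·_) w) x ∼ p
  scale {x} {p} x∼p = subst (_∼ p) (sym (embed-scale x)) (∼-· c c≢O x∼p)
  unscale : ∀ {x p} → embedBits (map (c ·_) w) x ∼ p → embedBits w x ∼ p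
  unscale {x} {p} x∼p with d , d≢O , dc≡I ← inverse c c≢O = subst (_∼ p) (begin
    d · embedBits (map (c ·_) w) x  ≡⟨ cong (d ·_) (embed-scale x) ⟩
    d · (c · embedBits w x)         ≡⟨ ·-assoc d c _ ⟨
    (d *₄ c) · embedBits w x        ≡⟨ cong (_· embedBits w x) dc≡I ⟩
    I · embedBits w x               ≡⟨ ·-identity _ ⟩
    embedBits w x                   ∎) (∼-· d d≢O x∼p)

IsRotation : Vec Bool 4 → Vec (Vec Bool 4) 4 → Set
IsRotation x R = head R ≡ x × L₂.combination e₁ R ≡ x × gram h₀ (map (map ι) R) ≡ Γ
               × Stabilises R ovoidBits × Stabilises R quadrangleBits

rotations : Allₗ.All (λ x → Anyₗ.Any (IsRotation x) cyclicFrames) ovoidBits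
rotations = decide (Allₗ.all? (λ x → Anyₗ.any? (isRotation? x) cyclicFrames) ovoidBits)
  where
  stabilises? : ∀ R L → Dec (Stabilises R L)
  stabilises? R L = Allₗ.all? (λ y → Anyₗ.any? (L₂.combination y R ≟ᵇ_) L) L
              ×-dec Allₗ.all? (λ x → Anyₗ.any? (λ y → x ≟ᵇ L₂.combination y R) L) L
  isRotation? : ∀ x R → Dec (IsRotation x R)
  isRotation? x R = (head R ≟ᵇ x) ×-dec (L₂.combination e₁ R ≟ᵇ x)
              ×-dec Vec-≡-dec _≟ᵥ_ (gram h₀ (map (map ι) R)) Γ
              ×-dec stabilises? R ovoidBits ×-dec stabilises? R quadrangleBits

map-head : ∀ {A B : Set} {n} (f : A → B) (xs : Vec A (suc n)) → head (map f xs) ≡ f (head xs)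
map-head f (x ∷ xs) = refl

map-combination-standardFrame : ∀ {n} (v : Vec (L₄.Vector n) 4) → map (λ a → combination a v) standardFrame ≡ v
map-combination-standardFrame (a ∷ b ∷ c ∷ d ∷ []) = cong₂ _∷_
  (trans (cong (I · a ⊕_) (trans (skip b _) (trans (skip c _) (skip d _)))) (keep a)) (cong₂ _∷_
  (trans (skip a _) (trans (cong (I · b ⊕_) (trans (skip c _) (skip d _))) (keep b))) (cong₂ _∷_
  (trans (skip a _) (trans (skip b _) (trans (cong (I · c ⊕_) (skip d _)) (keep c)))) (cong (_∷ [])
  (trans (skip a _) (trans (skip b _) (trans (skip c _) (keep d)))))))
  where
  skip : ∀ {n} (u w : L₄.Vector n) → O · u ⊕ w ≡ w
  skip []      []      = refl
  skip (_ ∷ u) (x ∷ w) = cong (x ∷_) (skip u w)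
  keep : ∀ {n} (u : L₄.Vector n) → I · u ⊕ 𝟎 ≡ u
  keep u = trans (⊕-identityʳ _) (·-identity u)

module Frames {h : L₄.Form 4} (unitary : IsUnitary h) where

  open IsUnitary unitary
  open L₄.IsSesquilinear sesquilinear
  open ≡-Reasoning

  recombine-frame : ∀ w R → IsFrame h w → gram h₀ (map (map ι) R) ≡ Γ → IsFrame h (map (embedBits w) R)
  recombine-frame w R frame R-frame = begin
    gram h (map (embedBits w) R)
      ≡⟨ cong (gram h) (map-∘ (λ a → combination a w) (map ι) R) ⟩
    gram h (map (λ a → combination a w) (map (map ι) R))
      ≡⟨ Coordinates.fromCoords-frame unitary frame R-frame ⟩
    Γ ∎

  rescale-frame : ∀ w c → c ≢ O → IsFrame h w → IsFrame h (map (c ·_) w)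
  rescale-frame w c c≢O = trans (gram-map h-scale w)
    where
    norm≡I : ∀ c x → c ≢ O → c *₄ (frobenius c *₄ x) ≡ x
    norm≡I = decide (all? search-𝔽₄ λ c → all? search-𝔽₄ λ x → ¬? (c ≟₄ O) →-dec (c *₄ (frobenius c *₄ x) ≟₄ x))
    h-scale : ∀ a b → h (c · a) (c · b) ≡ h a b
    h-scale a b = begin
      h (c · a) (c · b)             ≡⟨ homogeneousˡ c a _ ⟩
      c *₄ h a (c · b)              ≡⟨ cong (c *₄_) (homogeneousʳ c a b) ⟩
      c *₄ (frobenius c *₄ h a b)   ≡⟨ norm≡I c _ c≢O ⟩
      h a b                         ∎

  reframe : ∀ {a w p} → IsFrame h w → a ∼ p → p ∈ₛ ovoid w →
    ∃[ u ] (IsFrame h u × head u ≡ a × ovoid u ≡ ovoid w × quadrangle u ≡ quadrangle w)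
  reframe {a} {w} {p} frame a∼p p∈w
    = case to (∈-bitLocus w ovoidBits p) p∈w of λ
      { (y , y∈ , y∼p) → case find (Allₗ.lookup rotations y∈) ,′ ∼-scalar a∼p y∼p of λ
      { ((R , _ , R≡y , _ , R-frame , ovoid-R , quadrangle-R) , (c , c≢O , eq)) →
        let u = map (embedBits w) R in
        map (c ·_) u , rescale-frame u c c≢O (recombine-frame w R frame R-frame)
      , (begin
          head (map (c ·_) u)                 ≡⟨ map-head (c ·_) u ⟩
          c · head (map (embedBits w) R)      ≡⟨ cong (c ·_) (map-head (embedBits w) R) ⟩
          c · embedBits w (head R)            ≡⟨ cong (λ z → c · embedBits w z) R≡y ⟩
          c · embedBits w y                   ≡⟨ eq ⟨
          a                                   ∎)
      , trans (rescale-bitLocus u c ovoidBits c≢O) (recombine-bitLocus w R ovoidBits ovoid-R)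
      , trans (rescale-bitLocus u c quadrangleBits c≢O) (recombine-bitLocus w R quadrangleBits quadrangle-R) } }

∣S∣≡1⇒nonempty : ∀ {n} (S : Subset n) → ∣ S ∣ ≡ 1 → ∃[ p ] p ∈ₛ S
∣S∣≡1⇒nonempty {n} S ∣S∣≡1 = decidable-stable (nonempty? S) λ empty →
  contradiction (trans (sym ∣S∣≡1) (trans (cong ∣_∣ (Empty-unique empty)) (∣⊥∣≡0 n))) λ ()

opaque
  unfolding neighbours

  someNeighbour : ∃[ N ] N ∈ₗ neighbours
  someNeighbour = _ , here refl

module FromFrame {h : L₄.Form 4} (unitary : IsUnitary h)
                 {v : Vec (L₄.Vector 4) 4} (frame : IsFrame h v) where

  open Coordinates unitary frame
  open Frames unitary
  open ≡-Reasoning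

  coordsOf fromCoordsOf : Vec (L₄.Vector 4) 4 → Vec (L₄.Vector 4) 4
  coordsOf = map toCoords
  fromCoordsOf = map fromCoords

  coordsOf-fromCoordsOf : ∀ M → coordsOf (fromCoordsOf M) ≡ M
  coordsOf-fromCoordsOf M = begin
    map toCoords (map fromCoords M)  ≡⟨ map-∘ toCoords fromCoords M ⟨
    map (toCoords ∘ fromCoords) M    ≡⟨ map-cong toCoords∘fromCoords M ⟩
    map id M                         ≡⟨ map-id M ⟩
    M                                ∎

  coordsOf-v : coordsOf v ≡ standardFrame
  coordsOf-v = trans (cong coordsOf (sym (map-combination-standardFrame v))) (coordsOf-fromCoordsOf standardFrame)

  relative-v : relative (ovoid v) ≡ ovoid standardFrame
  relative-v = trans (relative-ovoid v) (cong ovoid coordsOf-v)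

  coordsOf-adjacent : ∀ {w u} → AdjacentFrames w u → AdjacentFrames (coordsOf w) (coordsOf u)
  coordsOf-adjacent {w} {u} (∣O∣ , ∣W∣) =
      trans (cong₂ (λ S T → ∣ S ∩ T ∣) (sym (relative-ovoid w)) (sym (relative-ovoid u)))
        (trans (relative-∣∩∣ (ovoid w) (ovoid u)) ∣O∣)
    , trans (cong₂ (λ S T → ∣ S ∩ T ∣) (sym (relative-quadrangle w)) (sym (relative-quadrangle u)))
        (trans (relative-∣∩∣ (quadrangle w) (quadrangle u)) ∣W∣)

  fromCoordsOf-adjacent : ∀ {M N} → AdjacentFrames M N → AdjacentFrames (fromCoordsOf M) (fromCoordsOf N)
  fromCoordsOf-adjacent {M} {N} (∣O∣ , ∣W∣) =
      trans (sym (relative-∣∩∣ (ovoid (fromCoordsOf M)) _))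
        (trans (cong₂ (λ S T → ∣ S ∩ T ∣)
          (relative-from ovoid relative-ovoid M) (relative-from ovoid relative-ovoid N)) ∣O∣)
    , trans (sym (relative-∣∩∣ (quadrangle (fromCoordsOf M)) _))
        (trans (cong₂ (λ S T → ∣ S ∩ T ∣)
          (relative-from quadrangle relative-quadrangle M) (relative-from quadrangle relative-quadrangle N)) ∣W∣)
    where
    relative-from : ∀ (F : Vec (L₄.Vector 4) 4 → PointSet) → (∀ w → relative (F w) ≡ F (coordsOf w)) →
      ∀ M → relative (F (fromCoordsOf M)) ≡ F M
    relative-from F F-relative M = trans (F-relative (fromCoordsOf M)) (cong F (coordsOf-fromCoordsOf M))

  reframe-coords : ∀ {w p} → IsFrame h w → embedBits v e₁ ∼ p → p ∈ₛ ovoid w →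
    ∃[ u ] (coordsOf u ∈ₗ framesThrough (map ι e₁) × ovoid u ≡ ovoid w × quadrangle u ≡ quadrangle w)
  reframe-coords {w} {p} w-frame e₁∼p p∈w =
    map₂ (λ {u} (u-frame , head-u , u≡w) → coordsOf-∈ u u-frame head-u , u≡w)
      (reframe {embedBits v e₁} {w} {p} w-frame e₁∼p p∈w)
    where
    coordsOf-∈ : ∀ u → IsFrame h u → head u ≡ embedBits v e₁ → coordsOf u ∈ₗ framesThrough (map ι e₁)
    coordsOf-∈ u u-frame head-u = subst (λ a → coordsOf u ∈ₗ framesThrough a)
      (trans (map-head toCoords u) (trans (cong toCoords head-u) (toCoords∘fromCoords (map ι e₁))))
      (∈-framesThrough (coordsOf u) (toCoords-frame {u} u-frame))

  quadrangle-determined : ∀ {w} → IsFrame h w → ovoid w ≡ ovoid v → quadrangle w ≡ quadrangle v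
  quadrangle-determined {w} w-frame Ow≡Ov = go (pointOf (embedBits v e₁) ((λ ()) ∘ fromCoords≢𝟎 (map ι e₁)))
    where
    coords-quadrangle : ∀ u → coordsOf u ∈ₗ framesThrough (map ι e₁) →
      ovoid u ≡ ovoid v → quadrangle u ≡ quadrangle v
    coords-quadrangle u u∈ Ou≡Ov = relative-injective (begin
      relative (quadrangle u)    ≡⟨ relative-quadrangle u ⟩
      quadrangle (coordsOf u)    ≡⟨ proj₁ (neighboursThrough-complete u∈)
        (trans (sym (relative-ovoid u)) (trans (cong relative Ou≡Ov) relative-v)) ⟩
      quadrangle standardFrame   ≡⟨ cong quadrangle coordsOf-v ⟨
      quadrangle (coordsOf v)    ≡⟨ relative-quadrangle v ⟨
      relative (quadrangle v)    ∎)
    go : ∃[ p ] embedBits v e₁ ∼ p → quadrangle w ≡ quadrangle v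
    go (p , e₁∼p) = conclude (reframe-coords {w} {p} w-frame e₁∼p
        (subst (p ∈ₛ_) (sym Ow≡Ov) (from (∈-bitLocus v ovoidBits p) (e₁ , here refl , e₁∼p))))
      where
      conclude : ∃[ u ] (coordsOf u ∈ₗ framesThrough (map ι e₁) ×
                         ovoid u ≡ ovoid w × quadrangle u ≡ quadrangle w) →
        quadrangle w ≡ quadrangle v
      conclude (u , u∈ , Ou≡Ow , Wu≡Ww) = trans (sym Wu≡Ww) (coords-quadrangle u u∈ (trans Ou≡Ow Ow≡Ov))

  fromNeighbour-frame : ∀ {N} → N ∈ₗ neighbours → IsFrame h (fromCoordsOf N)
  fromNeighbour-frame N∈ = fromCoords-frame (Allₗ.lookup neighbours-frames N∈)

  fromNeighbour-adjacent : ∀ {N} → N ∈ₗ neighbours → AdjacentFrames v (fromCoordsOf N)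
  fromNeighbour-adjacent {N} N∈ =
    subst (λ u → AdjacentFrames u (fromCoordsOf N)) (map-combination-standardFrame v)
    (fromCoordsOf-adjacent (Allₗ.lookup neighbours-adjacent N∈))

  toNeighbourThrough : ∀ {w p} → IsFrame h w → AdjacentFrames v w → embedBits v e₁ ∼ p → p ∈ₛ ovoid w →
    ∃[ N ] (N ∈ₗ neighboursThrough × ovoid w ≡ ovoid (fromCoordsOf N))
  toNeighbourThrough {w} {p} w-frame v∼w e₁∼p p∈w = go (reframe-coords {w} {p} w-frame e₁∼p p∈w)
    where
    relative-neighbour : ∀ u N → ovoid (coordsOf u) ≡ ovoid N → ovoid u ≡ ovoid (fromCoordsOf N)
    relative-neighbour u N eq = relative-injective (begin
      relative (ovoid u)                   ≡⟨ relative-ovoid u ⟩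
      ovoid (coordsOf u)                   ≡⟨ eq ⟩
      ovoid N                              ≡⟨ cong ovoid (coordsOf-fromCoordsOf N) ⟨
      ovoid (coordsOf (fromCoordsOf N))    ≡⟨ relative-ovoid (fromCoordsOf N) ⟨
      relative (ovoid (fromCoordsOf N))    ∎)
    go : ∃[ u ] (coordsOf u ∈ₗ framesThrough (map ι e₁) × ovoid u ≡ ovoid w × quadrangle u ≡ quadrangle w) →
      ∃[ N ] (N ∈ₗ neighboursThrough × ovoid w ≡ ovoid (fromCoordsOf N))
    go (u , u∈ , Ou≡Ow , Wu≡Ww) =
      map₂ (λ {N} → map₂ (λ eq → trans (sym Ou≡Ow) (relative-neighbour u N eq)))
        (find (Anyₗ.map⁻ {f = ovoid} {P = ovoid (coordsOf u) ≡_} (proj₂ (neighboursThrough-complete u∈)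
          (subst (λ v′ → AdjacentFrames v′ (coordsOf u)) coordsOf-v (coordsOf-adjacent {v} {u} v∼u)))))
      where
      v∼u : AdjacentFrames v u
      v∼u = subst₂ (λ S T → ∣ ovoid v ∩ S ∣ ≡ 1 × ∣ quadrangle v ∩ T ∣ ≡ 6) (sym Ou≡Ow) (sym Wu≡Ww) v∼w

  ¬self-adjacent : ¬ AdjacentFrames v v
  ¬self-adjacent v∼v = ∣ovoid∣≢1 (proj₁ (subst (λ u → AdjacentFrames u u) coordsOf-v (coordsOf-adjacent v∼v)))

quadrangle-unique : ∀ {h v w} → IsUnitary h → IsFrame h v → IsFrame h w →
  ovoid v ≡ ovoid w → quadrangle v ≡ quadrangle w
quadrangle-unique unitary v-frame w-frame = FromFrame.quadrangle-determined unitary w-frame v-frame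

adjacentFrames-resp : ∀ {h v v′ w w′} → IsUnitary h → IsFrame h v → IsFrame h v′ → IsFrame h w → IsFrame h w′ →
  ovoid v ≡ ovoid v′ → ovoid w ≡ ovoid w′ → AdjacentFrames v w → AdjacentFrames v′ w′
adjacentFrames-resp {h} {v} {v′} {w} {w′} unitary v-frame v′-frame w-frame w′-frame Ov Ow (∣O∣ , ∣W∣) =
    trans (cong₂ (λ S T → ∣ S ∩ T ∣) (sym Ov) (sym Ow)) ∣O∣
  , trans (cong₂ (λ S T → ∣ S ∩ T ∣) (sym (quadrangle-unique {h} {v} {v′} unitary v-frame v′-frame Ov))
                                     (sym (quadrangle-unique {h} {w} {w′} unitary w-frame w′-frame Ow))) ∣W∣

module _ {h : L₄.Form 4} (unitary : IsUnitary h) {v : Vec (L₄.Vector 4) 4} (frame : IsFrame h v) where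

  open FromFrame unitary frame

  toNeighbour : ∀ {w} → IsFrame h w → AdjacentFrames v w →
    ∃[ N ] (N ∈ₗ neighbours × ovoid w ≡ ovoid (fromCoordsOf N))
  toNeighbour {w} w-frame v∼w = common (∣S∣≡1⇒nonempty (ovoid v ∩ ovoid w) (proj₁ v∼w))
    where
    open Frames unitary
    fromCoordsOf-recombine : ∀ R N →
      map (λ a → combination a (map (embedBits v) R)) N ≡ fromCoordsOf (recombine R N)
    fromCoordsOf-recombine R N = trans (map-cong (λ a → sym (trans
        (map-combination (λ b → combination b v) (combination-⊕ v) (combination-· v) a (map (map ι) R))
        (cong (combination a) (sym (map-∘ (λ b → combination b v) (map ι) R))))) N)
      (map-∘ (λ b → combination b v) (λ a → combination a (map (map ι) R)) N)
    rotated : ∀ {x p} → embedBits v x ∼ p → p ∈ₛ ovoid w → ∃[ R ] (R ∈ₗ cyclicFrames × IsRotation x R) →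
      ∃[ N ] (N ∈ₗ neighbours × ovoid w ≡ ovoid (fromCoordsOf N))
    rotated {x} {p} x∼p p∈w (R , R∈ , _ , e₁R≡x , R-frame , ovoid-R , quadrangle-R) =
      recombined (FromFrame.toNeighbourThrough unitary v′-frame {w} {p} w-frame v′∼w e₁∼p p∈w)
      where
      v′ : Vec (L₄.Vector 4) 4
      v′ = map (embedBits v) R
      v′-frame : IsFrame h v′
      v′-frame = recombine-frame v R frame R-frame
      v′∼w : AdjacentFrames v′ w
      v′∼w = subst₂ (λ S T → ∣ S ∩ ovoid w ∣ ≡ 1 × ∣ T ∩ quadrangle w ∣ ≡ 6)
        (sym (recombine-bitLocus v R ovoidBits ovoid-R))
        (sym (recombine-bitLocus v R quadrangleBits quadrangle-R)) v∼w
      e₁∼p : embedBits v′ e₁ ∼ p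
      e₁∼p = subst (_∼ p) (sym (trans (embedBits-combination v e₁ R) (cong (embedBits v) e₁R≡x))) x∼p
      recombined : ∃[ N ] (N ∈ₗ neighboursThrough × ovoid w ≡ ovoid (map (λ a → combination a v′) N)) →
        ∃[ N ] (N ∈ₗ neighbours × ovoid w ≡ ovoid (fromCoordsOf N))
      recombined (N , N∈ , eq) = recombine R N , recombine-∈-neighbours {R} {N} R∈ N∈
        , trans eq (cong ovoid (fromCoordsOf-recombine R N))
    located : ∀ {p} → p ∈ₛ ovoid w → ∃[ x ] (x ∈ₗ ovoidBits × embedBits v x ∼ p) →
      ∃[ N ] (N ∈ₗ neighbours × ovoid w ≡ ovoid (fromCoordsOf N))
    located {p} p∈w (x , x∈ , x∼p) = rotated {x} {p} x∼p p∈w (find (Allₗ.lookup rotations x∈))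
    common : ∃[ p ] p ∈ₛ ovoid v ∩ ovoid w → ∃[ N ] (N ∈ₗ neighbours × ovoid w ≡ ovoid (fromCoordsOf N))
    common (p , p∈) = located {p} (proj₂ (x∈p∩q⁻ (ovoid v) (ovoid w) p∈))
      (to (∈-bitLocus v ovoidBits p) (proj₁ (x∈p∩q⁻ (ovoid v) (ovoid w) p∈)))

  neighbour-exists : ∃[ w ] (IsFrame h w × AdjacentFrames v w)
  neighbour-exists = Product.map fromCoordsOf
    (λ {N} N∈ → fromNeighbour-frame {N} N∈ , fromNeighbour-adjacent {N} N∈) someNeighbour

  common-neighbour-exists : ∀ {w} → IsFrame h w → AdjacentFrames v w →
    ∃[ u ] (IsFrame h u × AdjacentFrames v u × AdjacentFrames w u)
  common-neighbour-exists {w} w-frame v∼w = extend (toNeighbour {w} w-frame v∼w)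
    where
    adjacent : ∀ N M → N ∈ₗ neighbours → M ∈ₗ neighbours → ovoid w ≡ ovoid (fromCoordsOf N) →
      AdjacentFrames N M → AdjacentFrames w (fromCoordsOf M)
    adjacent N M N∈ M∈ Ow≡ON N∼M = adjacentFrames-resp
      {h} {fromCoordsOf N} {w} {fromCoordsOf M} {fromCoordsOf M} unitary
      (fromNeighbour-frame {N} N∈) w-frame (fromNeighbour-frame {M} M∈) (fromNeighbour-frame {M} M∈)
      (sym Ow≡ON) refl (fromCoordsOf-adjacent {N} {M} N∼M)
    extend : ∃[ N ] (N ∈ₗ neighbours × ovoid w ≡ ovoid (fromCoordsOf N)) →
      ∃[ u ] (IsFrame h u × AdjacentFrames v u × AdjacentFrames w u)
    extend (N , N∈ , Ow≡ON) = extend′ (neighbours-extensible {N} N∈)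
      where
      extend′ : ∃[ M ] (M ∈ₗ neighbours × AdjacentFrames N M) →
        ∃[ u ] (IsFrame h u × AdjacentFrames v u × AdjacentFrames w u)
      extend′ (M , M∈ , N∼M) = fromCoordsOf M , fromNeighbour-frame {M} M∈ , fromNeighbour-adjacent {M} M∈
        , adjacent N M N∈ M∈ Ow≡ON N∼M

  no-tetrahedron : ∀ {a b c} → IsFrame h a → IsFrame h b → IsFrame h c →
    AdjacentFrames v a → AdjacentFrames v b → AdjacentFrames v c →
    AdjacentFrames a b → AdjacentFrames a c → ¬ AdjacentFrames b c
  no-tetrahedron {a} {b} {c} a-frame b-frame c-frame v∼a v∼b v∼c a∼b a∼c b∼c =
    go (toNeighbour {a} a-frame v∼a) (toNeighbour {b} b-frame v∼b) (toNeighbour {c} c-frame v∼c)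
    where
    descend : ∀ M N w u → M ∈ₗ neighbours → N ∈ₗ neighbours → IsFrame h w → IsFrame h u →
      ovoid w ≡ ovoid (fromCoordsOf M) → ovoid u ≡ ovoid (fromCoordsOf N) →
      AdjacentFrames w u → AdjacentFrames M N
    descend M N w u M∈ N∈ w-frame u-frame Ow Ou w∼u =
      subst₂ AdjacentFrames (coordsOf-fromCoordsOf M) (coordsOf-fromCoordsOf N)
        (coordsOf-adjacent {fromCoordsOf M} {fromCoordsOf N} (adjacentFrames-resp
          {h} {w} {fromCoordsOf M} {u} {fromCoordsOf N} unitary
          w-frame (fromNeighbour-frame {M} M∈) u-frame (fromNeighbour-frame {N} N∈) Ow Ou w∼u))
    NeighbourOf : Vec (L₄.Vector 4) 4 → Set
    NeighbourOf w = ∃[ N ] (N ∈ₗ neighbours × ovoid w ≡ ovoid (fromCoordsOf N))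
    go : NeighbourOf a → NeighbourOf b → NeighbourOf c → ⊥
    go (A , A∈ , Oa) (B , B∈ , Ob) (C , C∈ , Oc) = neighbours-triangleFree {A} {B} {C} A∈ B∈ C∈
      (descend A B a b A∈ B∈ a-frame b-frame Oa Ob a∼b)
      (descend A C a c A∈ C∈ a-frame c-frame Oa Oc a∼c)
      (descend B C b c B∈ C∈ b-frame c-frame Ob Oc b∼c)

-- Elliptic quadratic forms in four variables over GF(2)

Coefficients : Set
Coefficients = Vec Bool 10

quadraticForm : Coefficients → Vec Bool 4 → Bool
quadraticForm (q₁ ∷ q₂ ∷ q₃ ∷ q₄ ∷ b₁₂ ∷ b₁₃ ∷ b₁₄ ∷ b₂₃ ∷ b₂₄ ∷ b₃₄ ∷ []) (a ∷ b ∷ c ∷ d ∷ []) =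
  (((a ∧ a) ∧ q₁) xor
  (((b ∧ b) ∧ q₂) xor
  (((c ∧ c) ∧ q₃) xor ((d ∧ d) ∧ q₄) xor (c ∧ d ∧ b₃₄)) xor
  (b ∧ ((c ∧ b₂₃) xor (d ∧ b₂₄)))) xor
  (a ∧ ((b ∧ b₁₂) xor (c ∧ b₁₃) xor (d ∧ b₁₄))))

module _ {Q : Vec Bool 4 → Bool} (quadratic : L₂.IsQuadratic Q) where

  open L₂.IsQuadratic quadratic
  open L₂.IsSesquilinear bilinear

  private
    B : L₂.Form 4
    B = L₂.polarForm Q
    δ₁ δ₂ δ₃ δ₄ : Vec Bool 4
    δ₁ = true  ∷ false ∷ false ∷ false ∷ []
    δ₂ = false ∷ true  ∷ false ∷ false ∷ []
    δ₃ = false ∷ false ∷ true  ∷ false ∷ []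
    δ₄ = false ∷ false ∷ false ∷ true  ∷ []

    Q-⊕ : ∀ u v → Q (u L₂.⊕ v) ≡ Q u xor Q v xor B u v
    Q-⊕ u v = lemma (Q (u L₂.⊕ v)) (Q u) (Q v)
      where
      lemma : ∀ x y z → x ≡ y xor z xor ((x xor y) xor z)
      lemma = decide (all? search-Bool λ x → all? search-Bool λ y → all? search-Bool λ z →
        x Bool.≟ (y xor z xor ((x xor y) xor z)))

    expand : ∀ x → x ≡ (lookup x 0F L₂.· δ₁) L₂.⊕ ((lookup x 1F L₂.· δ₂) L₂.⊕
      ((lookup x 2F L₂.· δ₃) L₂.⊕ (lookup x 3F L₂.· δ₄)))
    expand = decide (all? search-Bits λ x → x ≟ᵇ ((lookup x 0F L₂.· δ₁) L₂.⊕ ((lookup x 1F L₂.· δ₂) L₂.⊕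
      ((lookup x 2F L₂.· δ₃) L₂.⊕ (lookup x 3F L₂.· δ₄)))))

  coefficients : Coefficients
  coefficients = Q δ₁ ∷ Q δ₂ ∷ Q δ₃ ∷ Q δ₄ ∷ B δ₁ δ₂ ∷ B δ₁ δ₃ ∷ B δ₁ δ₄ ∷ B δ₂ δ₃ ∷ B δ₂ δ₄ ∷ B δ₃ δ₄ ∷ []

  quadraticForm-complete : ∀ x → Q x ≡ quadraticForm coefficients x
  quadraticForm-complete x@(a ∷ b ∷ c ∷ d ∷ []) = trans (cong Q (expand x))
    (trans (Q-⊕ (a L₂.· δ₁) _) (cong₂ _xor_ (homogeneous a δ₁) (cong₂ _xor_
      (trans (Q-⊕ (b L₂.· δ₂) _) (cong₂ _xor_ (homogeneous b δ₂) (cong₂ _xor_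
        (trans (Q-⊕ (c L₂.· δ₃) (d L₂.· δ₄)) (cong₂ _xor_ (homogeneous c δ₃) (cong₂ _xor_
          (homogeneous d δ₄)
          (trans (homogeneousˡ c δ₃ (d L₂.· δ₄)) (cong (c ∧_) (homogeneousʳ d δ₃ δ₄))))))
        (trans (homogeneousˡ b δ₂ _) (cong (b ∧_) (trans (additiveʳ δ₂ (c L₂.· δ₃) (d L₂.· δ₄))
          (cong₂ _xor_ (homogeneousʳ c δ₂ δ₃) (homogeneousʳ d δ₂ δ₄))))))))
      (trans (homogeneousˡ a δ₁ _) (cong (a ∧_) (trans (additiveʳ δ₁ (b L₂.· δ₂) _)
        (cong₂ _xor_ (homogeneousʳ b δ₁ δ₂) (trans (additiveʳ δ₁ (c L₂.· δ₃) (d L₂.· δ₄))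
          (cong₂ _xor_ (homogeneousʳ c δ₁ δ₃) (homogeneousʳ d δ₁ δ₄))))))))))

IsEllipticBasis : (Vec Bool 4 → Bool) → Vec (Vec Bool 4) 4 → Set
IsEllipticBasis Q R = (∀ y → Q (L₂.combination y R) ≡ Q₀ y)
                    × (∀ y → y ≢ L₂.𝟎 → L₂.combination y R ≢ L₂.𝟎)
                    × (∀ x → x ≢ L₂.𝟎 → ∃[ y ] (y ≢ L₂.𝟎 × L₂.combination y R ≡ x))
                    × (∀ i → lookup R i ≢ L₂.𝟎 × Q (lookup R i) ≡ false)
                    × (∀ i j → i ≢ j → lookup R i ≢ lookup R j)

private
  HasEllipticType : (Vec Bool 4 → Bool) → Set
  HasEllipticType Q = (∃[ u ] (u ≢ L₂.𝟎 × Q u ≡ false))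
    × (∀ u v → u ≢ L₂.𝟎 → Q u ≡ false → v ≢ L₂.𝟎 → Q v ≡ false → u ≢ v → Q (u L₂.⊕ v) ≢ false)
    × (∀ u → Q u ≡ false → (∀ v → Q (u L₂.⊕ v) xor Q u xor Q v ≡ false) → u ≡ L₂.𝟎)

  hasEllipticType? : ∀ Q → Dec (HasEllipticType Q)
  hasEllipticType? Q = (search-Bits λ u → ¬? (u ≟ᵇ L₂.𝟎) ×-dec (Q u Bool.≟ false))
    ×-dec (all? search-Bits λ u → all? search-Bits λ v → ¬? (u ≟ᵇ L₂.𝟎) →-dec (Q u Bool.≟ false) →-dec
      ¬? (v ≟ᵇ L₂.𝟎) →-dec (Q v Bool.≟ false) →-dec ¬? (u ≟ᵇ v) →-dec ¬? (Q (u L₂.⊕ v) Bool.≟ false))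
    ×-dec (all? search-Bits λ u → (Q u Bool.≟ false) →-dec
      (all? search-Bits λ v → Q (u L₂.⊕ v) xor Q u xor Q v Bool.≟ false) →-dec (u ≟ᵇ L₂.𝟎))

  isEllipticBasis? : ∀ Q R → Dec (IsEllipticBasis Q R)
  isEllipticBasis? Q R =
          (all? search-Bits λ y → Q (L₂.combination y R) Bool.≟ Q₀ y)
    ×-dec (all? search-Bits λ y → ¬? (y ≟ᵇ L₂.𝟎) →-dec ¬? (L₂.combination y R ≟ᵇ L₂.𝟎))
    ×-dec (all? search-Bits λ x → ¬? (x ≟ᵇ L₂.𝟎) →-dec
      search-Bits λ y → ¬? (y ≟ᵇ L₂.𝟎) ×-dec (L₂.combination y R ≟ᵇ x))
    ×-dec (all? search-Fin λ i → ¬? (lookup R i ≟ᵇ L₂.𝟎) ×-dec (Q (lookup R i) Bool.≟ false))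
    ×-dec (all? search-Fin λ i → all? search-Fin λ j → ¬? (i Fin.≟ j) →-dec ¬? (lookup R i ≟ᵇ lookup R j))

  -- Any four of the five singular points of an elliptic form will do.
  singularVectors : (Vec Bool 4 → Bool) → Vec (Vec Bool 4) 4
  singularVectors Q = firstFour (List.filter (λ x → Q x Bool.≟ false) quadrangleBits)
    where
    firstFour : List (Vec Bool 4) → Vec (Vec Bool 4) 4
    firstFour (a ∷ b ∷ c ∷ d ∷ _) = a ∷ b ∷ c ∷ d ∷ []
    firstFour _                   = replicate 4 L₂.𝟎

  singularVectors-basis : ∀ κ → HasEllipticType (quadraticForm κ) →
    IsEllipticBasis (quadraticForm κ) (singularVectors (quadraticForm κ))
  singularVectors-basis = decide (all? search-Bits λ κ →
    hasEllipticType? (quadraticForm κ) →-dec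
    isEllipticBasis? (quadraticForm κ) (singularVectors (quadraticForm κ)))

two-independent : ∀ (x y : Vec Bool 4) → x ≢ L₂.𝟎 → y ≢ L₂.𝟎 → x ≢ y → L₂.LinearlyIndependent (x ∷ y ∷ [])
two-independent = decide (all? search-Bits λ x → all? search-Bits λ y →
  ¬? (x ≟ᵇ L₂.𝟎) →-dec ¬? (y ≟ᵇ L₂.𝟎) →-dec ¬? (x ≟ᵇ y) →-dec all? search-Bits λ c →
  (L₂.combination c (x ∷ y ∷ []) ≟ᵇ L₂.𝟎) →-dec (c ≟ᵇ L₂.𝟎))

private
  combinations-of-two : ∀ (x y : Vec Bool 4) c →
    L₂.combination c (x ∷ y ∷ []) ≡ L₂.𝟎 ⊎ L₂.combination c (x ∷ y ∷ []) ≡ x ⊎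
    L₂.combination c (x ∷ y ∷ []) ≡ y ⊎ L₂.combination c (x ∷ y ∷ []) ≡ x L₂.⊕ y
  combinations-of-two = decide (all? search-Bits λ x → all? search-Bits λ y → all? search-Bits λ c →
    let z = L₂.combination c (x ∷ y ∷ []) in
    (z ≟ᵇ L₂.𝟎) ⊎-dec (z ≟ᵇ x) ⊎-dec (z ≟ᵇ y) ⊎-dec (z ≟ᵇ (x L₂.⊕ y)))

private
  ellipticBasis′ : ∀ {Q} κ → (∀ x → Q x ≡ quadraticForm κ x) → L₂.IsElliptic Q → ∃ (IsEllipticBasis Q)
  ellipticBasis′ {Q} κ Q≗ elliptic = R , transport R-basis
    where
    open L₂.IsElliptic elliptic using (quadratic; nonSingular; singularPoint; noSingularLines)
    singular : ∀ u v c → Q u ≡ false → Q v ≡ false → Q (u L₂.⊕ v) ≡ false →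
      Q (L₂.combination c (u ∷ v ∷ [])) ≡ false
    singular u v c Qu Qv Quv = cases (combinations-of-two u v c)
      where
      cases : _ ⊎ _ ⊎ _ ⊎ _ → Q (L₂.combination c (u ∷ v ∷ [])) ≡ false
      cases (inj₁ eq)               = trans (cong Q eq) (L₂.IsQuadratic.homogeneous quadratic false L₂.𝟎)
      cases (inj₂ (inj₁ eq))        = trans (cong Q eq) Qu
      cases (inj₂ (inj₂ (inj₁ eq))) = trans (cong Q eq) Qv
      cases (inj₂ (inj₂ (inj₂ eq))) = trans (cong Q eq) Quv
    hasEllipticType : HasEllipticType (quadraticForm κ)
    hasEllipticType =
        map₂ (λ {u} → map₂ (trans (sym (Q≗ u)))) singularPoint
      , (λ u v u≢𝟎 Qu v≢𝟎 Qv u≢v Quv → noSingularLines u v (two-independent u v u≢𝟎 v≢𝟎 u≢v) λ c →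
          singular u v c (trans (Q≗ u) Qu) (trans (Q≗ v) Qv) (trans (Q≗ (u L₂.⊕ v)) Quv))
      , (λ u Qu radical → nonSingular u (trans (Q≗ u) Qu) λ v →
          trans (cong₂ _xor_ (cong₂ _xor_ (Q≗ (u L₂.⊕ v)) (Q≗ u)) (Q≗ v))
            (trans (Bool.xor-assoc (quadraticForm κ (u L₂.⊕ v)) (quadraticForm κ u) (quadraticForm κ v))
              (radical v)))
    transport : ∀ {R} → IsEllipticBasis (quadraticForm κ) R → IsEllipticBasis Q R
    transport {R} (QR , R≢𝟎 , spans , singular-R , distinct) =
        (λ y → trans (Q≗ (L₂.combination y R)) (QR y)) , R≢𝟎 , spans
      , (λ i → map₂ (trans (Q≗ (lookup R i))) (singular-R i)) , distinct
    R : Vec (Vec Bool 4) 4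
    R = singularVectors (quadraticForm κ)
    R-basis : IsEllipticBasis (quadraticForm κ) R
    R-basis = singularVectors-basis κ hasEllipticType

opaque
  ellipticBasis : ∀ {Q} → L₂.IsElliptic Q → ∃ (IsEllipticBasis Q)
  ellipticBasis {Q} elliptic =
    ellipticBasis′ {Q} (coefficients quadratic) (quadraticForm-complete quadratic) elliptic
    where open L₂.IsElliptic elliptic using (quadratic)

opaque
  subsetOf : ∀ {n} {P : Fin n → Set} → Decidable P → Subset n
  subsetOf P? = tabulate (does ∘ P?)

  ∈-subsetOf : ∀ {n} {P : Fin n → Set} (P? : Decidable P) p → p ∈ₛ subsetOf P? ⇔ P p
  ∈-subsetOf P? p = mk⇔
    (λ p∈ → does⇒ (P? p) (trans (sym (lookup∘tabulate (does ∘ P?) p)) ([]=⇒lookup p∈)))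
    (λ Pp → lookup⇒[]= p _ (trans (lookup∘tabulate (does ∘ P?) p) (dec-true (P? p) Pp)))

represents? : ∀ v p → Dec (v represents p)
represents? v p = map′ (∼⇒represents {v} {p}) (represents⇒∼ {v} {p}) (v ∼? p)

gram≡Γ : ∀ {n} (h : L₄.Form n) v → (∀ i j → h (lookup v i) (lookup v j) ≡ lookup (lookup Γ i) j) → gram h v ≡ Γ
gram≡Γ h (a ∷ b ∷ c ∷ d ∷ []) entry =
  cong₂ _∷_ (row 0F) (cong₂ _∷_ (row 1F) (cong₂ _∷_ (row 2F) (cong (_∷ []) (row 3F))))
  where
  row : ∀ i → map (h (lookup (a ∷ b ∷ c ∷ d ∷ []) i)) (a ∷ b ∷ c ∷ d ∷ []) ≡ lookup Γ i
  row i = trans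
    (cong₂ _∷_ (entry i 0F) (cong₂ _∷_ (entry i 1F) (cong₂ _∷_ (entry i 2F) (cong (_∷ []) (entry i 3F)))))
    (tabulate∘lookup (lookup Γ i))

module BaerProperties (B : BaerSubgeometry) where

  open BaerSubgeometry B

  embed-injective : ∀ {x y p} → embed x ∼ p → embed y ∼ p → x ≡ y
  embed-injective {x} {y} x∼p y∼p = case ∼-scalar x∼p y∼p of λ
    { (c , c≢O , eq) → binary x y c c≢O (u⊕v≡𝟎⇒u≡v _ _ (independent _ (begin
        combination (map ι x ⊕ c · map ι y) basis
          ≡⟨ combination-⊕ basis (map ι x) (c · map ι y) ⟩
        embed x ⊕ combination (c · map ι y) basis
          ≡⟨ cong (embed x ⊕_) (combination-· basis c (map ι y)) ⟩
        embed x ⊕ c · embed y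
          ≡⟨ cong (_⊕ c · embed y) eq ⟩
        c · embed y ⊕ c · embed y
          ≡⟨ ⊕-self _ ⟩
        𝟎 ∎))) }
    where
    open ≡-Reasoning
    binary : ∀ (x y : Vec Bool 4) c → c ≢ O → map ι x ≡ c · map ι y → x ≡ y
    binary = decide (all? search-Bits λ x → all? search-Bits λ y → all? search-𝔽₄ λ c →
      ¬? (c ≟₄ O) →-dec (map ι x ≟ᵥ c · map ι y) →-dec (x ≟ᵇ y))

  embed≢𝟎 : ∀ x → x ≢ L₂.𝟎 → embed x ≢ 𝟎
  embed≢𝟎 x x≢𝟎 eq = x≢𝟎 (map-ι-injective x L₂.𝟎 (trans (independent (map ι x) eq) (sym (map-ι-𝟎 4))))

  lineThrough : ∀ x y → L₂.LinearlyIndependent (x ∷ y ∷ []) → Line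
  lineThrough x y x,y-independent = record
    { x = x ; y = y ; line-independent = x,y-independent
    ; line-points = subsetOf onLine? ; line-spec = ∈-subsetOf onLine? }
    where
    onLine? : ∀ p → Dec (∃[ z ] (z ≢ L₂.𝟎 × (∃[ c ] z ≡ L₂.combination c (x ∷ y ∷ [])) × embed z represents p))
    onLine? p = search-Bits λ z → ¬? (z ≟ᵇ L₂.𝟎) ×-dec
      (search-Bits λ c → z ≟ᵇ L₂.combination c (x ∷ y ∷ [])) ×-dec represents? (embed z) p

  Locus-bitLocus : ∀ {P S L} R → Locus P S →
    (∀ {x} → x ≢ L₂.𝟎 → P x → ∃[ y ] (y ∈ₗ L × L₂.combination y R ≡ x)) →
    (∀ {y} → y ∈ₗ L → L₂.combination y R ≢ L₂.𝟎 × P (L₂.combination y R)) →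
    S ≡ bitLocus (map embed R) L
  Locus-bitLocus {P} {S} {L} R spec into out = ⊆-antisym
    (λ {p} p∈ → case to (spec p) p∈ of λ
      { (x , x≢𝟎 , Px , x∼p) → case into x≢𝟎 Px of λ
      { (y , y∈ , refl) → from (∈-bitLocus (map embed R) L p)
          (y , y∈ , subst (_∼ p) (sym (embedBits-combination basis y R)) (represents⇒∼ {embed x} {p} x∼p)) } })
    (λ {p} p∈ → case to (∈-bitLocus (map embed R) L p) p∈ of λ
      { (y , y∈ , y∼p) → from (spec p) (L₂.combination y R , proj₁ (out y∈) , proj₂ (out y∈)
          , ∼⇒represents {embed (L₂.combination y R)} {p} (subst (_∼ p) (embedBits-combination basis y R) y∼p)) })

module OvoidFrame {h : L₄.Form 4} (unitary : IsUnitary h) (W : SymplecticSubquadrangle h)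
                  {S : PointSet} (isOvoid : IsEllipticOvoidOf W S) where

  open SymplecticSubquadrangle W
  open BaerProperties baer
  open IsEllipticOvoidOf isOvoid
  open IsUnitary unitary
  open L₂.IsSymplectic symplectic using (alternating) renaming (bilinear to f-bilinear)
  open L₄.IsSymplectic symplectic~ using () renaming (bilinear to f~-bilinear; alternating to f~-alternating)
  private
    module f  = L₂.IsSesquilinear f-bilinear
    module f~ = L₄.IsSesquilinear f~-bilinear
    module h  = L₄.IsSesquilinear sesquilinear
  open ≡-Reasoning

  private
    Q : Vec Bool 4 → Bool
    Q = proj₁ quadric

    basis-Q : ∃ (IsEllipticBasis Q)
    basis-Q = ellipticBasis (proj₁ (proj₂ quadric))

    R : Vec (Vec Bool 4) 4
    R = proj₁ basis-Q

    QR : ∀ y → Q (L₂.combination y R) ≡ Q₀ y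
    QR = proj₁ (proj₂ basis-Q)

    R≢𝟎 : ∀ y → y ≢ L₂.𝟎 → L₂.combination y R ≢ L₂.𝟎
    R≢𝟎 = proj₁ (proj₂ (proj₂ basis-Q))

    R-spans : ∀ x → x ≢ L₂.𝟎 → ∃[ y ] (y ≢ L₂.𝟎 × L₂.combination y R ≡ x)
    R-spans = proj₁ (proj₂ (proj₂ (proj₂ basis-Q)))

    R-singular : ∀ i → lookup R i ≢ L₂.𝟎 × Q (lookup R i) ≡ false
    R-singular = proj₁ (proj₂ (proj₂ (proj₂ (proj₂ basis-Q))))

    R-distinct : ∀ i j → i ≢ j → lookup R i ≢ lookup R j
    R-distinct = proj₂ (proj₂ (proj₂ (proj₂ (proj₂ basis-Q))))

  v : Vec (L₄.Vector 4) 4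
  v = map embed R

  private
    into-ovoidBits : ∀ {x} → x ≢ L₂.𝟎 → Q x ≡ false → ∃[ y ] (y ∈ₗ ovoidBits × L₂.combination y R ≡ x)
    into-ovoidBits {x} x≢𝟎 Qx =
      map₂ (λ {y} (y≢𝟎 , eq) → ∈-ovoidBits y y≢𝟎 (trans (sym (QR y)) (trans (cong Q eq) Qx)) , eq) (R-spans x x≢𝟎)

    out-ovoidBits : ∀ {y} → y ∈ₗ ovoidBits → L₂.combination y R ≢ L₂.𝟎 × Q (L₂.combination y R) ≡ false
    out-ovoidBits {y} y∈ = R≢𝟎 y (proj₁ (∈-ovoidBits⁻ y y∈)) , trans (QR y) (proj₂ (∈-ovoidBits⁻ y y∈))

    S-locus : Locus (λ x → Q x ≡ false) S
    S-locus = proj₂ (proj₂ quadric)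

    points-locus : Locus (λ _ → ⊤) points
    points-locus p = mk⇔
      (λ p∈ → map₂ (map₂ (tt ,_)) (to (points-spec p) p∈))
      (λ ∃x → from (points-spec p) (map₂ (map₂ proj₂) ∃x))

  S≡ovoid : S ≡ ovoid v
  S≡ovoid = Locus-bitLocus {P = λ x → Q x ≡ false} {S = S} {L = ovoidBits} R S-locus into-ovoidBits out-ovoidBits

  points≡quadrangle : points ≡ quadrangle v
  points≡quadrangle = Locus-bitLocus {P = λ _ → ⊤} {S = points} {L = quadrangleBits} R points-locus
    (λ {x} x≢𝟎 _ → map₂ (λ {y} → map₁ (∈-quadrangleBits y)) (R-spans x x≢𝟎))
    (λ {y} y∈ → R≢𝟎 y (∈-quadrangleBits⁻ y y∈) , tt)

  -- A line on two points of the ovoid is not a tangent.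
  singular-nonorthogonal : ∀ x y → x ≢ L₂.𝟎 → y ≢ L₂.𝟎 → x ≢ y → Q x ≡ false → Q y ≡ false → form x y ≡ true
  singular-nonorthogonal x y x≢𝟎 y≢𝟎 x≢y Qx Qy = Bool.¬-not λ fxy → x≢y (case
    pointOf (embed x) (embed≢𝟎 x x≢𝟎) ,′ pointOf (embed y) (embed≢𝟎 y y≢𝟎) of λ
    { ((p , x∼p) , (q , y∼q)) → embed-injective {x} {y} {p} x∼p (subst (embed y ∼_) (sym
      (∣S∣≡1⇒unique (from (tangents-generators ℓ) (isotropic fxy))
        (x∈p∩q⁺ (from (Line.line-spec ℓ p) (x , x≢𝟎 , (true ∷ false ∷ [] , x-at) , ∼⇒represents {embed x} {p} x∼p)
               , from (proj₂ (proj₂ quadric) p) (x , x≢𝟎 , Qx , ∼⇒represents {embed x} {p} x∼p)))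
        (x∈p∩q⁺ (from (Line.line-spec ℓ q) (y , y≢𝟎 , (false ∷ true ∷ [] , y-at) , ∼⇒represents {embed y} {q} y∼q)
               , from (proj₂ (proj₂ quadric) q) (y , y≢𝟎 , Qy , ∼⇒represents {embed y} {q} y∼q))))) y∼q) })
    where
    ℓ : Line
    ℓ = lineThrough x y (two-independent x y x≢𝟎 y≢𝟎 x≢y)
    open Line ℓ using (at)
    x-at : x ≡ at (true ∷ false ∷ [])
    x-at = lemma x y
      where
      lemma : ∀ (x y : Vec Bool 4) → x ≡ L₂.combination (true ∷ false ∷ []) (x ∷ y ∷ [])
      lemma = decide (all? search-Bits λ x → all? search-Bits λ y →
        x ≟ᵇ L₂.combination (true ∷ false ∷ []) (x ∷ y ∷ []))
    y-at : y ≡ at (false ∷ true ∷ [])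
    y-at = lemma x y
      where
      lemma : ∀ (x y : Vec Bool 4) → y ≡ L₂.combination (false ∷ true ∷ []) (x ∷ y ∷ [])
      lemma = decide (all? search-Bits λ x → all? search-Bits λ y →
        y ≟ᵇ L₂.combination (false ∷ true ∷ []) (x ∷ y ∷ []))
    isotropic : form x y ≡ false → TotallyIsotropic form ℓ
    isotropic fxy (a ∷ b ∷ []) (c ∷ d ∷ []) = begin
      form (at (a ∷ b ∷ [])) (at (c ∷ d ∷ []))
        ≡⟨ cong₂ form (at-sum a b) (at-sum c d) ⟩
      form (a L₂.· x L₂.⊕ b L₂.· y) (c L₂.· x L₂.⊕ d L₂.· y)
        ≡⟨ f.additiveˡ _ _ _ ⟩
      form (a L₂.· x) (c L₂.· x L₂.⊕ d L₂.· y) xor form (b L₂.· y) (c L₂.· x L₂.⊕ d L₂.· y)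
        ≡⟨ cong₂ _xor_ (f.additiveʳ _ _ _) (f.additiveʳ _ _ _) ⟩
      (form (a L₂.· x) (c L₂.· x) xor form (a L₂.· x) (d L₂.· y)) xor
      (form (b L₂.· y) (c L₂.· x) xor form (b L₂.· y) (d L₂.· y))
        ≡⟨ cong₂ _xor_ (cong₂ _xor_ (vanish a c (alternating x)) (vanish a d fxy))
                       (cong₂ _xor_ (vanish b c fyx) (vanish b d (alternating y))) ⟩
      false ∎
      where
      at-sum : ∀ a b → at (a ∷ b ∷ []) ≡ a L₂.· x L₂.⊕ b L₂.· y
      at-sum a b = cong (a L₂.· x L₂.⊕_) (zipWith-identityʳ Bool.xor-identityʳ (b L₂.· y))
      vanish : ∀ {u w} a c → form u w ≡ false → form (a L₂.· u) (c L₂.· w) ≡ false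
      vanish {u} {w} a c fuw = begin
        form (a L₂.· u) (c L₂.· w)  ≡⟨ f.homogeneousˡ a u _ ⟩
        a ∧ form u (c L₂.· w)       ≡⟨ cong (a ∧_) (f.homogeneousʳ c u w) ⟩
        a ∧ c ∧ form u w            ≡⟨ cong (λ t → a ∧ c ∧ t) fuw ⟩
        a ∧ c ∧ false               ≡⟨ cong (a ∧_) (Bool.∧-zeroʳ c) ⟩
        a ∧ false                   ≡⟨ Bool.∧-zeroʳ a ⟩
        false                       ∎
      fyx : form y x ≡ false
      fyx = begin
        form y x                    ≡⟨ Bool.xor-identityʳ _ ⟨
        form y x xor false          ≡⟨ cong (form y x xor_) (alternating y) ⟨
        form y x xor form y y       ≡⟨ f.additiveʳ y x y ⟨
        form y (x L₂.⊕ y)           ≡⟨ cong (_xor form y (x L₂.⊕ y)) fxx+y ⟨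
        form x (x L₂.⊕ y) xor form y (x L₂.⊕ y)  ≡⟨ f.additiveˡ x y _ ⟨
        form (x L₂.⊕ y) (x L₂.⊕ y)  ≡⟨ alternating (x L₂.⊕ y) ⟩
        false                       ∎
        where
        fxx+y : form x (x L₂.⊕ y) ≡ false
        fxx+y = trans (f.additiveʳ x x y) (cong₂ _xor_ (alternating x) fxy)

  -- As σ fixes the points p of the subgeometry, p lies in (p^⊥̃)^⊥, that
  -- is, p^⊥̃ ⊆ p^⊥.
  perp-agrees : ∀ x → x ≢ L₂.𝟎 → ∀ w → form~ (embed x) w ≡ O → h w (embed x) ≡ O
  perp-agrees x x≢𝟎 w f~xw = case pointOf u (embed≢𝟎 x x≢𝟎) of λ
    { (p , u∼p) → case w ≟ᵥ 𝟎 of λ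
    { (yes refl) → Sesquilinear.𝟎ˡ sesquilinear u
    ; (no w≢𝟎) → case pointOf w w≢𝟎 of λ
    { (q , w∼q) → case ∼-scalar (coords-∼ p) u∼p ,′ ∼-scalar (coords-∼ q) w∼q ,′
                       ∼-scalar u∼p (coords-∼ p) ,′ ∼-scalar w∼q (coords-∼ q) of λ
    { ((a , _ , p≡au) , (b , _ , q≡bw) , (c , _ , u≡cp) , (d , _ , w≡dq)) → begin
      h w u                                          ≡⟨ cong₂ h w≡dq u≡cp ⟩
      h (d · coords q) (c · coords p)                ≡⟨ h.homogeneousˡ d _ _ ⟩
      d *₄ h (coords q) (c · coords p)               ≡⟨ cong (d *₄_) (h.homogeneousʳ c _ _) ⟩
      d *₄ (frobenius c *₄ h (coords q) (coords p))  ≡⟨ cong (λ t → d *₄ (frobenius c *₄ t)) (proj₂ (perp∘perp~ p)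
        (to (σ-fixes p) (from (points-spec p) (x , x≢𝟎 , ∼⇒represents {u} {p} u∼p))) q λ q′ p≡q′ →
          subst (λ r → form~ (coords r) (coords q) ≡ O) p≡q′ (begin
            form~ (coords p) (coords q)   ≡⟨ cong₂ form~ p≡au q≡bw ⟩
            form~ (a · u) (b · w)         ≡⟨ f~.homogeneousˡ a u _ ⟩
            a *₄ form~ u (b · w)          ≡⟨ cong (a *₄_) (f~.homogeneousʳ b u w) ⟩
            a *₄ (b *₄ form~ u w)         ≡⟨ cong (λ t → a *₄ (b *₄ t)) f~xw ⟩
            a *₄ (b *₄ O)                 ≡⟨ cong (a *₄_) (*-zeroʳ b) ⟩
            a *₄ O                        ≡⟨ *-zeroʳ a ⟩
            O                             ∎)) ⟩
      d *₄ (frobenius c *₄ O)                        ≡⟨ cong (d *₄_) (*-zeroʳ (frobenius c)) ⟩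
      d *₄ O                                         ≡⟨ *-zeroʳ d ⟩
      O                                              ∎ } } } }
    where u = embed x

  -- By perp-agrees, applied to the sum of two other members of the frame,
  -- h vᵢ vⱼ (i ≠ j) does not depend on i.  Going round a triangle i, j, k
  -- then shows that it is fixed by frobenius, hence 1.
  frame : IsFrame h v
  frame = gram≡Γ h v λ i j → trans (cong₂ h (lookup-map i embed R) (lookup-map j embed R)) (entry i j)
    where
    G : Fin 4 → Fin 4 → 𝔽₄
    G i j = h (embed (lookup R i)) (embed (lookup R j))
    third : ∀ (i j : Fin 4) → i ≢ j → ∃[ k ] (k ≢ i × k ≢ j)
    third = decide (all? search-Fin λ i → all? search-Fin λ j → ¬? (i Fin.≟ j) →-dec
      search-Fin λ k → ¬? (k Fin.≟ i) ×-dec ¬? (k Fin.≟ j))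
    form~-R : ∀ i j → i ≢ j → form~ (embed (lookup R i)) (embed (lookup R j)) ≡ I
    form~-R i j i≢j = trans (extends (lookup R i) (lookup R j)) (cong ι
      (singular-nonorthogonal _ _ (proj₁ (R-singular i)) (proj₁ (R-singular j)) (R-distinct i j i≢j)
        (proj₂ (R-singular i)) (proj₂ (R-singular j))))
    constant : ∀ i j k → i ≢ j → k ≢ j → G i j ≡ G k j
    constant i j k i≢j k≢j = x+y≡O⇒x≡y _ _ (trans (sym (h.additiveˡ _ _ _))
      (perp-agrees (lookup R j) (proj₁ (R-singular j)) _ (trans (f~.additiveʳ _ _ _)
        (cong₂ _+₄_ (form~-R j i (i≢j ∘ sym)) (form~-R j k (k≢j ∘ sym))))))
    G-diagonal : ∀ i → G i i ≡ O
    G-diagonal i = perp-agrees (lookup R i) (proj₁ (R-singular i)) _ (f~-alternating _)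
    G≢O : ∀ i j → i ≢ j → G i j ≢ O
    G≢O i j i≢j Gij = embed≢𝟎 (lookup R j) (proj₁ (R-singular j)) (nonDegenerate u λ w →
      trans (hermitian w u) (cong frobenius (hwu w)))
      where
      u e : L₄.Vector 4
      u = embed (lookup R j)
      e = embed (lookup R i)
      hwu : ∀ w → h w u ≡ O
      hwu w = begin
        h w u                            ≡⟨ +-identityʳ _ ⟨
        h w u +₄ O                       ≡⟨ cong (h w u +₄_) (*-zeroʳ c) ⟨
        h w u +₄ c *₄ O                  ≡⟨ cong (λ t → h w u +₄ c *₄ t) Gij ⟨
        h w u +₄ c *₄ h e u              ≡⟨ cong (h w u +₄_) (h.homogeneousˡ c e u) ⟨
        h w u +₄ h (c · e) u             ≡⟨ h.additiveˡ w (c · e) u ⟨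
        h (w ⊕ c · e) u                  ≡⟨ perp-agrees (lookup R j) (proj₁ (R-singular j)) (w ⊕ c · e) (begin
          form~ u (w ⊕ c · e)            ≡⟨ f~.additiveʳ u w (c · e) ⟩
          c +₄ form~ u (c · e)           ≡⟨ cong (c +₄_) (f~.homogeneousʳ c u e) ⟩
          c +₄ c *₄ form~ u e            ≡⟨ cong (λ t → c +₄ c *₄ t) (form~-R j i (i≢j ∘ sym)) ⟩
          c +₄ c *₄ I                    ≡⟨ cong (c +₄_) (*-comm c I) ⟩
          c +₄ c                         ≡⟨ x+x≡O c ⟩
          O                              ∎) ⟩
        O                                ∎
        where
        c : 𝔽₄
        c = form~ u w
    G-off : ∀ i j → i ≢ j → G i j ≡ I
    G-off i j i≢j = case third i j i≢j of λ
      { (k , k≢i , k≢j) → fixed (G i j) (G≢O i j i≢j) (begin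
        G i j              ≡⟨ constant i j k i≢j k≢j ⟩
        G k j              ≡⟨ hermitian _ _ ⟩
        frobenius (G j k)  ≡⟨ cong frobenius (constant j k i (k≢j ∘ sym) (k≢i ∘ sym)) ⟩
        frobenius (G i k)  ≡⟨ hermitian _ _ ⟨
        G k i              ≡⟨ constant k i j k≢i (i≢j ∘ sym) ⟩
        G j i              ≡⟨ hermitian _ _ ⟩
        frobenius (G i j)  ∎) }
      where
      fixed : ∀ x → x ≢ O → x ≡ frobenius x → x ≡ I
      fixed = decide (all? search-𝔽₄ λ x → ¬? (x ≟₄ O) →-dec (x ≟₄ frobenius x) →-dec (x ≟₄ I))
    Γ-diagonal : ∀ i → lookup (lookup Γ i) i ≡ O
    Γ-diagonal = decide (all? search-Fin λ i → lookup (lookup Γ i) i ≟₄ O)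
    Γ-off : ∀ i j → i ≢ j → lookup (lookup Γ i) j ≡ I
    Γ-off = decide (all? search-Fin λ i → all? search-Fin λ j → ¬? (i Fin.≟ j) →-dec (lookup (lookup Γ i) j ≟₄ I))
    entry : ∀ i j → G i j ≡ lookup (lookup Γ i) j
    entry i j = case i Fin.≟ j of λ
      { (yes refl) → trans (G-diagonal i) (sym (Γ-diagonal i))
      ; (no i≢j)   → trans (G-off i j i≢j) (sym (Γ-off i j i≢j)) }

-- The elliptic quadric Q₀

f₀ : L₂.Form 4
f₀ = L₂.polarForm Q₀

f₀-bilinear : L₂.IsBilinear f₀
f₀-bilinear = record
  { additiveˡ    = decide (all? search-Bits λ u → all? search-Bits λ v → all? search-Bits λ w →
      f₀ (u L₂.⊕ v) w Bool.≟ (f₀ u w xor f₀ v w))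
  ; additiveʳ    = decide (all? search-Bits λ u → all? search-Bits λ v → all? search-Bits λ w →
      f₀ u (v L₂.⊕ w) Bool.≟ (f₀ u v xor f₀ u w))
  ; homogeneousˡ = decide (all? search-Bool λ c → all? search-Bits λ u → all? search-Bits λ v →
      f₀ (c L₂.· u) v Bool.≟ (c ∧ f₀ u v))
  ; homogeneousʳ = decide (all? search-Bool λ c → all? search-Bits λ u → all? search-Bits λ v →
      f₀ u (c L₂.· v) Bool.≟ (c ∧ f₀ u v))
  }

f₀-symplectic : L₂.IsSymplectic f₀
f₀-symplectic = record
  { bilinear      = f₀-bilinear
  ; alternating   = decide (all? search-Bits λ u → f₀ u u Bool.≟ false)
  ; nonDegenerate = decide (all? search-Bits λ u → (all? search-Bits λ v → f₀ u v Bool.≟ false) →-dec (u ≟ᵇ L₂.𝟎))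
  }

Q₀-elliptic : L₂.IsElliptic Q₀
Q₀-elliptic = record
  { quadratic = record
    { homogeneous = decide (all? search-Bool λ c → all? search-Bits λ v → Q₀ (c L₂.· v) Bool.≟ ((c ∧ c) ∧ Q₀ v))
    ; bilinear    = f₀-bilinear }
  ; nonSingular = decide (all? search-Bits λ u → (Q₀ u Bool.≟ false) →-dec
      (all? search-Bits λ v → f₀ u v Bool.≟ false) →-dec (u ≟ᵇ L₂.𝟎))
  ; singularPoint = true ∷ false ∷ false ∷ false ∷ [] , (λ ()) , refl
  ; noSingularLines = λ u v independent singular → case dependent u v singular of λ
      { (c , c≢𝟎 , eq) → c≢𝟎 (independent c eq) }
  }
  where
  dependent : ∀ (u v : Vec Bool 4) → (∀ c → Q₀ (L₂.combination c (u ∷ v ∷ [])) ≡ false) →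
    ∃[ c ] (c ≢ L₂.𝟎 × L₂.combination c (u ∷ v ∷ []) ≡ L₂.𝟎)
  dependent = decide (all? search-Bits λ u → all? search-Bits λ v →
    (all? search-Bits λ c → Q₀ (L₂.combination c (u ∷ v ∷ [])) Bool.≟ false) →-dec
    search-Bits λ c → ¬? (c ≟ᵇ L₂.𝟎) ×-dec (L₂.combination c (u ∷ v ∷ []) ≟ᵇ L₂.𝟎))

SingularOn : (x y z : Vec Bool 4) → Set
SingularOn x y z = z ≢ L₂.𝟎 × (∃[ c ] z ≡ L₂.combination c (x ∷ y ∷ [])) × Q₀ z ≡ false

singularOn? : ∀ x y z → Dec (SingularOn x y z)
singularOn? x y z = ¬? (z ≟ᵇ L₂.𝟎) ×-dec (search-Bits λ c → z ≟ᵇ L₂.combination c (x ∷ y ∷ []))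
              ×-dec (Q₀ z Bool.≟ false)

Isotropic : (x y : Vec Bool 4) → Set
Isotropic x y = ∀ c d → f₀ (L₂.combination c (x ∷ y ∷ [])) (L₂.combination d (x ∷ y ∷ [])) ≡ false

isotropic? : ∀ x y → Dec (Isotropic x y)
isotropic? x y = all? search-Bits λ c → all? search-Bits λ d →
  f₀ (L₂.combination c (x ∷ y ∷ [])) (L₂.combination d (x ∷ y ∷ [])) Bool.≟ false

isotropic⇒tangent : ∀ x y → Isotropic x y →
  (∃[ z ] (SingularOn x y z × (∀ z′ → SingularOn x y z′ → z′ ≡ z)))
  ⊎ (∃[ c ] (c ≢ L₂.𝟎 × L₂.combination c (x ∷ y ∷ []) ≡ L₂.𝟎))
isotropic⇒tangent = decide (all? search-Bits λ x → all? search-Bits λ y → isotropic? x y →-dec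
  ((search-Bits λ z → singularOn? x y z ×-dec (all? search-Bits λ z′ → singularOn? x y z′ →-dec (z′ ≟ᵇ z)))
   ⊎-dec (search-Bits λ c → ¬? (c ≟ᵇ L₂.𝟎) ×-dec (L₂.combination c (x ∷ y ∷ []) ≟ᵇ L₂.𝟎))))

nonisotropic⇒nontangent : ∀ x y → ¬ Isotropic x y →
  (∀ z → ¬ SingularOn x y z) ⊎ (∃[ z ] ∃[ z′ ] (SingularOn x y z × SingularOn x y z′ × z ≢ z′))
nonisotropic⇒nontangent = decide (all? search-Bits λ x → all? search-Bits λ y → ¬? (isotropic? x y) →-dec
  ((all? search-Bits λ z → ¬? (singularOn? x y z))
   ⊎-dec (search-Bits λ z → search-Bits λ z′ → singularOn? x y z ×-dec singularOn? x y z′ ×-dec ¬? (z ≟ᵇ z′))))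

frobenius-automorphism : IsRingIsomorphism GF4 GF4 frobenius
frobenius-automorphism = record
  { isRingMonomorphism = record
    { isRingHomomorphism = record
      { isSemiringHomomorphism = record
        { isNearSemiringHomomorphism = record
          { +-isMonoidHomomorphism = record
            { isMagmaHomomorphism = record
              { isRelHomomorphism = record { cong = cong frobenius }
              ; homo = frobenius-+ }
            ; ε-homo = refl }
          ; *-homo = frobenius-* }
        ; 1#-homo = refl }
      ; -‿homo = λ _ → refl }
    ; injective = λ {x} {y} eq →
        trans (sym (frobenius-involutive x)) (trans (cong frobenius eq) (frobenius-involutive y)) }
  ; surjective = λ y → frobenius y , λ { refl → frobenius-involutive y } }

map-frobenius-⊕ : ∀ {n} → IsAdditive (map {n = n} frobenius)
map-frobenius-⊕ []      []      = refl
map-frobenius-⊕ (a ∷ u) (b ∷ v) = cong₂ _∷_ (frobenius-+ a b) (map-frobenius-⊕ u v)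

map-frobenius-· : ∀ {n} c (u : L₄.Vector n) → map frobenius (c · u) ≡ frobenius c · map frobenius u
map-frobenius-· c []      = refl
map-frobenius-· c (a ∷ u) = cong₂ _∷_ (frobenius-* c a) (map-frobenius-· c u)

map-frobenius-involutive : ∀ {n} (u : L₄.Vector n) → map frobenius (map frobenius u) ≡ u
map-frobenius-involutive []      = refl
map-frobenius-involutive (a ∷ u) = cong₂ _∷_ (frobenius-involutive a) (map-frobenius-involutive u)

map-frobenius-ι : ∀ {n} (x : Vec Bool n) → map frobenius (map ι x) ≡ map ι x
map-frobenius-ι []          = refl
map-frobenius-ι (false ∷ x) = cong (O ∷_) (map-frobenius-ι x)
map-frobenius-ι (true  ∷ x) = cong (I ∷_) (map-frobenius-ι x)

dot-frobenius : ∀ {n} (a b : L₄.Vector n) → dot (map frobenius a) (map frobenius b) ≡ frobenius (dot a b)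
dot-frobenius []      []      = refl
dot-frobenius (a ∷ u) (b ∷ v) = begin
  frobenius a *₄ frobenius b +₄ dot (map frobenius u) (map frobenius v)
    ≡⟨ cong₂ _+₄_ (sym (frobenius-* a b)) (dot-frobenius u v) ⟩
  frobenius (a *₄ b) +₄ frobenius (dot u v)
    ≡⟨ frobenius-+ (a *₄ b) (dot u v) ⟨
  frobenius (dot (a ∷ u) (b ∷ v)) ∎
  where open ≡-Reasoning

h₀-frobenius : ∀ a b → h₀ (map frobenius a) (map frobenius b) ≡ frobenius (h₀ a b)
h₀-frobenius a b = begin
  dot (map frobenius a) (map (dot (map frobenius (map frobenius b))) (map (map frobenius) Γ))
    ≡⟨ cong (dot (map frobenius a)) (map-∘ (dot (map frobenius (map frobenius b))) (map frobenius) Γ) ⟨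
  dot (map frobenius a) (map (λ r → dot (map frobenius (map frobenius b)) (map frobenius r)) Γ)
    ≡⟨ cong (dot (map frobenius a)) (map-cong (dot-frobenius (map frobenius b)) Γ) ⟩
  dot (map frobenius a) (map (frobenius ∘ dot (map frobenius b)) Γ)
    ≡⟨ cong (dot (map frobenius a)) (map-∘ frobenius (dot (map frobenius b)) Γ) ⟩
  dot (map frobenius a) (map frobenius (map (dot (map frobenius b)) Γ))
    ≡⟨ dot-frobenius a (map (dot (map frobenius b)) Γ) ⟩
  frobenius (h₀ a b) ∎
  where open ≡-Reasoning

module Perp {h : L₄.Form 4} (unitary : IsUnitary h) where

  open IsUnitary unitary
  open L₄.IsSesquilinear sesquilinear
  open Sesquilinear sesquilinear
  open ≡-Reasoning

  h-swap : ∀ {u v} → h u v ≡ O → h v u ≡ O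
  h-swap {u} {v} eq = trans (hermitian u v) (cong frobenius eq)

  nonDegenerateʳ : ∀ u → (∀ w → h w u ≡ O) → u ≡ 𝟎
  nonDegenerateʳ u zero-on = nonDegenerate u λ w → h-swap {w} {u} (zero-on w)

  double-perp : ∀ u u′ → u ≢ 𝟎 → (∀ w → h w u ≡ O → h w u′ ≡ O) → ∃[ c ] u′ ≡ c · u
  double-perp u u′ u≢𝟎 u⊥⊆u′⊥ =
    case ¬∀⇒∃¬ search-Vector (λ w → h w u ≟₄ O) (u≢𝟎 ∘ nonDegenerateʳ u) of λ
    { (w₀ , hw₀u≢O) → case inverse (h w₀ u) hw₀u≢O of λ
    { (e , _ , e*≡I) →
      let k = e *₄ h w₀ u′ in
      frobenius k , u⊕v≡𝟎⇒u≡v u′ (frobenius k · u) (nonDegenerateʳ _ λ w →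
        let w₁ = w ⊕ (h w u *₄ e) · w₀ in begin
        h w (u′ ⊕ frobenius k · u)
          ≡⟨ additiveʳ w u′ _ ⟩
        h w u′ +₄ h w (frobenius k · u)
          ≡⟨ cong (h w u′ +₄_) (homogeneousʳ (frobenius k) w u) ⟩
        h w u′ +₄ frobenius (frobenius k) *₄ h w u
          ≡⟨ cong (λ t → h w u′ +₄ t *₄ h w u) (frobenius-involutive k) ⟩
        h w u′ +₄ (e *₄ h w₀ u′) *₄ h w u
          ≡⟨ cong (h w u′ +₄_) (rearrange e (h w₀ u′) (h w u)) ⟩
        h w u′ +₄ (h w u *₄ e) *₄ h w₀ u′
          ≡⟨ cong (h w u′ +₄_) (homogeneousˡ (h w u *₄ e) w₀ u′) ⟨
        h w u′ +₄ h ((h w u *₄ e) · w₀) u′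
          ≡⟨ additiveˡ w ((h w u *₄ e) · w₀) u′ ⟨
        h w₁ u′
          ≡⟨ u⊥⊆u′⊥ w₁ (begin
            h w₁ u
              ≡⟨ additiveˡ w ((h w u *₄ e) · w₀) u ⟩
            h w u +₄ h ((h w u *₄ e) · w₀) u
              ≡⟨ cong (h w u +₄_) (homogeneousˡ (h w u *₄ e) w₀ u) ⟩
            h w u +₄ (h w u *₄ e) *₄ h w₀ u
              ≡⟨ cong (h w u +₄_) (*-assoc (h w u) e (h w₀ u)) ⟩
            h w u +₄ h w u *₄ (e *₄ h w₀ u)
              ≡⟨ cong (λ t → h w u +₄ h w u *₄ t) e*≡I ⟩
            h w u +₄ h w u *₄ I
              ≡⟨ cong (h w u +₄_) (*-comm (h w u) I) ⟩
            h w u +₄ h w u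
              ≡⟨ x+x≡O (h w u) ⟩
            O ∎) ⟩
        O ∎) } }
    where
    rearrange : ∀ x y z → (x *₄ y) *₄ z ≡ (z *₄ x) *₄ y
    rearrange = decide (all? search-𝔽₄ λ x → all? search-𝔽₄ λ y → all? search-𝔽₄ λ z →
      (x *₄ y) *₄ z ≟₄ (z *₄ x) *₄ y)

  double-perp-points : ∀ u u′ → u ≢ 𝟎 → (∀ q → h (coords q) u ≡ O → h (coords q) u′ ≡ O) → ∃[ c ] u′ ≡ c · u
  double-perp-points u u′ u≢𝟎 onPoints = double-perp u u′ u≢𝟎 λ w hwu → case w ≟ᵥ 𝟎 of λ
    { (yes w≡𝟎) → trans (cong (λ t → h t u′) w≡𝟎) (𝟎ˡ u′)
    ; (no w≢𝟎) → case pointOf w w≢𝟎 of λ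
    { (q , w∼q) → case ∼-scalar w∼q (coords-∼ q) ,′ ∼-scalar (coords-∼ q) w∼q of λ
    { ((c , _ , w≡cq) , (d , _ , q≡dw)) → begin
      h w u′                  ≡⟨ cong (λ t → h t u′) w≡cq ⟩
      h (c · coords q) u′     ≡⟨ homogeneousˡ c (coords q) u′ ⟩
      c *₄ h (coords q) u′    ≡⟨ cong (c *₄_) (onPoints q (begin
        h (coords q) u          ≡⟨ cong (λ t → h t u) q≡dw ⟩
        h (d · w) u             ≡⟨ homogeneousˡ d w u ⟩
        d *₄ h w u              ≡⟨ cong (d *₄_) hwu ⟩
        d *₄ O                  ≡⟨ *-zeroʳ d ⟩
        O                       ∎)) ⟩
      c *₄ O                  ≡⟨ *-zeroʳ c ⟩
      O                       ∎ } } }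

module FrameQuadrangle {h : L₄.Form 4} (unitary : IsUnitary h)
                       {v : Vec (L₄.Vector 4) 4} (frame : IsFrame h v) where

  open IsUnitary unitary
  open Coordinates unitary frame
  open Perp unitary
  open ≡-Reasoning
  private module h = L₄.IsSesquilinear sesquilinear

  baer : BaerSubgeometry
  baer = record
    { basis = v ; independent = fromCoords≢𝟎 ; points = quadrangle v
    ; points-spec = λ p → mk⇔
        (λ p∈ → map₂ (λ {x} → map₂ (∼⇒represents {embedBits v x} {p})) (to (∈-quadrangle v p) p∈))
        (λ ∃x → from (∈-quadrangle v p) (map₂ (λ {x} → map₂ (represents⇒∼ {embedBits v x} {p})) ∃x)) }

  τ : L₄.Vector 4 → L₄.Vector 4
  τ u = fromCoords (map frobenius (toCoords u))

  τ-⊕ : IsAdditive τ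
  τ-⊕ u w = begin
    fromCoords (map frobenius (toCoords (u ⊕ w)))
      ≡⟨ cong (fromCoords ∘ map frobenius) (toCoords-⊕ u w) ⟩
    fromCoords (map frobenius (toCoords u ⊕ toCoords w))
      ≡⟨ cong fromCoords (map-frobenius-⊕ (toCoords u) (toCoords w)) ⟩
    fromCoords (map frobenius (toCoords u) ⊕ map frobenius (toCoords w))
      ≡⟨ combination-⊕ v (map frobenius (toCoords u)) (map frobenius (toCoords w)) ⟩
    τ u ⊕ τ w ∎

  τ-· : ∀ c u → τ (c · u) ≡ frobenius c · τ u
  τ-· c u = begin
    fromCoords (map frobenius (toCoords (c · u)))
      ≡⟨ cong (fromCoords ∘ map frobenius) (toCoords-· c u) ⟩
    fromCoords (map frobenius (c · toCoords u))
      ≡⟨ cong fromCoords (map-frobenius-· c (toCoords u)) ⟩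
    fromCoords (frobenius c · map frobenius (toCoords u))
      ≡⟨ combination-· v (frobenius c) (map frobenius (toCoords u)) ⟩
    frobenius c · τ u ∎

  τ-involutive : ∀ u → τ (τ u) ≡ u
  τ-involutive u = begin
    fromCoords (map frobenius (toCoords (fromCoords (map frobenius (toCoords u)))))
      ≡⟨ cong (fromCoords ∘ map frobenius) (toCoords∘fromCoords (map frobenius (toCoords u))) ⟩
    fromCoords (map frobenius (map frobenius (toCoords u)))
      ≡⟨ cong fromCoords (map-frobenius-involutive (toCoords u)) ⟩
    fromCoords (toCoords u)
      ≡⟨ fromCoords∘toCoords u ⟩
    u ∎

  τ≢𝟎 : ∀ u → τ u ≡ 𝟎 → u ≡ 𝟎
  τ≢𝟎 u eq = begin
    u              ≡⟨ τ-involutive u ⟨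
    τ (τ u)        ≡⟨ cong τ (trans eq (sym (·-zeroˡ (𝟎 {4})))) ⟩
    τ (O · 𝟎)      ≡⟨ τ-· O 𝟎 ⟩
    O · τ 𝟎        ≡⟨ ·-zeroˡ (τ 𝟎) ⟩
    𝟎              ∎

  τ-embed : ∀ x → τ (embedBits v x) ≡ embedBits v x
  τ-embed x = cong fromCoords (trans (cong (map frobenius) (toCoords∘fromCoords (map ι x))) (map-frobenius-ι x))

  h-τ : ∀ u w → h u (τ w) ≡ frobenius (h (τ u) w)
  h-τ u w = begin
    h u (τ w)                    ≡⟨ cong (λ t → h t (τ w)) (τ-involutive u) ⟨
    h (τ (τ u)) (τ w)            ≡⟨ h-fromCoords (map frobenius (toCoords (τ u))) (map frobenius (toCoords w)) ⟩
    h₀ (map frobenius (toCoords (τ u))) (map frobenius (toCoords w))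
                                 ≡⟨ h₀-frobenius (toCoords (τ u)) (toCoords w) ⟩
    frobenius (h₀ (toCoords (τ u)) (toCoords w))
                                 ≡⟨ cong frobenius (h₀-toCoords (τ u) w) ⟩
    frobenius (h (τ u) w)        ∎

  h-τ-swap : ∀ u w → h u (τ w) ≡ O → h w (τ u) ≡ O
  h-τ-swap u w eq = h-swap {τ u} {w} (begin
    h (τ u) w                          ≡⟨ frobenius-involutive _ ⟨
    frobenius (frobenius (h (τ u) w))  ≡⟨ cong frobenius (h-τ u w) ⟨
    frobenius (h u (τ w))              ≡⟨ cong frobenius eq ⟩
    O                                  ∎)

  form~ : L₄.Form 4
  form~ u w = h u (τ w)

  form~-symplectic : L₄.IsSymplectic form~
  form~-symplectic = record
    { bilinear = record
      { additiveˡ    = λ u u′ w → h.additiveˡ u u′ (τ w)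
      ; additiveʳ    = λ u w w′ → trans (cong (h u) (τ-⊕ w w′)) (h.additiveʳ u (τ w) (τ w′))
      ; homogeneousˡ = λ c u w → h.homogeneousˡ c u (τ w)
      ; homogeneousʳ = λ c u w → trans (cong (h u) (τ-· c w)) (trans (h.homogeneousʳ (frobenius c) u (τ w))
          (cong (_*₄ h u (τ w)) (frobenius-involutive c))) }
    ; alternating = λ u → begin
        h u (τ u)                                          ≡⟨ cong (λ t → h t (τ u)) (fromCoords∘toCoords u) ⟨
        h (fromCoords (toCoords u)) (τ u)
          ≡⟨ h-fromCoords (toCoords u) (map frobenius (toCoords u)) ⟩
        h₀ (toCoords u) (map frobenius (toCoords u))       ≡⟨ h₀-alternating (toCoords u) ⟩
        O                                                  ∎
    ; nonDegenerate = λ u u⊥ → nonDegenerate u λ w → trans (cong (h u) (sym (τ-involutive w))) (u⊥ (τ w)) }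
    where
    h₀-alternating : ∀ a → h₀ a (map frobenius a) ≡ O
    h₀-alternating = decide (all? search-Vector λ a → h₀ a (map frobenius a) ≟₄ O)

  form~-extends : ∀ x y → form~ (embedBits v x) (embedBits v y) ≡ ι (f₀ x y)
  form~-extends x y = begin
    h (embedBits v x) (τ (embedBits v y))  ≡⟨ cong (h (embedBits v x)) (τ-embed y) ⟩
    h (embedBits v x) (embedBits v y)      ≡⟨ h-fromCoords (map ι x) (map ι y) ⟩
    h₀ (map ι x) (map ι y)                 ≡⟨ h₀-ι x y ⟩
    ι (f₀ x y)                             ∎
    where
    h₀-ι : ∀ x y → h₀ (map ι x) (map ι y) ≡ ι (f₀ x y)
    h₀-ι = decide (all? search-Bits λ x → all? search-Bits λ y → h₀ (map ι x) (map ι y) ≟₄ ι (f₀ x y))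

  open Collineation frobenius (λ c c≢O → x*y≢O c c c≢O c≢O) τ τ-· τ≢𝟎 public renaming (image to σ; ∼-image to ∼-σ)

  σ-involutive : ∀ p → σ (σ p) ≡ p
  σ-involutive p = ∼-unique {q = p} (∼-σ (∼-σ (coords-∼ p)))
    (subst (_∼ p) (sym (τ-involutive (coords p))) (coords-∼ p))

  σ-involution : IsSemilinearInvolution σ
  σ-involution = record
    { θ = frobenius ; T = τ
    ; semilinear = record
      { automorphism = frobenius-automorphism ; additive = τ-⊕ ; homogeneous = τ-· ; injective = τ≢𝟎 }
    ; induces = λ p → ∼⇒represents {τ (coords p)} {σ p} (∼-σ (coords-∼ p))
    ; involutive = σ-involutive }

  σ-fixes : ∀ p → p ∈ₛ quadrangle v ⇔ σ p ≡ p
  σ-fixes p = mk⇔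
    (λ p∈ → case to (∈-quadrangle v p) p∈ of λ
      { (x , _ , x∼p) → ∼-unique (subst (_∼ σ p) (τ-embed x) (∼-σ x∼p)) x∼p })
    (λ σp≡p → case ∼-scalar (subst (τ (coords p) ∼_) σp≡p (∼-σ (coords-∼ p))) (coords-∼ p) of λ
      { (c , _ , eq) → case real (toCoords (coords p)) c (frobenius-fixed c eq)
                                 (coords≢𝟎 p ∘ toCoords≢𝟎 (coords p)) of λ
      { (x , d , x≢𝟎 , d≢O , eq′) → from (∈-quadrangle v p) (x , x≢𝟎 , subst (_∼ p) (begin
          d · coords p                          ≡⟨ cong (d ·_) (fromCoords∘toCoords (coords p)) ⟨
          d · fromCoords (toCoords (coords p))  ≡⟨ combination-· v d (toCoords (coords p)) ⟨
          fromCoords (d · toCoords (coords p))  ≡⟨ cong fromCoords eq′ ⟨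
          embedBits v x                         ∎) (∼-· d d≢O (coords-∼ p))) } })
    where
    frobenius-fixed : ∀ c → τ (coords p) ≡ c · coords p → map frobenius (toCoords (coords p)) ≡ c · toCoords (coords p)
    frobenius-fixed c eq = begin
      map frobenius (toCoords (coords p))  ≡⟨ toCoords∘fromCoords _ ⟨
      toCoords (τ (coords p))              ≡⟨ cong toCoords eq ⟩
      toCoords (c · coords p)              ≡⟨ toCoords-· c (coords p) ⟩
      c · toCoords (coords p)              ∎
    real : ∀ a c → map frobenius a ≡ c · a → a ≢ 𝟎 → ∃[ x ] ∃[ d ] (x ≢ L₂.𝟎 × d ≢ O × map ι x ≡ d · a)
    real = decide (all? search-Vector λ a → all? search-𝔽₄ λ c → (map frobenius a ≟ᵥ c · a) →-dec ¬? (a ≟ᵥ 𝟎) →-dec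
      search-Bits λ x → search-𝔽₄ λ d → ¬? (x ≟ᵇ L₂.𝟎) ×-dec ¬? (d ≟₄ O) ×-dec (map ι x ≟ᵥ d · a))

  private
    scalar-nonzero : ∀ {u w : L₄.Vector 4} {c} → u ≢ 𝟎 → u ≡ c · w → c ≢ O
    scalar-nonzero {w = w} u≢𝟎 eq refl = u≢𝟎 (trans eq (·-zeroˡ w))

    vanish : ∀ c {w u u′} → u ≡ c · u′ → h w u′ ≡ O → h w u ≡ O
    vanish c {w} {u} {u′} eq hwu′ = begin
      h w u                    ≡⟨ cong (h w) eq ⟩
      h w (c · u′)             ≡⟨ h.homogeneousʳ c w u′ ⟩
      frobenius c *₄ h w u′    ≡⟨ cong (frobenius c *₄_) hwu′ ⟩
      frobenius c *₄ O         ≡⟨ *-zeroʳ (frobenius c) ⟩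
      O                        ∎

  perp∘perp~ : ∀ p → perp h (perp form~ ｛ p ｝) ≐ ｛ σ p ｝
  perp∘perp~ p =
      (λ {r} r∈ → case double-perp-points (τ (coords p)) (coords r) (coords≢𝟎 p ∘ τ≢𝟎 (coords p)) (λ q hq →
          r∈ q (λ q′ p≡q′ → subst (λ s → form~ (coords s) (coords q) ≡ O) p≡q′
            (h-τ-swap (coords q) (coords p) hq))) of λ
        { (c , eq) → sym (∼-unique (coords-∼ r) (subst (_∼ σ p) (sym eq)
            (∼-· c (scalar-nonzero {coords r} {τ (coords p)} (coords≢𝟎 r) eq) (∼-σ (coords-∼ p))))) })
    , (λ {r} σp≡r q q∈ → case ∼-scalar (subst (coords r ∼_) (sym σp≡r) (coords-∼ r)) (∼-σ (coords-∼ p)) of λ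
        { (c , _ , eq) → vanish c eq (h-τ-swap (coords p) (coords q) (q∈ p refl)) })

  perp~∘perp : ∀ p → perp form~ (perp h ｛ p ｝) ≐ ｛ σ p ｝
  perp~∘perp p =
      (λ {r} r∈ → case double-perp-points (coords p) (τ (coords r)) (coords≢𝟎 p) (λ q hq →
          r∈ q (λ q′ p≡q′ → subst (λ s → h (coords s) (coords q) ≡ O) p≡q′ (h-swap {coords q} {coords p} hq))) of λ
        { (c , eq) → trans (cong σ (∼-unique (subst (_∼ p) (sym eq)
            (∼-· c (scalar-nonzero {τ (coords r)} {coords p} (coords≢𝟎 r ∘ τ≢𝟎 (coords r)) eq) (coords-∼ p)))
            (∼-σ (coords-∼ r))))
            (σ-involutive r) })
    , (λ {r} σp≡r q q∈ → case ∼-scalar (∼-σ (subst (coords r ∼_) (sym σp≡r) (coords-∼ r)))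
                                       (subst (coords p ∼_) (sym (σ-involutive p)) (coords-∼ p)) of λ
        { (c , _ , eq) → vanish c eq (h-swap {coords p} {coords q} (q∈ p refl)) })

  subquadrangle : SymplecticSubquadrangle h
  subquadrangle = record
    { baer = baer ; form = f₀ ; symplectic = f₀-symplectic
    ; form~ = form~ ; symplectic~ = form~-symplectic ; extends = form~-extends
    ; σ = σ ; σ-involution = σ-involution ; σ-fixes = σ-fixes
    ; perp∘perp~ = perp∘perp~ ; perp~∘perp = perp~∘perp }

  open BaerSubgeometry baer using (Line; Tangent; TotallyIsotropic; Locus)
  open BaerProperties baer

  ovoid-locus : Locus (λ x → Q₀ x ≡ false) (ovoid v)
  ovoid-locus p = mk⇔
    (λ p∈ → map₂ (λ {x} → map₂ (map₂ (∼⇒represents {embedBits v x} {p}))) (to (∈-ovoid v p) p∈))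
    (λ ∃x → from (∈-ovoid v p) (map₂ (λ {x} → map₂ (map₂ (represents⇒∼ {embedBits v x} {p}))) ∃x))

  tangents-isotropic : ∀ ℓ → Tangent (ovoid v) ℓ ⇔ TotallyIsotropic f₀ ℓ
  tangents-isotropic ℓ = mk⇔ tangent⇒ isotropic⇒
    where
    open Line ℓ
    common : Subset (numPoints 4)
    common = line-points ∩ ovoid v

    common⁺ : ∀ {z p} → SingularOn x y z → embedBits v z ∼ p → p ∈ₛ common
    common⁺ {z} {p} (z≢𝟎 , z-at , Qz) z∼p = x∈p∩q⁺
      ( from (line-spec p) (z , z≢𝟎 , z-at , ∼⇒represents {embedBits v z} {p} z∼p)
      , from (∈-ovoid v p) (z , z≢𝟎 , Qz , z∼p))

    common⁻ : ∀ {p} → p ∈ₛ common → ∃[ z ] (SingularOn x y z × embedBits v z ∼ p)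
    common⁻ {p} p∈ = case x∈p∩q⁻ line-points (ovoid v) p∈ of λ
      { (p∈ℓ , p∈O) → case to (line-spec p) p∈ℓ ,′ to (∈-ovoid v p) p∈O of λ
      { ((z , z≢𝟎 , z-at , z∼p) , (z′ , _ , Qz′ , z′∼p)) →
        z , (z≢𝟎 , z-at , subst (λ t → Q₀ t ≡ false)
              (embed-injective {z′} {z} {p} z′∼p (represents⇒∼ {embedBits v z} {p} z∼p)) Qz′)
          , represents⇒∼ {embedBits v z} {p} z∼p } }

    tangent⇒ : ∣ common ∣ ≡ 1 → Isotropic x y
    tangent⇒ ∣common∣≡1 = decidable-stable (isotropic? x y) λ ¬isotropic →
      case nonisotropic⇒nontangent x y ¬isotropic of λ
      { (inj₁ none) → case common⁻ (proj₂ (∣S∣≡1⇒nonempty common ∣common∣≡1)) of λ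
          { (z , z-singular , _) → none z z-singular }
      ; (inj₂ (z , z′ , z-singular , z′-singular , z≢z′)) →
          case pointOf (embedBits v z) (embed≢𝟎 z (proj₁ z-singular)) ,′
               pointOf (embedBits v z′) (embed≢𝟎 z′ (proj₁ z′-singular)) of λ
          { ((p , z∼p) , (q , z′∼q)) → z≢z′ (embed-injective {z} {z′} {p} z∼p (subst (embedBits v z′ ∼_)
              (sym (∣S∣≡1⇒unique ∣common∣≡1 (common⁺ z-singular z∼p) (common⁺ z′-singular z′∼q))) z′∼q)) } }

    isotropic⇒ : Isotropic x y → ∣ common ∣ ≡ 1
    isotropic⇒ isotropic = case isotropic⇒tangent x y isotropic of λ
      { (inj₁ (z , z-singular , unique)) → case pointOf (embedBits v z) (embed≢𝟎 z (proj₁ z-singular)) of λ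
          { (p , z∼p) → unique⇒∣S∣≡1 p (common⁺ z-singular z∼p) λ {q} q∈ → case common⁻ q∈ of λ
          { (z′ , z′-singular , z′∼q) →
              ∼-unique (subst (λ t → embedBits v t ∼ q) (unique z′ z′-singular) z′∼q) z∼p } }
      ; (inj₂ (c , c≢𝟎 , eq)) → contradiction (line-independent c eq) c≢𝟎 }

  ovoid-isEllipticOvoid : IsEllipticOvoidOf subquadrangle (ovoid v)
  ovoid-isEllipticOvoid = record
    { quadric = Q₀ , Q₀-elliptic , ovoid-locus
    ; tangents-generators = tangents-isotropic }

module OrthonormalBasis {h : L₄.Form 4} (unitary : IsUnitary h) where

  open IsUnitary unitary
  open L₄.IsSesquilinear sesquilinear
  open Sesquilinear sesquilinear
  open Perp unitary
  open ≡-Reasoning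

  coefficientsIn : ∀ {k} → Vec (L₄.Vector 4) k → L₄.Vector 4 → L₄.Vector k
  coefficientsIn es u = map (h u) es

  Orthonormal : ∀ {k} → Vec (L₄.Vector 4) k → Set
  Orthonormal es = ∀ a → coefficientsIn es (combination a es) ≡ a

  coefficientsIn-⊕ : ∀ {k} (es : Vec (L₄.Vector 4) k) → IsAdditive (coefficientsIn es)
  coefficientsIn-⊕ []       u w = refl
  coefficientsIn-⊕ (e ∷ es) u w = cong₂ _∷_ (additiveˡ u w e) (coefficientsIn-⊕ es u w)

  coefficientsIn-· : ∀ {k} (es : Vec (L₄.Vector 4) k) c u → coefficientsIn es (c · u) ≡ c · coefficientsIn es u
  coefficientsIn-· []       c u = refl
  coefficientsIn-· (e ∷ es) c u = cong₂ _∷_ (homogeneousˡ c u e) (coefficientsIn-· es c u)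

  module _ {k : ℕ} {es : Vec (L₄.Vector 4) k} (orthonormal : Orthonormal es) where

    projection : L₄.Vector 4 → L₄.Vector 4
    projection u = u ⊕ combination (coefficientsIn es u) es

    projection-⊥ : ∀ u → coefficientsIn es (projection u) ≡ 𝟎
    projection-⊥ u = begin
      coefficientsIn es (projection u)
        ≡⟨ coefficientsIn-⊕ es u _ ⟩
      coefficientsIn es u ⊕ coefficientsIn es (combination (coefficientsIn es u) es)
        ≡⟨ cong (coefficientsIn es u ⊕_) (orthonormal (coefficientsIn es u)) ⟩
      coefficientsIn es u ⊕ coefficientsIn es u
        ≡⟨ ⊕-self _ ⟩
      𝟎 ∎

    projection-⊕ : IsAdditive projection
    projection-⊕ u w = begin
      (u ⊕ w) ⊕ combination (coefficientsIn es (u ⊕ w)) es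
        ≡⟨ cong (λ a → (u ⊕ w) ⊕ combination a es) (coefficientsIn-⊕ es u w) ⟩
      (u ⊕ w) ⊕ combination (coefficientsIn es u ⊕ coefficientsIn es w) es
        ≡⟨ cong ((u ⊕ w) ⊕_) (combination-⊕ es (coefficientsIn es u) (coefficientsIn es w)) ⟩
      (u ⊕ w) ⊕ (combination (coefficientsIn es u) es ⊕ combination (coefficientsIn es w) es)
        ≡⟨ ⊕-interchange u w _ _ ⟩
      projection u ⊕ projection w ∎

    projection-· : ∀ c u → projection (c · u) ≡ c · projection u
    projection-· c u = begin
      c · u ⊕ combination (coefficientsIn es (c · u)) es
        ≡⟨ cong (λ a → c · u ⊕ combination a es) (coefficientsIn-· es c u) ⟩
      c · u ⊕ combination (c · coefficientsIn es u) es
        ≡⟨ cong (c · u ⊕_) (combination-· es c (coefficientsIn es u)) ⟩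
      c · u ⊕ c · combination (coefficientsIn es u) es
        ≡⟨ ·-distribˡ c u _ ⟨
      c · projection u ∎

    combination-⊥ : ∀ u a → coefficientsIn es u ≡ 𝟎 → h u (combination a es) ≡ O
    combination-⊥ u a eq =
      trans (combinationʳ u a es) (trans (cong (dot (map frobenius a)) eq) (dot-𝟎 (map frobenius a)))
      where
      dot-𝟎 : ∀ {n} (b : L₄.Vector n) → dot b 𝟎 ≡ O
      dot-𝟎 []      = refl
      dot-𝟎 (x ∷ b) = cong₂ _+₄_ (*-zeroʳ x) (dot-𝟎 b)

    -- Polarising u ↦ h u u at u + w and at ω u + w shows that a form
    -- without anisotropic vectors is zero.
    projection-trivial : (∀ u → h (projection u) (projection u) ≡ O) → ∀ u → projection u ≡ 𝟎
    projection-trivial isotropic u = nonDegenerate (projection u) λ w → begin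
      h (projection u) w
        ≡⟨ +-identityʳ _ ⟨
      h (projection u) w +₄ O
        ≡⟨ cong (h (projection u) w +₄_) (combination-⊥ (projection u) (coefficientsIn es w) (projection-⊥ u)) ⟨
      h (projection u) w +₄ h (projection u) (combination (coefficientsIn es w) es)
        ≡⟨ additiveʳ (projection u) w _ ⟨
      h (projection u) (projection w)
        ≡⟨ zero-form u w ⟩
      O ∎
      where
      symmetric : ∀ u w → h (projection u) (projection w) ≡ frobenius (h (projection u) (projection w))
      symmetric u w = x+y≡O⇒x≡y _ _ (begin
        h x y +₄ frobenius (h x y)                         ≡⟨ cong (h x y +₄_) (hermitian x y) ⟨
        h x y +₄ h y x                                     ≡⟨ cong (h x y +₄_) (+-identityʳ (h y x)) ⟨
        (O +₄ h x y) +₄ (h y x +₄ O)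
          ≡⟨ cong₂ (λ s t → (s +₄ h x y) +₄ (h y x +₄ t)) (isotropic u) (isotropic w) ⟨
        (h x x +₄ h x y) +₄ (h y x +₄ h y y)               ≡⟨ cong₂ _+₄_ (additiveʳ x x y) (additiveʳ y x y) ⟨
        h x (x ⊕ y) +₄ h y (x ⊕ y)                         ≡⟨ additiveˡ x y (x ⊕ y) ⟨
        h (x ⊕ y) (x ⊕ y)                                  ≡⟨ cong (λ t → h t t) (projection-⊕ u w) ⟨
        h (projection (u ⊕ w)) (projection (u ⊕ w))        ≡⟨ isotropic (u ⊕ w) ⟩
        O                                                  ∎)
        where
        x y : L₄.Vector 4
        x = projection u
        y = projection w
      zero-form : ∀ u w → h (projection u) (projection w) ≡ O
      zero-form u w = fixed (h (projection u) (projection w)) (symmetric u w)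
        (subst (λ t → t ≡ frobenius t)
          (trans (cong (λ t → h t (projection w)) (projection-· ω u)) (homogeneousˡ ω (projection u) (projection w)))
          (symmetric (ω · u) w))
        where
        fixed : ∀ x → x ≡ frobenius x → ω *₄ x ≡ frobenius (ω *₄ x) → x ≡ O
        fixed = decide (all? search-𝔽₄ λ x → (x ≟₄ frobenius x) →-dec (ω *₄ x ≟₄ frobenius (ω *₄ x)) →-dec (x ≟₄ O))

    extend : 4 ℕ.^ k < 4 ℕ.^ 4 → ∃[ e ] Orthonormal (e ∷ es)
    extend k<4 = case ¬∀⇒∃¬ search-Vector (λ u → h (projection u) (projection u) ≟₄ O) (λ isotropic →
        vector-pigeonhole k<4 (coefficientsIn es) (λ {u} {w} eq → begin
          u                                      ≡⟨ u⊕v≡𝟎⇒u≡v u _ (projection-trivial isotropic u) ⟩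
          combination (coefficientsIn es u) es   ≡⟨ cong (λ a → combination a es) eq ⟩
          combination (coefficientsIn es w) es   ≡⟨ u⊕v≡𝟎⇒u≡v w _ (projection-trivial isotropic w) ⟨
          w                                      ∎)) of λ
      { (u , anisotropic) → projection u , extended (projection u) (projection-⊥ u)
          (norm (h (projection u) (projection u)) anisotropic (hermitian (projection u) (projection u))) }
      where
      norm : ∀ x → x ≢ O → x ≡ frobenius x → x ≡ I
      norm = decide (all? search-𝔽₄ λ x → ¬? (x ≟₄ O) →-dec (x ≟₄ frobenius x) →-dec (x ≟₄ I))
      extended : ∀ e → coefficientsIn es e ≡ 𝟎 → h e e ≡ I → Orthonormal (e ∷ es)
      extended e e⊥ hee (a ∷ c) = cong₂ _∷_
        (begin
          h (a · e ⊕ combination c es) e         ≡⟨ additiveˡ (a · e) _ e ⟩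
          h (a · e) e +₄ h (combination c es) e
            ≡⟨ cong₂ _+₄_ (homogeneousˡ a e e) (h-swap {e} {combination c es} (combination-⊥ e c e⊥)) ⟩
          a *₄ h e e +₄ O                        ≡⟨ +-identityʳ _ ⟩
          a *₄ h e e                             ≡⟨ cong (a *₄_) hee ⟩
          a *₄ I                                 ≡⟨ *-comm a I ⟩
          a                                      ∎)
        (begin
          coefficientsIn es (a · e ⊕ combination c es)
            ≡⟨ coefficientsIn-⊕ es (a · e) _ ⟩
          coefficientsIn es (a · e) ⊕ coefficientsIn es (combination c es)
            ≡⟨ cong₂ _⊕_ (trans (coefficientsIn-· es a e) (trans (cong (a ·_) e⊥) (·-zeroʳ a))) (orthonormal c) ⟩
          𝟎 ⊕ c
            ≡⟨ trans (zipWith-comm +-comm 𝟎 c) (⊕-identityʳ c) ⟩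
          c ∎)

  orthonormalBasis : ∃ (Orthonormal {4})
  orthonormalBasis =
    case extend {es = []} (λ { [] → refl }) (ℕ.<ᵇ⇒< 1 256 _) of λ
    { (a , a-o) → case extend {es = a ∷ []} a-o (ℕ.<ᵇ⇒< 4 256 _) of λ
    { (b , b-o) → case extend {es = b ∷ a ∷ []} b-o (ℕ.<ᵇ⇒< 16 256 _) of λ
    { (c , c-o) → case extend {es = c ∷ b ∷ a ∷ []} c-o (ℕ.<ᵇ⇒< 64 256 _) of λ
    { (d , d-o) → d ∷ c ∷ b ∷ a ∷ [] , d-o } } } }

  frame-exists : ∃ (IsFrame h)
  frame-exists = case orthonormalBasis of λ
    { (es , orthonormal) → map (λ a → combination a es) F
      , trans (gram-map {h = h} {h′ = λ a b → dot (map frobenius b) a} {T = λ a → combination a es} (λ a b →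
          trans (combinationʳ (combination a es) b es) (cong (dot (map frobenius b)) (orthonormal a))) F) refl }
    where
    F : Vec (L₄.Vector 4) 4
    F = (O ∷ O ∷ I ∷ I ∷ [])
      ∷ (O ∷ O ∷ ω ∷ ω̄ ∷ [])
      ∷ (I ∷ I ∷ ω̄ ∷ ω ∷ [])
      ∷ (ω ∷ ω̄ ∷ ω̄ ∷ ω ∷ []) ∷ []

module OvoidGraph {h : L₄.Form 4} (unitary : IsUnitary h) where

  vertex⇒frame : ∀ {S} → IsVertex h S → ∃[ v ] (IsFrame h v × S ≡ ovoid v)
  vertex⇒frame (W , isOvoid) = v , frame , S≡ovoid
    where open OvoidFrame unitary W isOvoid

  frame⇒vertex : ∀ v → IsFrame h v → IsVertex h (ovoid v)
  frame⇒vertex v frame = subquadrangle , ovoid-isEllipticOvoid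
    where open FrameQuadrangle unitary frame

  adjacent⇒frames : ∀ {S T v w} → IsFrame h v → IsFrame h w → S ≡ ovoid v → T ≡ ovoid w →
    Adjacent h S T → AdjacentFrames v w
  adjacent⇒frames {S} {T} {v} {w} v-frame w-frame S≡ T≡ (∣S∩T∣ , W , W′ , W-ovoid , W′-ovoid , ∣W∩W′∣) =
    adjacentFrames-resp {h} {OW.v} {v} {OW′.v} {w} unitary OW.frame v-frame OW′.frame w-frame
      (trans (sym OW.S≡ovoid) S≡) (trans (sym OW′.S≡ovoid) T≡)
      ( trans (cong₂ (λ A B → ∣ A ∩ B ∣) (sym OW.S≡ovoid) (sym OW′.S≡ovoid)) ∣S∩T∣
      , trans (cong₂ (λ A B → ∣ A ∩ B ∣) (sym OW.points≡quadrangle) (sym OW′.points≡quadrangle)) ∣W∩W′∣)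
    where
    module OW  = OvoidFrame unitary W W-ovoid
    module OW′ = OvoidFrame unitary W′ W′-ovoid

  frames⇒adjacent : ∀ {v w} → IsFrame h v → IsFrame h w → AdjacentFrames v w → Adjacent h (ovoid v) (ovoid w)
  frames⇒adjacent v-frame w-frame (∣O∣ , ∣W∣) =
    ∣O∣ , subquadrangle unitary v-frame , subquadrangle unitary w-frame
        , ovoid-isEllipticOvoid unitary v-frame , ovoid-isEllipticOvoid unitary w-frame , ∣W∣
    where open FrameQuadrangle

  adjacent-sym : ∀ {S T} → Adjacent h S T → Adjacent h T S
  adjacent-sym {S} {T} (∣S∩T∣ , W , W′ , W-ovoid , W′-ovoid , ∣W∩W′∣) =
    trans (cong ∣_∣ (∩-comm T S)) ∣S∩T∣ , W′ , W , W′-ovoid , W-ovoid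
    , trans (cong ∣_∣ (∩-comm (points W′) (points W))) ∣W∩W′∣
    where open SymplecticSubquadrangle using (points)

  adjacent-irrefl : ∀ {S} → IsVertex h S → ¬ Adjacent h S S
  adjacent-irrefl {S} S-vertex S∼S = go (vertex⇒frame S-vertex)
    where
    go : ∃[ v ] (IsFrame h v × S ≡ ovoid v) → ⊥
    go (v , frame , S≡) = FromFrame.¬self-adjacent unitary frame (adjacent⇒frames {v = v} {v} frame frame S≡ S≡ S∼S)

  module MaximalClique {C : List PointSet} (maximalClique : IsMaximalClique (IsVertex h) (Adjacent h) C) where

    open IsMaximalClique maximalClique
    open IsClique clique

    not-extensible : ∀ {S} → IsVertex h S → ¬ (∀ {T} → T ∈ₗ C → Adjacent h S T)
    not-extensible {S} S-vertex S∼ = S∉C (maximal (S ∷ C) extension there (here refl))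
      where
      S∉C : ¬ (S ∈ₗ C)
      S∉C S∈C = adjacent-irrefl S-vertex (S∼ S∈C)
      extension : IsClique (IsVertex h) (Adjacent h) (S ∷ C)
      extension = record
        { unique   = Allₗ.tabulate (λ T∈ S≡T → S∉C (subst (_∈ₗ C) (sym S≡T) T∈)) ∷ unique
        ; vertices = λ { (here refl) → S-vertex ; (there T∈) → vertices T∈ }
        ; adjacent = λ
          { (here refl) (here refl) S≢S → contradiction refl S≢S
          ; (here refl) (there U∈)  _   → S∼ U∈
          ; (there T∈)  (here refl) _   → adjacent-sym (S∼ T∈)
          ; (there T∈)  (there U∈)  T≢U → adjacent T∈ U∈ T≢U } }

    frameOf : ∀ {S} → S ∈ₗ C → ∃[ v ] (IsFrame h v × S ≡ ovoid v)
    frameOf S∈ = vertex⇒frame (vertices S∈)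

  open MaximalClique using (not-extensible; frameOf)

  length≡3 : ∀ C → IsMaximalClique (IsVertex h) (Adjacent h) C → length C ≡ 3
  length≡3 [] maximalClique = contradiction (OrthonormalBasis.frame-exists unitary) λ (v , frame) →
    not-extensible maximalClique (frame⇒vertex v frame) λ ()
  length≡3 (S ∷ []) maximalClique = contradiction (frameOf maximalClique (here refl)) go
    where
    go : ¬ (∃[ v ] (IsFrame h v × S ≡ ovoid v))
    go (v , v-frame , S≡) = extend (neighbour-exists unitary v-frame)
      where
      extend : ¬ (∃[ w ] (IsFrame h w × AdjacentFrames v w))
      extend (w , w-frame , v∼w) = not-extensible maximalClique (frame⇒vertex w w-frame) λ
        { (here refl) → adjacent-sym (subst (λ T → Adjacent h T (ovoid w)) (sym S≡)
            (frames⇒adjacent {v} {w} v-frame w-frame v∼w)) }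
  length≡3 (S ∷ T ∷ []) maximalClique =
    contradiction (frameOf maximalClique (here refl)) λ v-data →
    contradiction (frameOf maximalClique (there (here refl))) (go v-data)
    where
    open IsClique (IsMaximalClique.clique maximalClique)
    S∼T : Adjacent h S T
    S∼T = adjacent (here refl) (there (here refl)) (distinct unique)
      where
      distinct : Unique (S ∷ T ∷ []) → S ≢ T
      distinct ((S≢T ∷ _) ∷ _) = S≢T
    go : ∃[ v ] (IsFrame h v × S ≡ ovoid v) → ¬ (∃[ w ] (IsFrame h w × T ≡ ovoid w))
    go (v , v-frame , S≡) (w , w-frame , T≡) = extend (common-neighbour-exists unitary v-frame {w} w-frame
        (adjacent⇒frames {v = v} {w} v-frame w-frame S≡ T≡ S∼T))
      where
      extend : ¬ (∃[ u ] (IsFrame h u × AdjacentFrames v u × AdjacentFrames w u))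
      extend (u , u-frame , v∼u , w∼u) = not-extensible maximalClique (frame⇒vertex u u-frame) λ
        { (here refl) → adjacent-sym (subst (λ X → Adjacent h X (ovoid u)) (sym S≡)
            (frames⇒adjacent {v} {u} v-frame u-frame v∼u))
        ; (there (here refl)) → adjacent-sym (subst (λ X → Adjacent h X (ovoid u)) (sym T≡)
            (frames⇒adjacent {w} {u} w-frame u-frame w∼u)) }
  length≡3 (_ ∷ _ ∷ _ ∷ []) _ = refl
  length≡3 (S ∷ T ∷ U ∷ V ∷ C) maximalClique =
    ⊥-elim (go (frameOf maximalClique S∈) (frameOf maximalClique T∈)
               (frameOf maximalClique U∈) (frameOf maximalClique V∈) unique)
    where
    open IsClique (IsMaximalClique.clique maximalClique)
    S∈ : S ∈ₗ S ∷ T ∷ U ∷ V ∷ C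
    S∈ = here refl
    T∈ : T ∈ₗ S ∷ T ∷ U ∷ V ∷ C
    T∈ = there (here refl)
    U∈ : U ∈ₗ S ∷ T ∷ U ∷ V ∷ C
    U∈ = there (there (here refl))
    V∈ : V ∈ₗ S ∷ T ∷ U ∷ V ∷ C
    V∈ = there (there (there (here refl)))
    FrameFor : PointSet → Set
    FrameFor X = ∃[ v ] (IsFrame h v × X ≡ ovoid v)
    go : FrameFor S → FrameFor T → FrameFor U → FrameFor V → Unique (S ∷ T ∷ U ∷ V ∷ C) → ⊥
    go (s , s-frame , S≡) (t , t-frame , T≡) (u , u-frame , U≡) (v , v-frame , V≡)
       ((S≢T ∷ S≢U ∷ S≢V ∷ _) ∷ (T≢U ∷ T≢V ∷ _) ∷ (U≢V ∷ _) ∷ _) =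
      no-tetrahedron unitary s-frame {t} {u} {v} t-frame u-frame v-frame
        (adjacent⇒frames {v = s} {t} s-frame t-frame S≡ T≡ (adjacent S∈ T∈ S≢T))
        (adjacent⇒frames {v = s} {u} s-frame u-frame S≡ U≡ (adjacent S∈ U∈ S≢U))
        (adjacent⇒frames {v = s} {v} s-frame v-frame S≡ V≡ (adjacent S∈ V∈ S≢V))
        (adjacent⇒frames {v = t} {u} t-frame u-frame T≡ U≡ (adjacent T∈ U∈ T≢U))
        (adjacent⇒frames {v = t} {v} t-frame v-frame T≡ V≡ (adjacent T∈ V∈ T≢V))
        (adjacent⇒frames {v = u} {v} u-frame v-frame U≡ V≡ (adjacent U∈ V∈ U≢V))

lemma4p1 : ∀ (h : L₄.Form 4) → IsUnitary h → ∀ (C : List PointSet) →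
    IsMaximalClique (IsVertex h) (Adjacent h) C → length C ≡ 3
lemma4p1 h unitary = OvoidGraph.length≡3 unitary
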